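{- Let $d\ge 3$ be an odd integer and let $\lambda$ be a bar partition. Put $c=\bar c_d(\lambda)$ and $q=\bar q_d(\lambda)$. Then, as multisets, $$\mathcal{B}(\lambda)=\mathcal{B}(c)\cup\tilde{\mathcal{B}}(q),$$ where $$\tilde{\mathcal{B}}(q)=\Big(\overline{\mathcal{B}}(q)\setminus\big[\mathcal{P}(c)\cap\overline{\mathcal{P}}(q)\big]\Big)\cup\big[\mathcal{P}(c)\cap\overline{\mathcal{P}}(q)\big]^{\times 2}.$$
   Context: A bar partition is a partition into distinct parts $\mu=(a_1>a_2>\dots>a_m>0)$, with $m(\mu)=m$ and $|\mu|=\sum a_i$. Its multiset of bar lengths is $\mathcal{B}(\mu)=\bigcup_{1\le i\le m}\big(\{1,\dots,a_i\}\cup\{a_i+a_j\mid j>i\}\setminus\{a_i-a_j\mid j>i\}\big)$, and $\mathcal{P}(\mu)=\{a_1,\dots,a_m\}$ is its set of parts. Partition and multiset conventions: multiset union $\cup$ adds multiplicities, $\setminus$ is multiset difference, $\cap$ takes minimum multiplicities, and $A^{\times2}=\{2a\mid a\in A\}$ (with multiplicities). Young diagrams are drawn in English convention, with node $(r,c)$ in row $r$ and column $c$. For a partition $\nu$, $\nu'_c$ denotes the length of column $c$. The hook at node $(r,c)$ has length $h=\nu_r-c+\nu'_c-r+1$, hand node $(r,\nu_r)$ and foot node $(\nu'_c,c)$. The residue of node $(r,c)$ is $[c-r]_d$, the least non-negative integer congruent to $c-r$ mod $d$. For $0\le i,j\le d-1$, the set $H_{i\to j}(\nu)$ consists of the hooks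 of $\nu$ whose hand node has residue $i$ and whose foot node has residue $[j+1]_d$. The doubled partition $D(\mu)$ is the partition of $2|\mu|$ whose Frobenius symbol is $(a_1,\dots,a_m\mid a_1-1,\dots,a_m-1)$. Equivalently, for $1\le r\le m$, row $r$ has length $a_r+r$ and column $r$ has length $a_r+r-1$. Define two sets of hooks of $D(\mu)$: - $P(D(\mu))$ is the set of hooks at the nodes $(r,m+1)$, $1\le r\le m$; the hook in row $r$ has length $a_r$. - $B(D(\mu))$ is the set of hooks at the nodes $(r,c)$ with $1\le r\le m$, $r<c\le r+a_r$ and $c\ne m+1$. The lengths of the hooks in $P(D(\mu))\cup B(D(\mu))$ form exactly the multiset $\mathcal{B}(\mu)$. $d$-abacus: for a partition $\nu$, let $k$ be the least multiple of $d$ that is at least the number of nonzero parts of $\nu$. The minimally normalized $\beta$-set of $\nu$ is $X=\{\nu_s+k-s\mid 1\le s\le k\}$, and runner $i$ consists of the elements of $X$ congruent to $i$ mod $d$. The $d$-quotient of $\nu$ is the tuple of partitions whose $\beta$-sets are $\{(x-i)/d\mid x\in X,\ x\equiv i \bmod d\}$, $0\le i\le d-1$, computed with such a normalized $\beta$-set. The $d$-core is obtained by removing all hooks of length divisible by $d$. $\bar c_d(\lambda)$ is the $\bar d$-core of $\lambda$: it is obtained from $\lambda$ by removing all bars of length divisible by $d$, and it is the bar partition whose double $D(\bar c_d(\lambda))$ is the $d$-core of $D(\lambda)$. $\bar q_d(\lambda)$ is the $\bar d$-quotient partition: the unique bar partition $\mu$ such that $D(\mu)$ has empty $d$-core and the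 same $d$-quotient as $D(\lambda)$. Let $x_i$ be the number of beads on runner $i$ of the minimally normalized $d$-abacus of $D(\lambda)$. For a hook $z\in H_{i\to j}(D(q))$, its modified length is $\bar h(z)=h(z)+(x_i-x_j)d$. Then - $\overline{\mathcal{B}}(q)$ is the multiset $\{|\bar h(z)|\mid z\in P(D(q))\cup B(D(q))\}$; - $\overline{\mathcal{P}}(q)$ is the multiset $\{|\bar h(z)|\mid z\in P(D(q))\}$. -}

module Defs where

open import Data.Nat using (ℕ; zero; suc; _+_; _*_; _∸_; _≤_; _<_; NonZero; _≡ᵇ_; _≤ᵇ_; _<ᵇ_)
open import Data.Nat.DivMod using (_/_; _%_)
import Data.Integer as ℤ
open ℤ using (ℤ; ∣_∣; _%ℕ_)
open import Data.Bool using (Bool; true; false; if_then_else_; not; _∧_)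
open import Data.List using (List; []; _∷_; _++_; map; concat; concatMap; length; filterᵇ; upTo; reverse)
open import Data.List.Relation.Unary.All using (All)
open import Data.List.Relation.Unary.Linked using (Linked)
open import Data.Product using (_×_; _,_)

[_⋯_] : ℕ → ℕ → List ℕ
[ a ⋯ b ] = map (λ x → a + x) (upTo (suc b ∸ a))

-- r-th entry (1-indexed), 0 if out of range
entry : List ℕ → ℕ → ℕ
entry []       _             = 0
entry (x ∷ xs) zero          = 0
entry (x ∷ xs) (suc zero)    = x
entry (x ∷ xs) (suc (suc r)) = entry xs (suc r)

count : (ℕ → Bool) → List ℕ → ℕ
count p xs = length (filterᵇ p xs)

-- Multisets of naturals are lists, compared up to permutation (_↭_).
-- multiset union is _++_.

removeOne : ℕ → List ℕ → List ℕ
removeOne x []       = []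
removeOne x (y ∷ ys) = if x ≡ᵇ y then ys else y ∷ removeOne x ys

memb : ℕ → List ℕ → Bool
memb x []       = false
memb x (y ∷ ys) = if x ≡ᵇ y then true else memb x ys

_∖_ : List ℕ → List ℕ → List ℕ
xs ∖ []       = xs
xs ∖ (y ∷ ys) = removeOne y xs ∖ ys

_∩_ : List ℕ → List ℕ → List ℕ
[]       ∩ ys = []
(x ∷ xs) ∩ ys = if memb x ys then x ∷ (xs ∩ removeOne x ys) else xs ∩ ys

double : List ℕ → List ℕ
double = map (2 *_)

IsBarPartition : List ℕ → Set
IsBarPartition μ = Linked (λ a b → b < a) μ × All (λ a → 0 < a) μ

bars : List ℕ → List ℕ
bars []         = []
bars (a ∷ rest) = ((([ 1 ⋯ a ]) ++ map (λ x → a + x) rest) ∖ map (a ∸_) rest) ++ bars rest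

parts : List ℕ → List ℕ
parts μ = μ

-- Ordinary partitions (weakly decreasing lists of positive parts)

nonzero : List ℕ → List ℕ
nonzero = filterᵇ (λ x → 0 <ᵇ x)

colLen : List ℕ → ℕ → ℕ
colLen ν c = count (λ x → c ≤ᵇ x) ν

hookLen : List ℕ → ℕ → ℕ → ℕ
hookLen ν r c = (entry ν r + colLen ν c + 1) ∸ (c + r)

-- doubled partition D(μ), Frobenius symbol (a₁,…,a_m | a₁-1,…,a_m-1):
-- row r ≤ m has length a_r + r; row r > m has length #{ j ≤ m : (a_j - 1) + j ≥ r }
D : List ℕ → List ℕ
D μ = nonzero (map (λ r → entry μ r + r) [ 1 ⋯ m ]
               ++ map (λ r → count (λ j → r ≤ᵇ ((entry μ j ∸ 1) + j)) [ 1 ⋯ m ]) [ suc m ⋯ entry μ 1 ])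
  where m = length μ

module _ (d : ℕ) .{{_ : NonZero d}} where

  abacusK : List ℕ → ℕ
  abacusK ν = d * ((length (nonzero ν) + (d ∸ 1)) / d)

  -- minimally normalized β-set X = { ν_s + k - s | 1 ≤ s ≤ k }, in decreasing order
  betaSet : List ℕ → List ℕ
  betaSet ν = map (λ s → entry ν s + k ∸ s) [ 1 ⋯ k ]
    where k = abacusK ν

  beads : List ℕ → ℕ → ℕ
  beads ν i = count (λ x → (x % d) ≡ᵇ i) (betaSet ν)

  -- partition with decreasing β-set b₁ > … > b_n : parts b_s - (n - s)
  fromBeta : List ℕ → List ℕ
  fromBeta bs = nonzero (map (λ s → entry bs s ∸ (n ∸ s)) [ 1 ⋯ n ])
    where n = length bs

  quotientPart : List ℕ → ℕ → List ℕ
  quotientPart ν i = fromBeta (map (λ x → (x ∸ i) / d) (filterᵇ (λ x → (x % d) ≡ᵇ i) (betaSet ν)))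

  quotient : List ℕ → List (List ℕ)
  quotient ν = map (quotientPart ν) [ 0 ⋯ d ∸ 1 ]

  -- d-core: push all beads on each runner to the top of the abacus
  -- (equivalently, remove all hooks of length divisible by d)
  core : List ℕ → List ℕ
  core ν = fromBeta (filterᵇ (λ y → (y / d) <ᵇ beads ν (y % d)) (reverse (upTo (d * k))))
    where k = abacusK ν

  IsBarCore : List ℕ → List ℕ → Set
  IsBarCore λ' c = IsBarPartition c × (D c ≡ core (D λ'))
    where open import Relation.Binary.PropositionalEquality using (_≡_)

  IsBarQuotient : List ℕ → List ℕ → Set
  IsBarQuotient λ' q = IsBarPartition q × (core (D q) ≡ []) × (quotient (D q) ≡ quotient (D λ'))
    where open import Relation.Binary.PropositionalEquality using (_≡_)

  res : ℤ → ℕ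
  res z = z %ℕ d

  PNodes : List ℕ → List (ℕ × ℕ)
  PNodes q = map (λ r → (r , suc (length q))) [ 1 ⋯ length q ]

  BNodes : List ℕ → List (ℕ × ℕ)
  BNodes q = concatMap (λ r → map (λ c → (r , c))
                  (filterᵇ (λ c → not (c ≡ᵇ suc (length q))) [ suc r ⋯ r + entry q r ]))
             [ 1 ⋯ length q ]

  -- |h̄(z)| for the hook z at node (r , c) of D(q), with bead counts x_i from
  -- the abacus of D(λ): z ∈ H_{i→j}, i = [ν_r - r]_d (hand), [j+1]_d = [c - ν'_c]_d (foot)
  modHook : (λ' q : List ℕ) → ℕ × ℕ → ℕ
  modHook λ' q (r , c) =
    ∣ ℤ.+ h ℤ.+ ((ℤ.+ beads Dλ i) ℤ.- (ℤ.+ beads Dλ j)) ℤ.* (ℤ.+ d) ∣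
    where
      ν  = D q
      Dλ = D λ'
      h  = hookLen ν r c
      i  = res ((ℤ.+ entry ν r) ℤ.- (ℤ.+ r))
      j  = res ((ℤ.+ c) ℤ.- (ℤ.+ colLen ν c) ℤ.- (ℤ.+ 1))

  barsBar : (λ' q : List ℕ) → List ℕ
  barsBar λ' q = map (modHook λ' q) (PNodes q ++ BNodes q)

  partsBar : (λ' q : List ℕ) → List ℕ
  partsBar λ' q = map (modHook λ' q) (PNodes q)

  barsTilde : (λ' c q : List ℕ) → List ℕ
  barsTilde λ' c q = (barsBar λ' q ∖ I) ++ double I
    where I = parts c ∩ partsBar λ' q

{-# OPTIONS --safe #-}

-- The doubled partition ν = D(μ) is encoded by S(μ) = {ν_s − s} ⊂ ℤ, which contains
-- exactly one of x and −x for every x ≠ 0 and omits 0.  Hooks of ν are pairs x > y with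
-- x ∈ S(μ), y ∉ S(μ); the reflection (x , y) ↦ (−y , −x) permutes them, and the bars of μ
-- are a choice of one hook from each orbit, apart from the fixed points (x , −x).  Hence
--   2 · bars = hooks + parts − doubled parts,
-- and the same holds for modified lengths.  Let e_i be the charge of runner i of D(λ) and
-- φ(x) = x + e_{x mod d} d.  Then φ is an odd bijection carrying S(q) to S(λ), and
-- u ∈ S(c) iff φ⁻¹(u) < 0.  For fixed u − v = h the hooks of λ, q and c are compared pair
-- by pair; the discrepancy is a sum of S(λ) − S(c) against a d-periodic weight, which
-- vanishes because S(λ) and S(c) have equally many beads on each runner.  Finally
-- h ∈ λ iff exactly one of h ∈ c and h ∈ P̄(q) holds, which produces the intersection terms.
module Submission where

open import Data.Bool using (Bool; true; false; if_then_else_; T; not)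
open import Data.Bool.Properties using (T?)
open import Data.Empty using (⊥; ⊥-elim)
open import Data.Integer as ℤ using (ℤ; +_; -[1+_]; _+_; _-_; _*_; -_; 0ℤ; 1ℤ; +[1+_]; ∣_∣; _%ℕ_; _/ℕ_)
import Data.Integer.DivMod as ℤ-DivMod
import Data.Integer.Properties as ℤₚ
open import Data.Integer.Tactic.RingSolver using (solve-∀)
open import Data.List using (List; []; _∷_; _++_; map; concatMap; length; filterᵇ; upTo; applyUpTo; reverse)
open import Data.List.Membership.Propositional using (_∈_; _∉_)
open import Data.List.Membership.Propositional.Properties using (∈-map⁻; ∈-∃++; ∈-++⁺ˡ; ∈-++⁺ʳ; ∈-++⁻; ∈-map⁺; ∈-upTo⁺; ∈-upTo⁻; ∈-filter⁺; ∈-filter⁻; ∈-downFrom⁺; ∈-applyUpTo⁺; ∈-applyUpTo⁻)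
open import Data.List.Properties using (length-++; length-map; length-upTo; map-∘; map-upTo; length-applyUpTo; length-filter; reverse-upTo; ∷-injective; map-cong-local; map-++)
open import Data.List.Relation.Binary.Permutation.Propositional using (_↭_; refl; prep; swap; trans; ↭-sym; ↭-refl; ↭-trans; ↭-reflexive)
import Data.List.Relation.Binary.Permutation.Propositional.Properties as ↭ₚ
open import Data.List.Relation.Unary.All using (All; []; _∷_)
import Data.List.Relation.Unary.All as All
open import Data.List.Relation.Unary.AllPairs using ([]; _∷_; AllPairs)
import Data.List.Relation.Unary.AllPairs as AllPairs
import Data.List.Relation.Unary.AllPairs.Properties as AllPairsₚ
open import Data.List.Relation.Unary.Any using (here; there)
open import Data.List.Relation.Unary.Linked.Properties using (Linked⇒AllPairs)
open import Data.List.Relation.Unary.Unique.Propositional using (Unique)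
import Data.List.Relation.Unary.Unique.Propositional.Properties as Uniqueₚ
open import Data.Nat as ℕ using (ℕ; zero; suc; _≡ᵇ_; s≤s; z≤n; _<ᵇ_; _≤ᵇ_; NonZero; _≤_)
open import Data.Nat.DivMod using (_/_; _%_; m≡m%n+[m/n]*n; m%n<n; [m+kn]%n≡m%n; m<n⇒m%n≡m; m*n/n≡m)
import Data.Nat.Properties as ℕₚ
open import Data.Product using (∃; ∃₂; _×_; _,_; proj₁; proj₂)
open import Data.Sum using (inj₁; inj₂; _⊎_)
open import Data.Unit using (⊤; tt)
open import Defs
open import Function using (_∘_)
open import Relation.Binary.Definitions using (tri<; tri≈; tri>)
open import Relation.Binary.PropositionalEquality as ≡ using (_≡_; _≢_; refl; sym; cong; cong₂; subst; module ≡-Reasoning; subst₂)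
open import Relation.Nullary using (yes; no; does; ¬_)

-- Hooks are quadratic in membership, yet their comparison is linear. Fix u > v and write s, t for
-- the membership of u, v in S(λ), and s', t' for that in S(c). If φ⁻¹ keeps the order of u and v,
-- then λ and q have the same hook there and c has none. If φ⁻¹ reverses it, λ minus q contributes
-- s(1 - t) - t(1 - s) = s - t, while c contributes s' - t', because S(c) is a half-line in the slid
-- coordinate. For fixed u - v, whether the order is reversed depends only on u mod d; this is the
-- periodic weight.
--
-- With I the intersection of c and P̄(q), the parts satisfy λ + 2I = c + P̄(q). Used once for parts
-- and once for doubled parts in 2 · bars = hooks + parts - doubled parts, this leaves the
-- correction - 2I plus twice the doubled I, and halving gives the stated formula.
--
-- Sums over all integers are infinite, so each length h > 0 gets the finite window from -M to M +
-- h. It is stable under the reflection and M is chosen so large that every part, slid part and bead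
-- entering the sums lies inside. Length 0 is treated apart.

private variable
  A B : Set

-- Sums

∑ : List A → (A → ℤ) → ℤ
∑ []       f = 0ℤ
∑ (x ∷ xs) f = f x + ∑ xs f

∑-cong : ∀ (xs : List A) {f g} → (∀ {x} → x ∈ xs → f x ≡ g x) → ∑ xs f ≡ ∑ xs g
∑-cong []       eq = refl
∑-cong (x ∷ xs) eq = cong₂ _+_ (eq (here refl)) (∑-cong xs (eq ∘ there))

∑-++ : ∀ (xs ys : List A) f → ∑ (xs ++ ys) f ≡ ∑ xs f + ∑ ys f
∑-++ []       ys f = sym (ℤₚ.+-identityˡ _)
∑-++ (x ∷ xs) ys f = ≡.trans (cong (_+_ (f x)) (∑-++ xs ys f)) (sym (ℤₚ.+-assoc (f x) _ _))

∑-map : ∀ (g : A → B) xs f → ∑ (map g xs) f ≡ ∑ xs (f ∘ g)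
∑-map g []       f = refl
∑-map g (x ∷ xs) f = cong (_+_ (f (g x))) (∑-map g xs f)

∑-concatMap : ∀ (g : A → List B) xs f → ∑ (concatMap g xs) f ≡ ∑ xs (λ x → ∑ (g x) f)
∑-concatMap g []       f = refl
∑-concatMap g (x ∷ xs) f =
  ≡.trans (∑-++ (g x) (concatMap g xs) f) (cong (_+_ (∑ (g x) f)) (∑-concatMap g xs f))

∑-0 : ∀ (xs : List A) → ∑ xs (λ _ → 0ℤ) ≡ 0ℤ
∑-0 []       = refl
∑-0 (x ∷ xs) = ≡.trans (ℤₚ.+-identityˡ _) (∑-0 xs)

∑-+ : ∀ (xs : List A) f g → ∑ xs (λ x → f x + g x) ≡ ∑ xs f + ∑ xs g
∑-+ []       f g = refl
∑-+ (x ∷ xs) f g = ≡.trans (cong (_+_ (f x + g x)) (∑-+ xs f g)) (medial (f x) (g x) _ _)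
  where
  medial : ∀ a b c d → a + b + (c + d) ≡ a + c + (b + d)
  medial = solve-∀

∑-neg : ∀ (xs : List A) f → ∑ xs (λ x → - f x) ≡ - ∑ xs f
∑-neg []       f = refl
∑-neg (x ∷ xs) f = ≡.trans (cong (_+_ (- f x)) (∑-neg xs f)) (sym (ℤₚ.neg-distrib-+ (f x) _))

∑-- : ∀ (xs : List A) f g → ∑ xs (λ x → f x - g x) ≡ ∑ xs f - ∑ xs g
∑-- xs f g = ≡.trans (∑-+ xs f _) (cong (_+_ (∑ xs f)) (∑-neg xs g))

∑-*ʳ : ∀ (xs : List A) f c → ∑ xs (λ x → f x * c) ≡ ∑ xs f * c
∑-*ʳ []       f c = refl
∑-*ʳ (x ∷ xs) f c =
  ≡.trans (cong (_+_ (f x * c)) (∑-*ʳ xs f c)) (sym (ℤₚ.*-distribʳ-+ c (f x) (∑ xs f)))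

∑-swap : ∀ (xs : List A) (ys : List B) (f : A → B → ℤ) →
  ∑ xs (λ x → ∑ ys (f x)) ≡ ∑ ys (λ y → ∑ xs (λ x → f x y))
∑-swap []       ys f = sym (∑-0 ys)
∑-swap (x ∷ xs) ys f =
  ≡.trans (cong (_+_ (∑ ys (f x))) (∑-swap xs ys f)) (sym (∑-+ ys (f x) _))

∑-↭ : ∀ {xs ys : List A} f → xs ↭ ys → ∑ xs f ≡ ∑ ys f
∑-↭ f refl          = refl
∑-↭ f (prep x p)    = cong (_+_ (f x)) (∑-↭ f p)
∑-↭ f (swap x y p)  = ≡.trans (cong (λ s → f x + (f y + s)) (∑-↭ f p)) (exchange (f x) (f y) _)
  where
  exchange : ∀ a b c → a + (b + c) ≡ b + (a + c)
  exchange = solve-∀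
∑-↭ f (trans p q)   = ≡.trans (∑-↭ f p) (∑-↭ f q)

⟦_⟧ : Bool → ℤ
⟦ true  ⟧ = 1ℤ
⟦ false ⟧ = 0ℤ

∑-filter : ∀ p (xs : List A) f → ∑ (filterᵇ p xs) f ≡ ∑ xs (λ x → ⟦ p x ⟧ * f x)
∑-filter p []       f = refl
∑-filter p (x ∷ xs) f with p x
... | true  = cong₂ _+_ (sym (ℤₚ.*-identityˡ (f x))) (∑-filter p xs f)
... | false = ≡.trans (∑-filter p xs f) (sym (ℤₚ.+-identityˡ _))

δ : ℤ → ℤ → ℤ
δ x y = ⟦ does (x ℤ.≟ y) ⟧

δ-≡ : ∀ {x y} → x ≡ y → δ x y ≡ 1ℤ
δ-≡ {x} {y} eq with x ℤ.≟ y
... | yes _  = refl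
... | no neq = ⊥-elim (neq eq)

δ-≢ : ∀ {x y} → x ≢ y → δ x y ≡ 0ℤ
δ-≢ {x} {y} neq with x ℤ.≟ y
... | yes eq = ⊥-elim (neq eq)
... | no _   = refl

δ-cong : ∀ {x y z w} → (x ≡ y → z ≡ w) → (z ≡ w → x ≡ y) → δ x y ≡ δ z w
δ-cong {x} {y} {z} {w} to from with x ℤ.≟ y
... | yes p = sym (δ-≡ (to p))
... | no ¬p = sym (δ-≢ (¬p ∘ from))

δ-sym : ∀ x y → δ x y ≡ δ y x
δ-sym x y = δ-cong {x} {y} sym sym

δ-subst : ∀ (f : ℤ → ℤ) x y → δ x y * f x ≡ δ x y * f y
δ-subst f x y with x ℤ.≟ y
... | yes refl = refl
... | no _     = refl

∑-δ-∉ : ∀ xs {x} (f : ℤ → ℤ) → x ∉ xs → ∑ xs (λ u → δ u x * f u) ≡ 0ℤ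
∑-δ-∉ xs {x} f x∉ = ≡.trans (∑-cong xs (λ {u} u∈ →
  cong (λ a → a * f u) (δ-≢ {u} {x} (λ { refl → x∉ u∈ })))) (∑-0 xs)

∑-δ : ∀ {xs x} (f : ℤ → ℤ) → Unique xs → x ∈ xs → ∑ xs (λ u → δ u x * f u) ≡ f x
∑-δ {y ∷ xs} f (y∉ ∷ _) (here refl) = ≡.trans
  (cong₂ (λ a b → a * f y + b) (δ-≡ {y} {y} refl) (∑-δ-∉ xs f (λ y∈ → All.lookup y∉ y∈ refl)))
  (one (f y))
  where
  one : ∀ a → 1ℤ * a + 0ℤ ≡ a
  one = solve-∀
∑-δ {y ∷ xs} {x} f (y∉ ∷ u) (there x∈) = ≡.trans
  (cong₂ (λ a b → a * f y + b) (δ-≢ {y} {x} (All.lookup y∉ x∈)) (∑-δ f u x∈))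
  (ℤₚ.+-identityˡ _)

-- Multisets

subset-↭ : ∀ {ys xs : List A} → Unique ys → (∀ {y} → y ∈ ys → y ∈ xs) → ∃ λ zs → xs ↭ ys ++ zs
subset-↭ {ys = []}     {xs} _ _ = xs , ↭-refl
subset-↭ {ys = y ∷ ys} {xs} (y∉ ∷ u) sub with ∈-∃++ (sub (here refl))
... | as , bs , refl with subset-↭ {ys = ys} {as ++ bs} u sub′
  where
  sub′ : ∀ {w} → w ∈ ys → w ∈ as ++ bs
  sub′ w∈ with ∈-++⁻ as (sub (there w∈))
  ... | inj₁ w∈as         = ∈-++⁺ˡ w∈as
  ... | inj₂ (here refl)  = ⊥-elim (All.lookup y∉ w∈ refl)
  ... | inj₂ (there w∈bs) = ∈-++⁺ʳ as w∈bs
... | zs , p = zs , ↭-trans (↭ₚ.shift y as bs) (prep y p)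

-- One inclusion and a length count replace the reverse inclusion, which for the feet of a row would
-- require finding the column of a given gap.
pigeonhole-↭ : ∀ {ys xs : List A} → Unique ys → (∀ {y} → y ∈ ys → y ∈ xs) →
  length xs ℕ.≤ length ys → xs ↭ ys
pigeonhole-↭ {ys = ys} {xs} u sub len with subset-↭ {ys = ys} {xs} u sub
... | []     , p = ↭-trans p (↭ₚ.++-identityʳ ys)
... | z ∷ zs , p = ⊥-elim (ℕₚ.<-irrefl refl (ℕₚ.<-≤-trans
  (ℕₚ.m<m+n (length ys) (s≤s z≤n))
  (ℕₚ.≤-trans (ℕₚ.≤-reflexive (sym (≡.trans (↭ₚ.↭-length p) (length-++ ys)))) len)))

map-unique : ∀ (f : A → B) {xs} → (∀ {x y} → x ∈ xs → y ∈ xs → f x ≡ f y → x ≡ y) →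
  Unique xs → Unique (map f xs)
map-unique f inj []                    = []
map-unique f {x ∷ xs} inj (x∉ ∷ u) = All.tabulate distinct ∷ map-unique f (λ p q → inj (there p) (there q)) u
  where
  distinct : ∀ {z} → z ∈ map f xs → f x ≢ z
  distinct z∈ eq with ∈-map⁻ f z∈
  ... | y , y∈ , refl = All.lookup x∉ y∈ (inj (here refl) (there y∈) eq)

unique-↭ : ∀ {xs ys : List A} → Unique xs → Unique ys →
  (∀ {z} → z ∈ xs → z ∈ ys) → (∀ {z} → z ∈ ys → z ∈ xs) → xs ↭ ys
unique-↭ {xs = xs} {ys} ux uy xs⊆ys ys⊆xs with subset-↭ ux xs⊆ys
... | zs , p = pigeonhole-↭ uy ys⊆xs (ℕₚ.≤-trans (ℕₚ.m≤m+n (length xs) (length zs))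
  (ℕₚ.≤-reflexive (≡.trans (sym (length-++ xs)) (sym (↭ₚ.↭-length p)))))

≡ᵇ-refl : ∀ n → (n ≡ᵇ n) ≡ true
≡ᵇ-refl zero    = refl
≡ᵇ-refl (suc n) = ≡ᵇ-refl n

≡ᵇ⇒≡ : ∀ m {n} → (m ≡ᵇ n) ≡ true → m ≡ n
≡ᵇ⇒≡ m {n} eq = ℕₚ.≡ᵇ⇒≡ m n (subst T (sym eq) _)

memb⇒∈ : ∀ x ys → memb x ys ≡ true → x ∈ ys
memb⇒∈ x (y ∷ ys) eq with x ≡ᵇ y in e
... | true  = here (≡ᵇ⇒≡ x e)
... | false = there (memb⇒∈ x ys eq)

∈⇒memb : ∀ {x ys} → x ∈ ys → memb x ys ≡ true
∈⇒memb {x} (here refl) rewrite ≡ᵇ-refl x = refl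
∈⇒memb {x} {y ∷ _} (there x∈) with x ≡ᵇ y
... | true  = refl
... | false = ∈⇒memb x∈

memb-∉ : ∀ {x ys} → memb x ys ≡ false → x ∉ ys
memb-∉ eq x∈ with () ← ≡.trans (sym eq) (∈⇒memb x∈)

removeOne-↭ : ∀ {x ys} → x ∈ ys → ys ↭ x ∷ removeOne x ys
removeOne-↭ {x} {y ∷ ys} x∈ with x ≡ᵇ y in e
... | true with refl ← ≡ᵇ⇒≡ x e = ↭-refl
removeOne-↭ {x} {y ∷ ys} (here refl) | false with () ← ≡.trans (sym e) (≡ᵇ-refl x)
removeOne-↭ {x} {y ∷ ys} (there x∈)  | false = ↭-trans (prep y (removeOne-↭ x∈)) (swap y x ↭-refl)

-- The difference drops only what it finds, so a usable rule needs `ys` to be contained in `xs`; the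
-- decomposition in the hypothesis supplies this together with the result.
∖-↭ : ∀ ys {xs zs} → xs ↭ ys ++ zs → xs ∖ ys ↭ zs
∖-↭ []       p = p
∖-↭ (y ∷ ys) {xs} {zs} p = ∖-↭ ys (↭ₚ.drop-∷ (↭-trans (↭-sym r) p))
  where
  r : xs ↭ y ∷ removeOne y xs
  r = removeOne-↭ (↭ₚ.∈-resp-↭ (↭-sym p) (here refl))

-- Remainders without a common element are what taking minimum multiplicities amounts to; all later
-- reasoning about the intersection goes through this decomposition.
∩-split : ∀ xs ys → ∃₂ λ as bs →
  (xs ↭ (xs ∩ ys) ++ as) × (ys ↭ (xs ∩ ys) ++ bs) × (∀ {h} → h ∈ as → h ∉ bs)
∩-split []       ys = [] , ys , ↭-refl , ↭-refl , λ ()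
∩-split (x ∷ xs) ys with memb x ys in e
... | true with ∩-split xs (removeOne x ys)
...   | as , bs , p , q , dis =
  as , bs , prep x p , ↭-trans (removeOne-↭ (memb⇒∈ x ys e)) (prep x q) , dis
∩-split (x ∷ xs) ys | false with ∩-split xs ys
...   | as , bs , p , q , dis =
  x ∷ as , bs , ↭-trans (prep x p) (↭-sym (↭ₚ.shift x (xs ∩ ys) as)) , q , dis′
  where
  dis′ : ∀ {h} → h ∈ x ∷ as → h ∉ bs
  dis′ (here refl) h∈ = memb-∉ e (↭ₚ.∈-resp-↭ (↭-sym q) (∈-++⁺ʳ (xs ∩ ys) h∈))
  dis′ (there h∈)     = dis h∈

mult : ℕ → List ℕ → ℕ
mult h []       = 0
mult h (x ∷ xs) = (if h ≡ᵇ x then 1 else 0) ℕ.+ mult h xs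

mult-∑ : ∀ h xs → + mult h xs ≡ ∑ xs (λ x → δ (+ h) (+ x))
mult-∑ h []       = refl
mult-∑ h (x ∷ xs) = ≡.trans (ℤₚ.pos-+ _ (mult h xs)) (cong₂ _+_ (indicator (h ≡ᵇ x)) (mult-∑ h xs))
  where
  indicator : ∀ b → + (if b then 1 else 0) ≡ ⟦ b ⟧
  indicator true  = refl
  indicator false = refl

mult-↭ : ∀ h {xs ys} → xs ↭ ys → mult h xs ≡ mult h ys
mult-↭ h {xs} {ys} p = ℤₚ.+-injective
  (≡.trans (mult-∑ h xs) (≡.trans (∑-↭ _ p) (sym (mult-∑ h ys))))

mult-++ : ∀ h xs ys → mult h (xs ++ ys) ≡ mult h xs ℕ.+ mult h ys
mult-++ h []       ys = refl
mult-++ h (x ∷ xs) ys = ≡.trans (cong (i ℕ.+_) (mult-++ h xs ys)) (sym (ℕₚ.+-assoc i _ _))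
  where
  i = if h ≡ᵇ x then 1 else 0

mult>0⇒∈ : ∀ h xs {n} → mult h xs ≡ suc n → h ∈ xs
mult>0⇒∈ h (x ∷ xs) eq with h ≡ᵇ x in e
... | true  = here (≡ᵇ⇒≡ h e)
... | false = there (mult>0⇒∈ h xs eq)

∉⇒mult≡0 : ∀ h xs → h ∉ xs → mult h xs ≡ 0
∉⇒mult≡0 h xs h∉ with mult h xs in e
... | zero  = refl
... | suc n = ⊥-elim (h∉ (mult>0⇒∈ h xs e))

mult-here : ∀ x xs → mult x (x ∷ xs) ≡ suc (mult x xs)
mult-here x xs rewrite ≡ᵇ-refl x = refl

-- Reduces an identity of multisets to a count for each single length, the form in which hook sums
-- can be compared.
mult≡⇒↭ : ∀ xs ys → (∀ h → mult h xs ≡ mult h ys) → xs ↭ ys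
mult≡⇒↭ []       []       eq = ↭-refl
mult≡⇒↭ []       (y ∷ ys) eq with () ← ≡.trans (eq y) (mult-here y ys)
mult≡⇒↭ (x ∷ xs) ys       eq = ↭-trans (prep x (mult≡⇒↭ xs (removeOne x ys) eq′)) (↭-sym r)
  where
  r : ys ↭ x ∷ removeOne x ys
  r = removeOne-↭ (mult>0⇒∈ x ys (≡.trans (sym (eq x)) (mult-here x xs)))
  eq′ : ∀ h → mult h xs ≡ mult h (removeOne x ys)
  eq′ h = ℕₚ.+-cancelˡ-≡ (if h ≡ᵇ x then 1 else 0) _ _ (≡.trans (eq h) (mult-↭ h r))

-- Integer inequalities

-- The ring solver proves only equations. An inequality is therefore transported by equality of the
-- two differences, and a strict one is first rewritten with `1ℤ +`.
≤-by : ∀ {a b c d} → a ℤ.≤ b → d - c ≡ b - a → c ℤ.≤ d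
≤-by a≤b eq = ℤₚ.0≤i-j⇒j≤i (subst (0ℤ ℤ.≤_) (sym eq) (ℤₚ.i≤j⇒0≤j-i a≤b))

≡-by : ∀ {a b c d} → a ≡ b → d - c ≡ b - a → c ≡ d
≡-by {a} refl eq = sym (ℤₚ.i-j≡0⇒i≡j _ _ (≡.trans eq (ℤₚ.i≡j⇒i-j≡0 {a} refl)))

<⇒1+≤ : ∀ {a b} → a ℤ.< b → 1ℤ + a ℤ.≤ b
<⇒1+≤ = ℤₚ.i<j⇒suc[i]≤j

1+≤⇒< : ∀ {a b} → 1ℤ + a ℤ.≤ b → a ℤ.< b
1+≤⇒< = ℤₚ.suc[i]≤j⇒i<j

-- Windows of consecutive integers

window : ℤ → ℕ → List ℤ
window lo n = map (λ k → lo + + k) (upTo n)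

∈-window⁺ : ∀ {lo n u} → lo ℤ.≤ u → u ℤ.< lo + + n → u ∈ window lo n
∈-window⁺ {lo} {n} {u} lo≤u u<hi = subst (_∈ window lo n) shifted (∈-map⁺ _ (∈-upTo⁺ k<n))
  where
  k = ∣ u - lo ∣
  k≡ : + k ≡ u - lo
  k≡ = ℤₚ.0≤i⇒+∣i∣≡i (ℤₚ.i≤j⇒0≤j-i lo≤u)
  assoc : ∀ a b → a + (b - a) ≡ b
  assoc = solve-∀
  shifted : lo + + k ≡ u
  shifted = ≡.trans (cong (_+_ lo) k≡) (assoc lo u)
  k<n : k ℕ.< n
  k<n = ℤₚ.drop‿+<+ (1+≤⇒< (≤-by (<⇒1+≤ (subst (ℤ._< lo + + n) (sym shifted) u<hi)) (ring lo (+ n) (+ k))))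
    where
    ring : ∀ l n k → n - (1ℤ + k) ≡ l + n - (1ℤ + (l + k))
    ring = solve-∀

∈-window⁻ : ∀ {lo n u} → u ∈ window lo n → (lo ℤ.≤ u) × (u ℤ.< lo + + n)
∈-window⁻ {lo} {n} u∈ with ∈-map⁻ _ u∈
... | k , k∈ , refl = ℤₚ.i≤i+j lo (+ k) , ℤₚ.+-monoʳ-< lo (ℤ.+<+ (∈-upTo⁻ k∈))

window-unique : ∀ lo n → Unique (window lo n)
window-unique lo n = Uniqueₚ.map⁺ (λ {x} {y} eq → ℤₚ.+-injective (≡-by eq (ring lo (+ x) (+ y)))) (Uniqueₚ.upTo⁺ n)
  where
  ring : ∀ l x y → y - x ≡ l + y - (l + x)
  ring = solve-∀

-- The window runs from -M to M + h, which u ↦ h - u maps onto itself. On pairs (u , u - h) this map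
-- is the reflection (x , y) ↦ (- y , - x).
∑-reflect : ∀ M (h : ℕ) f → let W = window (- + M) (suc (M ℕ.+ M ℕ.+ h)) in
  ∑ W (λ u → f (+ h - u)) ≡ ∑ W f
∑-reflect M h f = ≡.trans (sym (∑-map (λ u → + h - u) W f)) (sym (∑-↭ f W↭))
  where
  W = window (- + M) (suc (M ℕ.+ M ℕ.+ h))
  hi : ∀ {u} → u ℤ.< - + M + + (suc (M ℕ.+ M ℕ.+ h)) → u ℤ.≤ + M + + h
  hi {u} u< = ≤-by (<⇒1+≤ u<) (ring (+ M) (+ h) u)
    where
    ring : ∀ m h u → m + h - u ≡ - m + (1ℤ + (m + m + h)) - (1ℤ + u)
    ring = solve-∀
  W↭ : W ↭ map (λ u → + h - u) W
  W↭ = pigeonhole-↭ (Uniqueₚ.map⁺ inj (window-unique (- + M) _)) sub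
         (ℕₚ.≤-reflexive (sym (length-map _ W)))
    where
    cancel : ∀ h u → h - (h - u) ≡ u
    cancel = solve-∀
    inj : ∀ {u v} → + h - u ≡ + h - v → u ≡ v
    inj {u} {v} eq = ≡.trans (sym (cancel (+ h) u)) (≡.trans (cong (λ z → + h - z) eq) (cancel (+ h) v))
    sub : ∀ {y} → y ∈ map (λ u → + h - u) W → y ∈ W
    sub y∈ with ∈-map⁻ _ y∈
    ... | u , u∈ , refl with ∈-window⁻ { - + M} {suc (M ℕ.+ M ℕ.+ h)} u∈
    ... | lo≤ , <hi = ∈-window⁺ (≤-by (hi <hi) (ring₁ (+ M) (+ h) u))
                        (1+≤⇒< (≤-by lo≤ (ring₂ (+ M) (+ h) u)))
      where
      ring₁ : ∀ m h u → (h - u) - (- m) ≡ (m + h) - u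
      ring₁ = solve-∀
      ring₂ : ∀ m h u → (- m + (1ℤ + (m + m + h))) - (1ℤ + (h - u)) ≡ u - (- m)
      ring₂ = solve-∀

-- The integers of absolute value below `a`; for `a` = 0 the truncated length is 0 and the list is
-- empty.
ball : ℕ → List ℤ
ball a = window (1ℤ - + a) (a ℕ.+ a ℕ.∸ 1)

∈-ball⁺ : ∀ {a y} → ∣ y ∣ ℕ.< a → y ∈ ball a
∈-ball⁺ {suc a} {y} (s≤s ∣y∣≤a) = ∈-window⁺ (lower y ∣y∣≤a)
  (1+≤⇒< (≤-by (upper y ∣y∣≤a) (ring (+ a) y)))
  where
  ring : ∀ a y → (1ℤ - (1ℤ + a) + (a + (1ℤ + a))) - (1ℤ + y) ≡ a - y
  ring = solve-∀
  upper : ∀ y → ∣ y ∣ ℕ.≤ a → y ℤ.≤ + a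
  upper (+ n)    le = ℤ.+≤+ le
  upper -[1+ n ] le = ℤ.-≤+
  lower : ∀ y → ∣ y ∣ ℕ.≤ a → 1ℤ - +[1+ a ] ℤ.≤ y
  lower y le = ≤-by (upper (- y) (subst (ℕ._≤ a) (sym (ℤₚ.∣-i∣≡∣i∣ y)) le)) (ring₂ (+ a) y)
    where
    ring₂ : ∀ a y → y - (1ℤ - (1ℤ + a)) ≡ a - (- y)
    ring₂ = solve-∀

∈-ball⁻ : ∀ {a y} → y ∈ ball a → ∣ y ∣ ℕ.< a
∈-ball⁻ {suc a} {y} y∈ with ∈-window⁻ {1ℤ - +[1+ a ]} {suc a ℕ.+ suc a ℕ.∸ 1} y∈
... | lo≤ , <hi = s≤s (abs y (≤-by lo≤ (ring₁ (+ a) y)) (≤-by (<⇒1+≤ <hi) (ring₂ (+ a) y)))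
  where
  ring₁ : ∀ a y → a - (- y) ≡ y - (1ℤ - (1ℤ + a))
  ring₁ = solve-∀
  ring₂ : ∀ a y → a - y ≡ (1ℤ - (1ℤ + a) + (a + (1ℤ + a))) - (1ℤ + y)
  ring₂ = solve-∀
  abs : ∀ y → - y ℤ.≤ + a → y ℤ.≤ + a → ∣ y ∣ ℕ.≤ a
  abs (+ n)    _ (ℤ.+≤+ p) = p
  abs -[1+ n ] (ℤ.+≤+ p) _ = p

-- The Maya diagram of D(μ)

-- For ν = D(μ) this is the set of all ν_s − s.
S : List ℕ → ℤ → Bool
S μ (+ n)    = memb n μ
S μ -[1+ n ] = not (memb (suc n) μ)

pos : List ℕ → ℤ → ℤ
pos μ (+ n)    = ⟦ memb n μ ⟧
pos μ -[1+ n ] = 0ℤ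

∑-δ-pos : ∀ μ x → Unique μ → ∑ μ (λ a → δ (+ a) x) ≡ pos μ x
∑-δ-pos []      (+ n)    u = refl
∑-δ-pos (a ∷ μ) (+ n)    (a∉ ∷ u) with n ≡ᵇ a in e | a ≡ᵇ n in e′
... | true  | true  with refl ← ≡ᵇ⇒≡ n e = cong (_+_ 1ℤ) (≡.trans (∑-δ-pos μ (+ n) u) (zero′ (memb n μ) refl))
  where
  zero′ : ∀ b → memb n μ ≡ b → ⟦ b ⟧ ≡ 0ℤ
  zero′ true  eq = ⊥-elim (All.lookup a∉ (memb⇒∈ n μ eq) refl)
  zero′ false eq = refl
... | false | false = ≡.trans (ℤₚ.+-identityˡ _) (∑-δ-pos μ (+ n) u)
... | true  | false with refl ← ≡ᵇ⇒≡ n e with () ← ≡.trans (sym e′) (≡ᵇ-refl n)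
... | false | true  with refl ← ≡ᵇ⇒≡ a e′ with () ← ≡.trans (sym e) (≡ᵇ-refl n)
∑-δ-pos μ       -[1+ n ] u = ∑-0 μ

-- Encodes the bars contributed by the part `a`: a nonnegative gap y gives the length a - y that
-- survives the removal of differences of parts, and a negative gap y = -b, where b is a smaller
-- part, gives a + b.
gaps : List ℕ → ℕ → List ℤ
gaps μ a = filterᵇ (not ∘ S μ) (ball a)

<ᵇ-true : ∀ {m n} → m ℕ.< n → (m <ᵇ n) ≡ true
<ᵇ-true {zero}  {suc n} _       = refl
<ᵇ-true {suc m} {suc n} (s≤s p) = <ᵇ-true p

<ᵇ-false : ∀ {m n} → ¬ m ℕ.< n → (m <ᵇ n) ≡ false
<ᵇ-false {m}     {zero}  _ = refl
<ᵇ-false {zero}  {suc n} p = ⊥-elim (p (s≤s z≤n))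
<ᵇ-false {suc m} {suc n} p = <ᵇ-false (p ∘ s≤s)

<ᵇ⇒< : ∀ {m n} → (m <ᵇ n) ≡ true → m ℕ.< n
<ᵇ⇒< {m} {n} eq = ℕₚ.<ᵇ⇒< m n (subst T (sym eq) _)

∑-ball-δ : ∀ a z f → ∑ (ball a) (λ y → δ y z * f y) ≡ ⟦ ∣ z ∣ <ᵇ a ⟧ * f z
∑-ball-δ a z f with ∣ z ∣ ℕₚ.<? a
... | yes p rewrite <ᵇ-true p =
  ≡.trans (∑-δ f (window-unique (1ℤ - + a) (a ℕ.+ a ℕ.∸ 1)) (∈-ball⁺ p)) (sym (ℤₚ.*-identityˡ (f z)))
... | no ¬p rewrite <ᵇ-false ¬p = ∑-δ-∉ (ball a) f (¬p ∘ ∈-ball⁻)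

⟨_<_⟩ : ℤ → ℤ → ℤ
⟨ x < y ⟩ = ⟦ does (x ℤ.<? y) ⟧

-- The unordered pair {x , y} is a hook of D(μ) when S μ contains its larger element only.
hook : List ℕ → ℤ → ℤ → ℤ
hook μ x y = ⟦ S μ x ⟧ * ⟦ not (S μ y) ⟧ * ⟨ y < x ⟩ + ⟦ S μ y ⟧ * ⟦ not (S μ x) ⟧ * ⟨ x < y ⟩

-- Of a hook and its reflection, the test on absolute values keeps the one whose member of S has the
-- larger absolute value; being the larger entry too, that member is positive.
bar : List ℕ → ℤ → ℤ → ℤ
bar μ x y = pos μ x * (⟦ ∣ y ∣ <ᵇ ∣ x ∣ ⟧ * ⟦ not (S μ y) ⟧)

-- Indexed by the three tests at once, so that a match substitutes only consistent triples of
-- Booleans in a goal.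
data Compareᵇ (m n : ℕ) : Bool → Bool → Bool → Set where
  less    : Compareᵇ m n true false false
  equal   : m ≡ n → Compareᵇ m n false true false
  greater : Compareᵇ m n false false true

compareᵇ : ∀ m n → Compareᵇ m n (m <ᵇ n) (m ≡ᵇ n) (n <ᵇ m)
compareᵇ zero    zero    = equal refl
compareᵇ zero    (suc n) = less
compareᵇ (suc m) zero    = greater
compareᵇ (suc m) (suc n) with m <ᵇ n | m ≡ᵇ n | n <ᵇ m | compareᵇ m n
... | _ | _ | _ | less     = less
... | _ | _ | _ | equal eq = equal (cong suc eq)
... | _ | _ | _ | greater  = greater

-- The reflection (x , y) ↦ (− y , − x) permutes the hooks, and bar selects one of each orbit.  The
-- corrections are the fixed points x = − y and the pairs with an entry 0, whose reflections are not hooks.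
fold-pointwise : ∀ μ → memb 0 μ ≡ false → ∀ x y → x ≢ y →
  bar μ x y + bar μ y x + (bar μ (- y) (- x) + bar μ (- x) (- y)) + δ x (- y) * (pos μ x + pos μ y)
    ≡ hook μ x y + (δ y 0ℤ * pos μ (- x) + δ x 0ℤ * pos μ (- y))
fold-pointwise μ 0∉ +[1+ m ] +[1+ n ] x≢y with n <ᵇ m | m <ᵇ n | memb (suc m) μ | memb (suc n) μ
... | true  | true  | true  | true  = refl
... | true  | true  | true  | false = refl
... | true  | true  | false | true  = refl
... | true  | true  | false | false = refl
... | true  | false | true  | true  = refl
... | true  | false | true  | false = refl
... | true  | false | false | true  = refl
... | true  | false | false | false = refl
... | false | true  | true  | true  = refl
... | false | true  | true  | false = refl
... | false | true  | false | true  = refl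
... | false | true  | false | false = refl
... | false | false | true  | true  = refl
... | false | false | true  | false = refl
... | false | false | false | true  = refl
... | false | false | false | false = refl
fold-pointwise μ 0∉ -[1+ m ] -[1+ n ] x≢y with n <ᵇ m | m <ᵇ n | memb (suc m) μ | memb (suc n) μ
... | true  | true  | true  | true  = refl
... | true  | true  | true  | false = refl
... | true  | true  | false | true  = refl
... | true  | true  | false | false = refl
... | true  | false | true  | true  = refl
... | true  | false | true  | false = refl
... | true  | false | false | true  = refl
... | true  | false | false | false = refl
... | false | true  | true  | true  = refl
... | false | true  | true  | false = refl
... | false | true  | false | true  = refl
... | false | true  | false | false = refl
... | false | false | true  | true  = refl
... | false | false | true  | false = refl
... | false | false | false | true  = refl
... | false | false | false | false = refl
-- For equal signs the identity holds for every choice of Booleans. For opposite signs the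
-- reflection may fix the pair, so the equality test enters and must agree with the two order tests.
fold-pointwise μ 0∉ +[1+ m ] -[1+ n ] x≢y with m <ᵇ n | m ≡ᵇ n | n <ᵇ m | compareᵇ m n
fold-pointwise μ 0∉ +[1+ m ] -[1+ .m ] x≢y | _ | _ | _ | equal refl with memb (suc m) μ
... | true  = refl
... | false = refl
fold-pointwise μ 0∉ +[1+ m ] -[1+ n ] x≢y | _ | _ | _ | less with memb (suc m) μ | memb (suc n) μ
... | true  | true  = refl
... | true  | false = refl
... | false | true  = refl
... | false | false = refl
fold-pointwise μ 0∉ +[1+ m ] -[1+ n ] x≢y | _ | _ | _ | greater with memb (suc m) μ | memb (suc n) μ
... | true  | true  = refl
... | true  | false = refl
... | false | true  = refl
... | false | false = refl
fold-pointwise μ 0∉ -[1+ m ] +[1+ n ] x≢y with m <ᵇ n | m ≡ᵇ n | n <ᵇ m | compareᵇ m n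
fold-pointwise μ 0∉ -[1+ m ] +[1+ .m ] x≢y | _ | _ | _ | equal refl with memb (suc m) μ
... | true  = refl
... | false = refl
fold-pointwise μ 0∉ -[1+ m ] +[1+ n ] x≢y | _ | _ | _ | less with memb (suc m) μ | memb (suc n) μ
... | true  | true  = refl
... | true  | false = refl
... | false | true  = refl
... | false | false = refl
fold-pointwise μ 0∉ -[1+ m ] +[1+ n ] x≢y | _ | _ | _ | greater with memb (suc m) μ | memb (suc n) μ
... | true  | true  = refl
... | true  | false = refl
... | false | true  = refl
... | false | false = refl
fold-pointwise μ 0∉ (+ zero) (+ zero) x≢y = ⊥-elim (x≢y refl)
fold-pointwise μ 0∉ (+ zero) +[1+ n ] x≢y rewrite 0∉ with memb (suc n) μ
... | true  = refl
... | false = refl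
fold-pointwise μ 0∉ (+ zero) -[1+ n ] x≢y rewrite 0∉ with memb (suc n) μ
... | true  = refl
... | false = refl
fold-pointwise μ 0∉ +[1+ m ] (+ zero) x≢y rewrite 0∉ with memb (suc m) μ
... | true  = refl
... | false = refl
fold-pointwise μ 0∉ -[1+ m ] (+ zero) x≢y rewrite 0∉ with memb (suc m) μ
... | true  = refl
... | false = refl

-- Folding hooks into bars

-- At length 0 the two terms on the right would coincide, which is why the folding argument is run
-- for `suc h` only.
δ-∣∣ : ∀ h z → δ (+ suc h) (+ ∣ z ∣) ≡ δ z (+ suc h) + δ z (- (+ suc h))
δ-∣∣ h (+ n) = ≡.trans (δ-sym (+ suc h) (+ n)) (sym (ℤₚ.+-identityʳ _))
δ-∣∣ h -[1+ n ] = ≡.trans (δ-sym (+ suc h) (+ suc n)) (sym (ℤₚ.+-identityˡ _))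

∣∣≤⇒≤ : ∀ {z n} → ∣ z ∣ ℕ.≤ n → z ℤ.≤ + n
∣∣≤⇒≤ {+ _}      le = ℤ.+≤+ le
∣∣≤⇒≤ { -[1+ _ ]} le = ℤ.-≤+

∣∣≤⇒≥ : ∀ {z n} → ∣ z ∣ ℕ.≤ n → - + n ℤ.≤ z
∣∣≤⇒≥ {z} {n} le = ≤-by (∣∣≤⇒≤ { - z} (subst (ℕ._≤ n) (sym (ℤₚ.∣-i∣≡∣i∣ z)) le)) (ring (+ n) z)
  where
  ring : ∀ n z → z - (- n) ≡ n - (- z)
  ring = solve-∀

-- The number of bars of length h measured after applying φ: the identity gives ordinary bar
-- lengths, the slide of the runners gives the modified ones.
barSum : List ℕ → (ℤ → ℤ) → ℕ → ℤ
barSum μ φ h = ∑ μ (λ a → ∑ (gaps μ a) (λ y → δ (+ h) (+ ∣ φ (+ a) - φ y ∣)))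

partSum : List ℕ → (ℤ → ℤ) → ℕ → ℤ
partSum μ φ h = ∑ μ (λ a → δ (+ h) (+ ∣ φ (+ a) ∣))

-- A delta locating θ⁻¹ of each part in W is inserted and the two sums are exchanged; the inner sum
-- over parts then collapses to the indicator that θ u is a part.
reindex : ∀ μ → Unique μ → ∀ {W} → Unique W → (θ θ⁻¹ : ℤ → ℤ) →
  (∀ u → θ⁻¹ (θ u) ≡ u) → (∀ x → θ (θ⁻¹ x) ≡ x) → (∀ {a} → a ∈ μ → θ⁻¹ (+ a) ∈ W) →
  ∀ f → ∑ μ (λ a → f (+ a)) ≡ ∑ W (λ u → pos μ (θ u) * f (θ u))
reindex μ uniq {W} uniqW θ θ⁻¹ inv₁ inv₂ inW f = begin
  ∑ μ (λ a → f (+ a))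
    ≡⟨ ∑-cong μ (λ {a} a∈ → ≡.trans (cong f (sym (inv₂ (+ a)))) (sym (∑-δ (f ∘ θ) uniqW (inW a∈)))) ⟩
  ∑ μ (λ a → ∑ W (λ u → δ u (θ⁻¹ (+ a)) * f (θ u)))
    ≡⟨ ∑-swap μ W (λ a u → δ u (θ⁻¹ (+ a)) * f (θ u)) ⟩
  ∑ W (λ u → ∑ μ (λ a → δ u (θ⁻¹ (+ a)) * f (θ u)))
    ≡⟨ ∑-cong W (λ {u} _ → begin
      ∑ μ (λ a → δ u (θ⁻¹ (+ a)) * f (θ u))
        ≡⟨ ∑-*ʳ μ _ (f (θ u)) ⟩
      ∑ μ (λ a → δ u (θ⁻¹ (+ a))) * f (θ u)
        ≡⟨ cong (λ s → s * f (θ u)) (≡.trans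
             (∑-cong μ (λ {a} _ → δ-cong {u} {θ⁻¹ (+ a)} {+ a} {θ u}
               (λ eq → sym (≡.trans (cong θ eq) (inv₂ (+ a))))
               (λ eq → sym (≡.trans (cong θ⁻¹ eq) (inv₁ u)))))
             (∑-δ-pos μ (θ u) uniq)) ⟩
      pos μ (θ u) * f (θ u) ∎) ⟩
  ∑ W (λ u → pos μ (θ u) * f (θ u)) ∎
  where open ≡-Reasoning

-- φ stays abstract so that one argument serves λ and c, with the identity, and q, with the slide.
-- Oddness of ψ lets the reflection on slid positions u correspond to the reflection on positions ψ
-- u.
module Fold (μ : List ℕ) (uniq : Unique μ) (0∉ : memb 0 μ ≡ false)
  (φ ψ : ℤ → ℤ) (φψ : ∀ u → φ (ψ u) ≡ u) (ψφ : ∀ x → ψ (φ x) ≡ x)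
  (ψ-odd : ∀ u → ψ (- u) ≡ - ψ u)
  (M : ℕ) (φ≤M : ∀ {a} → a ∈ μ → ∣ φ (+ a) ∣ ℕ.≤ M) where

  ψ0 : ψ 0ℤ ≡ 0ℤ
  ψ0 = self-neg (ψ 0ℤ) (ψ-odd 0ℤ)
    where
    self-neg : ∀ x → x ≡ - x → x ≡ 0ℤ
    self-neg (+ zero) _ = refl

  ψ-inj : ∀ {u v} → ψ u ≡ ψ v → u ≡ v
  ψ-inj {u} {v} eq = ≡.trans (sym (φψ u)) (≡.trans (cong φ eq) (φψ v))

  partSum-pos : ∀ h → partSum μ φ (suc h) ≡ pos μ (ψ (+ suc h)) + pos μ (ψ (- (+ suc h)))
  partSum-pos h = begin
    partSum μ φ (suc h)
      ≡⟨ ∑-cong μ (λ {a} _ → ≡.trans (δ-∣∣ h (φ (+ a))) (cong₂ _+_ (transport a _) (transport a _))) ⟩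
    ∑ μ (λ a → δ (+ a) (ψ (+ suc h)) + δ (+ a) (ψ (- (+ suc h))))
      ≡⟨ ∑-+ μ _ _ ⟩
    ∑ μ (λ a → δ (+ a) (ψ (+ suc h))) + ∑ μ (λ a → δ (+ a) (ψ (- (+ suc h))))
      ≡⟨ cong₂ _+_ (∑-δ-pos μ (ψ (+ suc h)) uniq) (∑-δ-pos μ (ψ (- (+ suc h))) uniq) ⟩
    pos μ (ψ (+ suc h)) + pos μ (ψ (- (+ suc h))) ∎
    where
    open ≡-Reasoning
    transport : ∀ a z → δ (φ (+ a)) z ≡ δ (+ a) (ψ z)
    transport a z = δ-cong {φ (+ a)} {z} {+ a} {ψ z}
      (λ eq → ≡.trans (sym (ψφ (+ a))) (cong ψ eq))
      (λ eq → ≡.trans (cong φ eq) (φψ z))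

  module _ (h₀ : ℕ) (W : List ℤ) (uniqW : Unique W)
    (in-W : ∀ {u} → - + M ℤ.≤ u → u ℤ.≤ + M + + suc h₀ → u ∈ W)
    (reflect : ∀ f → ∑ W (λ u → f (+ suc h₀ - u)) ≡ ∑ W f) where

    h = suc h₀

    ≤-+h : ∀ {z} → z ℤ.≤ z + + h
    ≤-+h {z} = ℤₚ.i≤i+j z (+ h)

    W-φ : ∀ {a} → a ∈ μ → φ (+ a) ∈ W
    W-φ a∈ = in-W (∣∣≤⇒≥ (φ≤M a∈)) (ℤₚ.≤-trans (∣∣≤⇒≤ (φ≤M a∈)) ≤-+h)

    W--φ : ∀ {a} → a ∈ μ → - φ (+ a) ∈ W
    W--φ {a} a∈ = in-W (∣∣≤⇒≥ le) (ℤₚ.≤-trans (∣∣≤⇒≤ le) ≤-+h)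
      where
      le = subst (ℕ._≤ M) (sym (ℤₚ.∣-i∣≡∣i∣ (φ (+ a)))) (φ≤M a∈)

    W-φ+h : ∀ {a} → a ∈ μ → φ (+ a) + + h ∈ W
    W-φ+h {a} a∈ = in-W (ℤₚ.≤-trans (∣∣≤⇒≥ {φ (+ a)} (φ≤M a∈)) ≤-+h)
      (ℤₚ.+-monoˡ-≤ (+ h) (∣∣≤⇒≤ {φ (+ a)} (φ≤M a∈)))

    0∈W : 0ℤ ∈ W
    0∈W = in-W ℤₚ.neg-≤-pos (ℤ.+≤+ z≤n)

    h∈W : + h ∈ W
    h∈W = in-W (ℤₚ.neg-≤-pos {M} {h}) (ℤ.+≤+ (ℕₚ.m≤n+m h M))

    K : ℤ → ℤ → ℤ
    K x y = ⟦ ∣ y ∣ <ᵇ ∣ x ∣ ⟧ * ⟦ not (S μ y) ⟧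

    -- A part and a signed length determine the gap, y = ψ (φ a - z), so the sum has at most one
    -- term and `K` tests whether it occurs.
    gap-sum : ∀ a z → ∑ (gaps μ a) (λ y → δ (φ (+ a) - φ y) z) ≡ K (+ a) (ψ (φ (+ a) - z))
    gap-sum a z = begin
      ∑ (gaps μ a) (λ y → δ (φ (+ a) - φ y) z)
        ≡⟨ ∑-filter (not ∘ S μ) (ball a) _ ⟩
      ∑ (ball a) (λ y → ⟦ not (S μ y) ⟧ * δ (φ (+ a) - φ y) z)
        ≡⟨ ∑-cong (ball a) (λ {y} _ → ≡.trans (ℤₚ.*-comm ⟦ not (S μ y) ⟧ _)
             (cong (λ e → e * ⟦ not (S μ y) ⟧) (δ-cong {φ (+ a) - φ y} {z} {y} {ψ (φ (+ a) - z)}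
               (λ eq → ≡.trans (sym (ψφ y)) (cong ψ (≡-by (sym eq) (ring₁ (φ (+ a)) (φ y) z))))
               (λ eq → ≡.trans (cong (λ v → φ (+ a) - φ v) eq)
                 (≡.trans (cong (λ v → φ (+ a) - v) (φψ _)) (ring₂ (φ (+ a)) z)))))) ⟩
      ∑ (ball a) (λ y → δ y (ψ (φ (+ a) - z)) * ⟦ not (S μ y) ⟧)
        ≡⟨ ∑-ball-δ a (ψ (φ (+ a) - z)) (λ y → ⟦ not (S μ y) ⟧) ⟩
      K (+ a) (ψ (φ (+ a) - z)) ∎
      where
      open ≡-Reasoning
      ring₁ : ∀ a y z → a - z - y ≡ a - y - z
      ring₁ = solve-∀
      ring₂ : ∀ a z → a - (a - z) ≡ z
      ring₂ = solve-∀

    -- Both orders are needed: φ may reverse a part and its gap, so an absolute length h arises with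
    -- the part at u and the gap at u - h, or the other way round.
    G : ℤ → ℤ
    G u = bar μ (ψ u) (ψ (u - + h)) + bar μ (ψ (u - + h)) (ψ u)

    barSum-G : barSum μ φ h ≡ ∑ W G
    barSum-G = begin
      barSum μ φ h
        ≡⟨ ∑-cong μ (λ {a} _ → ≡.trans (∑-cong (gaps μ a) (λ {y} _ → δ-∣∣ h₀ (φ (+ a) - φ y)))
             (≡.trans (∑-+ (gaps μ a) _ _) (cong₂ _+_ (gap-sum a (+ h)) (gap-sum a (- + h))))) ⟩
      ∑ μ (λ a → K (+ a) (ψ (φ (+ a) - + h)) + K (+ a) (ψ (φ (+ a) - (- + h))))
        ≡⟨ ∑-+ μ _ _ ⟩
      ∑ μ (λ a → K (+ a) (ψ (φ (+ a) - + h))) + ∑ μ (λ a → K (+ a) (ψ (φ (+ a) - (- + h))))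
        ≡⟨ cong₂ _+_
             (reindex μ uniq uniqW ψ φ φψ ψφ W-φ (λ x → K x (ψ (φ x - + h))))
             (reindex μ uniq uniqW (λ u → ψ (u - + h)) (λ x → φ x + + h)
               (λ u → ≡.trans (cong (λ v → v + + h) (φψ _)) (ring₁ u (+ h)))
               (λ x → ≡.trans (cong ψ (ring₂ (φ x) (+ h))) (ψφ x))
               W-φ+h (λ x → K x (ψ (φ x - (- + h))))) ⟩
      ∑ W (λ u → pos μ (ψ u) * K (ψ u) (ψ (φ (ψ u) - + h))) +
      ∑ W (λ u → pos μ (ψ (u - + h)) * K (ψ (u - + h)) (ψ (φ (ψ (u - + h)) - (- + h))))
        ≡⟨ cong₂ _+_
             (∑-cong W (λ {u} _ → cong (λ v → pos μ (ψ u) * K (ψ u) (ψ (v - + h))) (φψ u)))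
             (∑-cong W (λ {u} _ → cong (λ v → pos μ (ψ (u - + h)) * K (ψ (u - + h)) (ψ v))
               (≡.trans (cong (λ v → v - (- + h)) (φψ _)) (ring₃ u (+ h))))) ⟩
      ∑ W (λ u → bar μ (ψ u) (ψ (u - + h))) + ∑ W (λ u → bar μ (ψ (u - + h)) (ψ u))
        ≡⟨ sym (∑-+ W _ _) ⟩
      ∑ W G ∎
      where
      open ≡-Reasoning
      ring₁ : ∀ u h → u - h + h ≡ u
      ring₁ = solve-∀
      ring₂ : ∀ x h → x + h - h ≡ x
      ring₂ = solve-∀
      ring₃ : ∀ u h → u - h - (- h) ≡ u
      ring₃ = solve-∀

    -- A slid part of absolute value h / 2 sits at u or at - u with u + u = h. These u are the fixed
    -- points of u ↦ h - u, so doubled parts account for the hooks fixed by the reflection.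
    double-pos : ∑ μ (λ a → δ (+ h) (+ (2 ℕ.* ∣ φ (+ a) ∣))) ≡
      ∑ W (λ u → δ (u + u) (+ h) * (pos μ (ψ u) + pos μ (ψ (- u))))
    double-pos = begin
      ∑ μ (λ a → δ (+ h) (+ (2 ℕ.* ∣ φ (+ a) ∣)))
        ≡⟨ ∑-cong μ (λ {a} _ → ≡.trans (cong (λ n → δ (+ h) (+ n)) (twice (φ (+ a)))) (δ-∣∣ h₀ (φ (+ a) + φ (+ a)))) ⟩
      ∑ μ (λ a → δ (φ (+ a) + φ (+ a)) (+ h) + δ (φ (+ a) + φ (+ a)) (- + h))
        ≡⟨ ∑-+ μ _ _ ⟩
      ∑ μ (λ a → δ (φ (+ a) + φ (+ a)) (+ h)) + ∑ μ (λ a → δ (φ (+ a) + φ (+ a)) (- + h))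
        ≡⟨ cong₂ _+_
             (reindex μ uniq uniqW ψ φ φψ ψφ W-φ (λ x → δ (φ x + φ x) (+ h)))
             (reindex μ uniq uniqW (λ u → ψ (- u)) (λ x → - φ x)
               (λ u → ≡.trans (cong -_ (φψ _)) (ℤₚ.neg-involutive u))
               (λ x → ≡.trans (cong ψ (ℤₚ.neg-involutive (φ x))) (ψφ x))
               W--φ (λ x → δ (φ x + φ x) (- + h))) ⟩
      ∑ W (λ u → pos μ (ψ u) * δ (φ (ψ u) + φ (ψ u)) (+ h)) +
      ∑ W (λ u → pos μ (ψ (- u)) * δ (φ (ψ (- u)) + φ (ψ (- u))) (- + h))
        ≡⟨ cong₂ _+_
             (∑-cong W (λ {u} _ → ≡.trans (ℤₚ.*-comm (pos μ (ψ u)) (δ (φ (ψ u) + φ (ψ u)) (+ h)))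
               (cong (λ v → δ (v + v) (+ h) * pos μ (ψ u)) (φψ u))))
             (∑-cong W (λ {u} _ → ≡.trans (ℤₚ.*-comm (pos μ (ψ (- u))) (δ (φ (ψ (- u)) + φ (ψ (- u))) (- + h)))
               (≡.trans (cong (λ v → δ (v + v) (- + h) * pos μ (ψ (- u))) (φψ (- u)))
                 (cong (λ e → e * pos μ (ψ (- u))) (δ-neg u))))) ⟩
      ∑ W (λ u → δ (u + u) (+ h) * pos μ (ψ u)) + ∑ W (λ u → δ (u + u) (+ h) * pos μ (ψ (- u)))
        ≡⟨ sym (∑-+ W _ _) ⟩
      ∑ W (λ u → δ (u + u) (+ h) * pos μ (ψ u) + δ (u + u) (+ h) * pos μ (ψ (- u)))
        ≡⟨ ∑-cong W (λ {u} _ → sym (ℤₚ.*-distribˡ-+ (δ (u + u) (+ h)) (pos μ (ψ u)) (pos μ (ψ (- u))))) ⟩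
      ∑ W (λ u → δ (u + u) (+ h) * (pos μ (ψ u) + pos μ (ψ (- u)))) ∎
      where
      open ≡-Reasoning
      twice : ∀ z → 2 ℕ.* ∣ z ∣ ≡ ∣ z + z ∣
      twice (+ n)    = cong (ℕ._+_ n) (ℕₚ.+-identityʳ n)
      twice -[1+ n ] = cong suc (≡.trans (cong (ℕ._+_ n) (ℕₚ.+-identityʳ (suc n))) (ℕₚ.+-suc n n))
      δ-neg : ∀ u → δ (- u + - u) (- + h) ≡ δ (u + u) (+ h)
      δ-neg u = δ-cong { - u + - u} { - + h} {u + u} {+ h}
        (λ eq → ≡-by (sym eq) (ring₁ u (+ h)))
        (λ eq → ≡.trans (ring₂ u) (cong -_ eq))
        where
        ring₁ : ∀ u h → h - (u + u) ≡ - u + - u - (- h)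
        ring₁ = solve-∀
        ring₂ : ∀ u → - u + - u ≡ - (u + u)
        ring₂ = solve-∀

    -- With x = ψ u and y = ψ (u - h), oddness gives ψ (h - u) = - y and ψ (h - u - h) = - x, so
    -- this is `fold-pointwise` read in the variable u. The zero entries occur at u = h and at u =
    -- 0.
    pointwise : ∀ u → G u + G (+ h - u) + δ (u + u) (+ h) * (pos μ (ψ u) + pos μ (ψ (- u))) ≡
      hook μ (ψ u) (ψ (u - + h)) +
      (δ u (+ h) * pos μ (ψ (- + h)) + δ u 0ℤ * pos μ (ψ (+ h)))
    pointwise u = begin
      G u + G (+ h - u) + δ (u + u) (+ h) * (pos μ x + pos μ (ψ (- u)))
        ≡⟨ cong₂ _+_ (cong (_+_ (G u)) (cong₂ (λ a b → bar μ a b + bar μ b a) e₁ e₂)) e₃ ⟩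
      bar μ x y + bar μ y x + (bar μ (- y) (- x) + bar μ (- x) (- y)) + δ x (- y) * (pos μ x + pos μ y)
        ≡⟨ fold-pointwise μ 0∉ x y x≢y ⟩
      hook μ x y + (δ y 0ℤ * pos μ (- x) + δ x 0ℤ * pos μ (- y))
        ≡⟨ cong (_+_ (hook μ x y)) (cong₂ _+_ e₄ e₅) ⟩
      hook μ x y + (δ u (+ h) * pos μ (ψ (- + h)) + δ u 0ℤ * pos μ (ψ (+ h))) ∎
      where
      open ≡-Reasoning
      x = ψ u
      y = ψ (u - + h)
      flip : ∀ h u → h - u ≡ - (u - h)
      flip = solve-∀
      shiftback : ∀ h u → h - u - h ≡ - u
      shiftback = solve-∀
      e₁ : ψ (+ h - u) ≡ - y
      e₁ = ≡.trans (cong ψ (flip (+ h) u)) (ψ-odd _)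
      e₂ : ψ (+ h - u - + h) ≡ - x
      e₂ = ≡.trans (cong ψ (shiftback (+ h) u)) (ψ-odd u)
      x≢y : x ≢ y
      x≢y eq = h≢0 (≡-by (ψ-inj {u} {u - + h} eq) (ring u (+ h)))
        where
        h≢0 : + h ≢ 0ℤ
        h≢0 ()
        ring : ∀ u h → 0ℤ - h ≡ u - h - u
        ring = solve-∀
      e₃ : δ (u + u) (+ h) * (pos μ x + pos μ (ψ (- u))) ≡ δ x (- y) * (pos μ x + pos μ y)
      e₃ with u + u ℤ.≟ + h
      ... | yes eq = ≡.trans (cong (λ z → 1ℤ * (pos μ x + pos μ (ψ z))) -u≡)
              (cong (λ e → e * (pos μ x + pos μ y)) (sym (δ-≡ {x} { - y} (≡.trans (cong ψ u≡) e₁))))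
        where
        ring₁ : ∀ u h → u - h - (- u) ≡ u + u - h
        ring₁ = solve-∀
        -u≡ : - u ≡ u - + h
        -u≡ = ≡-by (sym eq) (ring₁ u (+ h))
        ring₂ : ∀ u h → h - u - u ≡ h - (u + u)
        ring₂ = solve-∀
        u≡ : u ≡ + h - u
        u≡ = ≡-by eq (ring₂ u (+ h))
      ... | no neq = cong (λ e → e * (pos μ x + pos μ y)) (sym (δ-≢ {x} { - y} λ eq →
              neq (≡-by (ψ-inj {u} {+ h - u} (≡.trans eq (sym e₁))) (ring u (+ h)))))
        where
        ring : ∀ u h → h - (u + u) ≡ h - u - u
        ring = solve-∀
      e₄ : δ y 0ℤ * pos μ (- x) ≡ δ u (+ h) * pos μ (ψ (- + h))
      e₄ = ≡.trans (cong₂ _*_ (δ-cong {y} {0ℤ} {u} {+ h}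
          (λ eq → ≡-by (ψ-inj {u - + h} {0ℤ} (≡.trans eq (sym ψ0))) (ring₁ u (+ h)))
          (λ eq → ≡.trans (cong ψ (≡-by eq (ring₂ u (+ h)))) ψ0)) (cong (pos μ) (sym (ψ-odd u))))
        (δ-subst (λ v → pos μ (ψ (- v))) u (+ h))
        where
        ring₁ : ∀ u h → h - u ≡ 0ℤ - (u - h)
        ring₁ = solve-∀
        ring₂ : ∀ u h → 0ℤ - (u - h) ≡ h - u
        ring₂ = solve-∀
      e₅ : δ x 0ℤ * pos μ (- y) ≡ δ u 0ℤ * pos μ (ψ (+ h))
      e₅ = ≡.trans (cong₂ _*_ (δ-cong {x} {0ℤ} {u} {0ℤ}
          (λ eq → ψ-inj {u} {0ℤ} (≡.trans eq (sym ψ0)))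
          (λ eq → ≡.trans (cong ψ eq) ψ0)) (cong (pos μ) (sym e₁)))
        (≡.trans (δ-subst (λ v → pos μ (ψ (+ h - v))) u 0ℤ)
          (cong (λ v → δ u 0ℤ * pos μ (ψ v)) (ring (+ h))))
        where
        ring : ∀ h → h - 0ℤ ≡ h
        ring = solve-∀

    -- Reflection invariance of W makes the sums of G u and of G (h - u) equal, whence the factor
    -- two. The exceptional terms at u = h and u = 0 add up to `partSum`.
    fold : barSum μ φ h + barSum μ φ h + ∑ μ (λ a → δ (+ h) (+ (2 ℕ.* ∣ φ (+ a) ∣))) ≡
      ∑ W (λ u → hook μ (ψ u) (ψ (u - + h))) + partSum μ φ h
    fold = begin
      barSum μ φ h + barSum μ φ h + ∑ μ (λ a → δ (+ h) (+ (2 ℕ.* ∣ φ (+ a) ∣)))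
        ≡⟨ cong₂ _+_ (cong₂ _+_ barSum-G (≡.trans barSum-G (sym (reflect G)))) double-pos ⟩
      ∑ W G + ∑ W (λ u → G (+ h - u)) + ∑ W D₂
        ≡⟨ cong (λ s → s + ∑ W D₂) (sym (∑-+ W _ _)) ⟩
      ∑ W (λ u → G u + G (+ h - u)) + ∑ W D₂
        ≡⟨ sym (∑-+ W _ _) ⟩
      ∑ W (λ u → G u + G (+ h - u) + D₂ u)
        ≡⟨ ∑-cong W (λ {u} _ → pointwise u) ⟩
      ∑ W (λ u → H u + (δ u (+ h) * pos μ (ψ (- + h)) + δ u 0ℤ * pos μ (ψ (+ h))))
        ≡⟨ ∑-+ W _ _ ⟩
      ∑ W H + ∑ W (λ u → δ u (+ h) * pos μ (ψ (- + h)) + δ u 0ℤ * pos μ (ψ (+ h)))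
        ≡⟨ cong (_+_ (∑ W H)) (≡.trans (∑-+ W _ _)
             (cong₂ _+_ (∑-δ (λ _ → pos μ (ψ (- + h))) uniqW h∈W) (∑-δ (λ _ → pos μ (ψ (+ h))) uniqW 0∈W))) ⟩
      ∑ W H + (pos μ (ψ (- + h)) + pos μ (ψ (+ h)))
        ≡⟨ cong (_+_ (∑ W H)) (≡.trans (ℤₚ.+-comm (pos μ (ψ (- + h))) _) (sym (partSum-pos h₀))) ⟩
      ∑ W H + partSum μ φ h ∎
      where
      open ≡-Reasoning
      H D₂ : ℤ → ℤ
      H u = hook μ (ψ u) (ψ (u - + h))
      D₂ u = δ (u + u) (+ h) * (pos μ (ψ u) + pos μ (ψ (- u)))

-- Bars

T-≡ : ∀ {b} → T b → b ≡ true
T-≡ {true} _ = refl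

≡-T : ∀ {b} → b ≡ true → T b
≡-T refl = _

∉⇒memb : ∀ {x} ys → x ∉ ys → memb x ys ≡ false
∉⇒memb {x} ys x∉ with memb x ys in e
... | true  = ⊥-elim (x∉ (memb⇒∈ x ys e))
... | false = refl

not-true : ∀ {b} → not b ≡ true → b ≡ false
not-true {false} _ = refl

not-false : ∀ {b} → not b ≡ false → b ≡ true
not-false {true} _ = refl

∈-gaps⁺ : ∀ {μ a y} → ∣ y ∣ ℕ.< a → S μ y ≡ false → y ∈ gaps μ a
∈-gaps⁺ {μ} {a} lt eq = ∈-filter⁺ (T? ∘ not ∘ S μ) (∈-ball⁺ {a} lt) (≡-T (cong not eq))

∈-gaps⁻ : ∀ {μ a y} → y ∈ gaps μ a → (∣ y ∣ ℕ.< a) × (S μ y ≡ false)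
∈-gaps⁻ {μ} {a} y∈ with ∈-filter⁻ (T? ∘ not ∘ S μ) {xs = ball a} y∈
... | y∈ball , t = ∈-ball⁻ {a} y∈ball , not-true (T-≡ t)

gaps-unique : ∀ μ a → Unique (gaps μ a)
gaps-unique μ a = Uniqueₚ.filter⁺ (T? ∘ not ∘ S μ) (window-unique (1ℤ - + a) (a ℕ.+ a ℕ.∸ 1))

∈-range⁺ : ∀ {a b x} → a ℕ.≤ x → x ℕ.≤ b → x ∈ [ a ⋯ b ]
∈-range⁺ {a} {b} {x} a≤x x≤b = subst (_∈ [ a ⋯ b ]) (ℕₚ.m+[n∸m]≡n a≤x)
  (∈-map⁺ (a ℕ.+_) (∈-upTo⁺ (ℕₚ.∸-monoˡ-< (s≤s x≤b) a≤x)))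

<∸⇒+< : ∀ a {b k} → k ℕ.< b ℕ.∸ a → a ℕ.+ k ℕ.< b
<∸⇒+< zero            p = p
<∸⇒+< (suc a) {suc b} p = s≤s (<∸⇒+< a p)

∈-range⁻ : ∀ {a b x} → x ∈ [ a ⋯ b ] → (a ℕ.≤ x) × (x ℕ.≤ b)
∈-range⁻ {a} {b} x∈ with ∈-map⁻ (a ℕ.+_) x∈
... | k , k∈ , refl = ℕₚ.m≤m+n a k , ℕ.s≤s⁻¹ (<∸⇒+< a (∈-upTo⁻ k∈))

range-unique : ∀ a b → Unique [ a ⋯ b ]
range-unique a b = Uniqueₚ.map⁺ (ℕₚ.+-cancelˡ-≡ a _ _) (Uniqueₚ.upTo⁺ (suc b ℕ.∸ a))

Strict : List ℕ → Set
Strict = AllPairs ℕ._>_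

strict⇒unique : ∀ {μ} → Strict μ → Unique μ
strict⇒unique = AllPairs.map (λ b<a a≡b → ℕₚ.<-irrefl (sym a≡b) b<a)

barList : List ℕ → (ℤ → ℤ) → List ℕ
barList μ φ = concatMap (λ a → map (λ y → ∣ φ (+ a) - φ y ∣) (gaps μ a)) μ

mult-barList : ∀ h μ φ → + mult h (barList μ φ) ≡ barSum μ φ h
mult-barList h μ φ = ≡.trans (mult-∑ h (barList μ φ)) (≡.trans (∑-concatMap _ μ _)
  (∑-cong μ (λ {a} _ → ∑-map (λ y → ∣ φ (+ a) - φ y ∣) (gaps μ a) _)))

module _ {a rest} (a> : All (a ℕ.>_) rest) (srest : Strict rest) (rest>0 : All (0 ℕ.<_) rest) where

  private
    ν = a ∷ rest
    plus minus : List ℕ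
    plus  = [ 1 ⋯ a ] ++ map (λ x → a ℕ.+ x) rest
    minus = map (a ℕ.∸_) rest
    Z = map (λ y → ∣ + a - y ∣) (gaps ν a)

    Δ : ℤ → ℕ
    Δ y = ∣ + a - y ∣

    Δ-pos : ∀ {w} → w ℕ.≤ a → Δ (+ w) ≡ a ℕ.∸ w
    Δ-pos {w} w≤a = cong ∣_∣ (≡.trans (ℤₚ.m-n≡m⊖n a w) (ℤₚ.⊖-≥ w≤a))

    memb-rest : ∀ {w} → w ℕ.< a → memb w ν ≡ memb w rest
    memb-rest {w} w<a with w ≡ᵇ a in e
    ... | true  = ⊥-elim (ℕₚ.<-irrefl (≡ᵇ⇒≡ w e) w<a)
    ... | false = refl

    plus⊆ : ∀ {h} → h ∈ plus → h ∈ minus ++ Z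
    plus⊆ {h} h∈ with ∈-++⁻ [ 1 ⋯ a ] h∈
    ... | inj₂ h∈₂ with ∈-map⁻ _ h∈₂
    ... | zero  , b∈ , refl = ⊥-elim (ℕₚ.<-irrefl refl (All.lookup rest>0 b∈))
    ... | suc n , b∈ , refl = ∈-++⁺ʳ minus (∈-map⁺ Δ (∈-gaps⁺ {ν} { y = -[1+ n ]} (All.lookup a> b∈)
          (cong not (∈⇒memb {suc n} {ν} (there b∈)))))
    plus⊆ {h} h∈ | inj₁ h∈₁ with ∈-range⁻ {1} h∈₁
    ... | 1≤h , h≤a with memb (a ℕ.∸ h) rest in e
    ... | true  = ∈-++⁺ˡ (subst (_∈ minus) (ℕₚ.m∸[m∸n]≡n h≤a) (∈-map⁺ (a ℕ.∸_) (memb⇒∈ _ rest e)))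
    ... | false = ∈-++⁺ʳ minus (subst (_∈ Z) (≡.trans (Δ-pos (ℕₚ.m∸n≤m a h)) (ℕₚ.m∸[m∸n]≡n h≤a))
          (∈-map⁺ Δ (∈-gaps⁺ {ν} {y = + (a ℕ.∸ h)} w<a (≡.trans (memb-rest w<a) e))))
      where
      w<a : a ℕ.∸ h ℕ.< a
      w<a = ℕₚ.∸-monoʳ-< 1≤h h≤a

    in-range : ∀ {w} → w ℕ.< a → a ℕ.∸ w ∈ plus
    in-range {w} w<a = ∈-++⁺ˡ (∈-range⁺ {1} (ℕₚ.m<n⇒0<n∸m w<a) (ℕₚ.m∸n≤m a w))

    in-rest : ∀ {b} → b ℕ.< a → b ∈ ν → b ∈ rest
    in-rest b<a (here refl) = ⊥-elim (ℕₚ.<-irrefl refl b<a)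
    in-rest b<a (there b∈)  = b∈

    ⊆plus : ∀ {h} → h ∈ minus ++ Z → h ∈ plus
    ⊆plus h∈ with ∈-++⁻ minus h∈
    ⊆plus h∈ | inj₁ h∈₁ with ∈-map⁻ _ h∈₁
    ... | b , b∈ , refl = in-range (All.lookup a> b∈)
    ⊆plus h∈ | inj₂ h∈₂ with ∈-map⁻ Δ h∈₂
    ⊆plus h∈ | inj₂ h∈₂ | + w      , y∈ , refl with ∈-gaps⁻ {ν} {a} y∈
    ... | w<a , _ = subst (_∈ plus) (sym (Δ-pos (ℕₚ.<⇒≤ w<a))) (in-range w<a)
    ⊆plus h∈ | inj₂ h∈₂ | -[1+ n ] , y∈ , refl with ∈-gaps⁻ {ν} {a} y∈
    ... | b<a , e = ∈-++⁺ʳ [ 1 ⋯ a ] (∈-map⁺ (a ℕ.+_)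
          (in-rest b<a (memb⇒∈ (suc n) ν (not-false e))))

    plus-unique : Unique plus
    plus-unique = Uniqueₚ.++⁺ (range-unique 1 a)
      (Uniqueₚ.map⁺ (ℕₚ.+-cancelˡ-≡ a _ _) (strict⇒unique srest)) disjoint
      where
      disjoint : ∀ {h} → h ∈ [ 1 ⋯ a ] × h ∈ map (a ℕ.+_) rest → ⊥
      disjoint (h∈ , h∈′) with ∈-map⁻ _ h∈′
      ... | b , b∈ , refl = ℕₚ.<-irrefl refl (ℕₚ.<-≤-trans (ℕₚ.m<m+n a (All.lookup rest>0 b∈))
              (proj₂ (∈-range⁻ {1} h∈)))

    +Δ : ∀ {y} → ∣ y ∣ ℕ.< a → + Δ y ≡ + a - y
    +Δ {+ w}      lt = ≡.trans (cong +_ (Δ-pos (ℕₚ.<⇒≤ lt)))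
      (sym (≡.trans (ℤₚ.m-n≡m⊖n a w) (ℤₚ.⊖-≥ (ℕₚ.<⇒≤ lt))))
    +Δ { -[1+ n ]} lt = refl

    Z-unique : Unique Z
    Z-unique = map-unique Δ (λ {y} {z} y∈ z∈ eq → ≡-by
        (≡.trans (sym (+Δ {z} (small z∈))) (≡.trans (cong +_ (sym eq)) (+Δ {y} (small y∈)))) (ring (+ a) y z))
      (gaps-unique ν a)
      where
      small : ∀ {y} → y ∈ gaps ν a → ∣ y ∣ ℕ.< a
      small y∈ = proj₁ (∈-gaps⁻ {ν} {a} y∈)
      ring : ∀ a y z → z - y ≡ (a - y) - (a - z)
      ring = solve-∀

    minus-unique : Unique minus
    minus-unique = map-unique (a ℕ.∸_) (λ b∈ c∈ →
        ℕₚ.∸-cancelˡ-≡ (ℕₚ.<⇒≤ (All.lookup a> b∈)) (ℕₚ.<⇒≤ (All.lookup a> c∈)))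
      (strict⇒unique srest)

    rhs-unique : Unique (minus ++ Z)
    rhs-unique = Uniqueₚ.++⁺ minus-unique Z-unique disjoint
      where
      disjoint : ∀ {h} → h ∈ minus × h ∈ Z → ⊥
      disjoint (h∈ , h∈′) with ∈-map⁻ _ h∈ | ∈-map⁻ Δ h∈′
      ... | b , b∈ , refl | y , y∈ , eq with ∈-gaps⁻ {ν} {a} y∈
      disjoint (h∈ , h∈′) | b , b∈ , refl | + w , y∈ , eq | w<a , e
        with refl ← ℕₚ.∸-cancelˡ-≡ (ℕₚ.<⇒≤ (All.lookup a> b∈)) (ℕₚ.<⇒≤ w<a) (≡.trans eq (Δ-pos (ℕₚ.<⇒≤ w<a)))
        = memb-∉ {b} {ν} e (there b∈)
      disjoint (h∈ , h∈′) | b , b∈ , refl | -[1+ n ] , y∈ , eq | _ =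
        ℕₚ.<-irrefl eq (ℕₚ.≤-<-trans (ℕₚ.m∸n≤m a b) (ℕₚ.m<m+n a (s≤s z≤n)))

  -- The lengths 1, ..., a are a - w with 0 ≤ w < a, and w is either a smaller part, giving an entry
  -- of `minus`, or a gap; the lengths a + b come from the gaps - b. Both sides are free of
  -- duplicates, so comparing elements suffices.
  first-bars-↭ : plus ∖ minus ↭ Z
  first-bars-↭ = ∖-↭ minus (unique-↭ plus-unique rhs-unique plus⊆ ⊆plus)

-- Gaps for `b` see only positions of absolute value below `b`, hence not a larger part. This
-- reconciles the recursion of `bars`, which forgets earlier parts, with `barList`, which keeps all
-- of them.
gaps-∷ : ∀ {a μ b} → b ℕ.< a → gaps (a ∷ μ) b ↭ gaps μ b
gaps-∷ {a} {μ} {b} b<a = unique-↭ (gaps-unique (a ∷ μ) b) (gaps-unique μ b)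
  (λ {y} y∈ → let lt , e = ∈-gaps⁻ {a ∷ μ} y∈ in ∈-gaps⁺ {μ} {y = y} lt (≡.trans (sym (same y lt)) e))
  (λ {y} y∈ → let lt , e = ∈-gaps⁻ {μ} y∈ in ∈-gaps⁺ {a ∷ μ} {y = y} lt (≡.trans (same y lt) e))
  where
  skip : ∀ n → n ℕ.< a → memb n (a ∷ μ) ≡ memb n μ
  skip n n<a with n ≡ᵇ a in e
  ... | true  = ⊥-elim (ℕₚ.<-irrefl (≡ᵇ⇒≡ n e) n<a)
  ... | false = refl
  same : ∀ y → ∣ y ∣ ℕ.< b → S (a ∷ μ) y ≡ S μ y
  same (+ n)    lt = skip n (ℕₚ.<-trans lt b<a)
  same -[1+ n ] lt = cong not (skip (suc n) (ℕₚ.<-trans lt b<a))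

bars-↭ : ∀ {μ} → Strict μ → All (0 ℕ.<_) μ → bars μ ↭ barList μ (λ y → y)
bars-↭ []             []         = ↭-refl
bars-↭ {a ∷ rest} (a> ∷ st) (_ ∷ ps) =
  ↭ₚ.++⁺ (first-bars-↭ a> st ps) (↭-trans (bars-↭ st ps) (tails a>))
  where
  tails : ∀ {ρ} → All (a ℕ.>_) ρ →
    concatMap (λ b → map (λ y → ∣ + b - y ∣) (gaps rest b)) ρ ↭
    concatMap (λ b → map (λ y → ∣ + b - y ∣) (gaps (a ∷ rest) b)) ρ
  tails []         = ↭-refl
  tails (b<a ∷ bs) = ↭ₚ.++⁺ (↭ₚ.map⁺ _ (↭-sym (gaps-∷ b<a))) (tails bs)

-- Entries of partitions

-- 0-indexed
ent : List ℕ → ℕ → ℕ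
ent ν i = entry ν (suc i)

Decreasing : List ℕ → Set
Decreasing ν = ∀ {i j} → i ℕ.≤ j → ent ν j ℕ.≤ ent ν i

step⇒decreasing : ∀ ν → (∀ i → ent ν (suc i) ℕ.≤ ent ν i) → Decreasing ν
step⇒decreasing ν step {i} {j} i≤j = go (ℕₚ.≤⇒≤′ i≤j)
  where
  go : ∀ {j} → i ℕ.≤′ j → ent ν j ℕ.≤ ent ν i
  go ℕ.≤′-refl         = ℕₚ.≤-refl
  go (ℕ.≤′-step i≤′j)  = ℕₚ.≤-trans (step _) (go i≤′j)

map-range : ∀ {A : Set} (f : ℕ → A) a b → map f [ a ⋯ b ] ≡ applyUpTo (λ i → f (a ℕ.+ i)) (suc b ℕ.∸ a)
map-range f a b = ≡.trans (sym (map-∘ (upTo (suc b ℕ.∸ a)))) (map-upTo _ (suc b ℕ.∸ a))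

ent-applyUpTo-< : ∀ g {n i} → i ℕ.< n → ent (applyUpTo g n) i ≡ g i
ent-applyUpTo-< g {suc n} {zero}  _       = refl
ent-applyUpTo-< g {suc n} {suc i} (s≤s p) = ent-applyUpTo-< (g ∘ suc) p

ent-≥length : ∀ ν {i} → length ν ℕ.≤ i → ent ν i ≡ 0
ent-≥length []      _               = refl
ent-≥length (x ∷ ν) {suc i} (s≤s p) = ent-≥length ν p

ent-++ˡ : ∀ xs ys {i} → i ℕ.< length xs → ent (xs ++ ys) i ≡ ent xs i
ent-++ˡ (x ∷ xs) ys {zero}  _       = refl
ent-++ˡ (x ∷ xs) ys {suc i} (s≤s p) = ent-++ˡ xs ys p

ent-++ʳ : ∀ xs ys i → ent (xs ++ ys) (length xs ℕ.+ i) ≡ ent ys i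
ent-++ʳ []       ys i = refl
ent-++ʳ (x ∷ xs) ys i = ent-++ʳ xs ys i

-- In a weakly decreasing list the zeros come last, and the default entry 0 replaces them after
-- filtering.
ent-nonzero : ∀ ν → Decreasing ν → ∀ i → ent (nonzero ν) i ≡ ent ν i
ent-nonzero []          dec i       = refl
ent-nonzero (zero  ∷ ν) dec i       = ≡.trans (ent-nonzero ν (λ p → dec (s≤s p)) i)
  (≡.trans (ℕₚ.n≤0⇒n≡0 (dec {0} {suc i} z≤n)) (sym (ℕₚ.n≤0⇒n≡0 (dec {0} {i} z≤n))))
ent-nonzero (suc x ∷ ν) dec zero    = refl
ent-nonzero (suc x ∷ ν) dec (suc i) = ent-nonzero ν (λ p → dec (s≤s p)) i

ent-∈ : ∀ μ {i} → i ℕ.< length μ → ent μ i ∈ μ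
ent-∈ (a ∷ μ) {zero}  _       = here refl
ent-∈ (a ∷ μ) {suc i} (s≤s p) = there (ent-∈ μ p)

∈-ent : ∀ {μ a} → a ∈ μ → ∃ λ i → (i ℕ.< length μ) × (ent μ i ≡ a)
∈-ent (here refl) = 0 , s≤s z≤n , refl
∈-ent (there a∈) with ∈-ent a∈
... | i , i< , eq = suc i , s≤s i< , eq

≤ᵇ-true : ∀ {m n} → m ℕ.≤ n → (m ≤ᵇ n) ≡ true
≤ᵇ-true {zero}  _ = refl
≤ᵇ-true {suc m} p = <ᵇ-true p

≤ᵇ⇒≤ : ∀ {m n} → (m ≤ᵇ n) ≡ true → m ℕ.≤ n
≤ᵇ⇒≤ {m} {n} eq = ℕₚ.≤ᵇ⇒≤ m n (≡-T eq)

-- Counting an initial segment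

-- For such a predicate the count is the first place of failure, so `c < count` means truth at c.
-- The lower rows of D(μ) are defined by counts and become usable in this way.
Initial : (ℕ → Bool) → ℕ → Set
Initial p m = ∀ {j k} → j ℕ.≤ k → k ℕ.< m → p k ≡ true → p j ≡ true

count-initial : ∀ (p : ℕ → Bool) g m → Initial (p ∘ g) m → ∀ {c} →
  c ℕ.< count p (applyUpTo g m) → (c ℕ.< m) × (p (g c) ≡ true)
count-initial p g (suc m) init {c} c< with p (g 0) in e
count-initial p g (suc m) init {zero}  c<       | true = s≤s z≤n , e
count-initial p g (suc m) init {suc c} (s≤s c<) | true
  with count-initial p (g ∘ suc) m (λ j≤k k<m → init (s≤s j≤k) (s≤s k<m)) c<
... | c<m , eq = s≤s c<m , eq
count-initial p g (suc m) init {c} c< | false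
  with count-initial p (g ∘ suc) m (λ j≤k k<m → init (s≤s j≤k) (s≤s k<m)) c<
... | c<m , eq with () ← ≡.trans (sym e) (init z≤n (s≤s c<m) eq)

initial-count : ∀ (p : ℕ → Bool) g m → Initial (p ∘ g) m → ∀ {c} →
  c ℕ.< m → p (g c) ≡ true → c ℕ.< count p (applyUpTo g m)
initial-count p g (suc m) init {c} c<m eq with p (g 0) in e
... | false with () ← ≡.trans (sym e) (init z≤n c<m eq)
initial-count p g (suc m) init {zero}  c<m       eq | true = s≤s z≤n
initial-count p g (suc m) init {suc c} (s≤s c<m) eq | true =
  s≤s (initial-count p (g ∘ suc) m (λ j≤k k<m → init (s≤s j≤k) (s≤s k<m)) c<m eq)

<colLen : ∀ ν → Decreasing ν → ∀ {c s} → suc c ℕ.≤ ent ν s → s ℕ.< colLen ν (suc c)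
<colLen (x ∷ ν) dec {c} {s} c≤ rewrite <ᵇ-true (ℕₚ.≤-trans c≤ (dec {0} {s} z≤n)) with s
... | zero   = s≤s z≤n
... | suc s′ = s≤s (<colLen ν (λ p → dec (s≤s p)) c≤)

colLen< : ∀ ν → Decreasing ν → ∀ {c s} → s ℕ.< colLen ν (suc c) → suc c ℕ.≤ ent ν s
colLen< (x ∷ ν) dec {c} {s} s< with c <ᵇ x in e
colLen< (x ∷ ν) dec {c} {zero}  s<       | true = <ᵇ⇒< e
colLen< (x ∷ ν) dec {c} {suc s} (s≤s s<) | true = colLen< ν (λ p → dec (s≤s p)) s<
colLen< (x ∷ ν) dec {c} {s}     s<       | false with
  () ← ≡.trans (sym e) (<ᵇ-true (ℕₚ.≤-trans (colLen< ν (λ p → dec (s≤s p)) s<) (dec {0} {suc s} z≤n)))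

≤-from-< : ∀ {m n} → (∀ {c} → c ℕ.< m → c ℕ.< n) → m ℕ.≤ n
≤-from-< {zero}  f = z≤n
≤-from-< {suc m} f = f ℕₚ.≤-refl

-- Consecutive parts drop by at least one, which offsets the growing index. This monotonicity is
-- what makes the rows a_r + r weakly decreasing and the leg condition initial.
strict-slope : ∀ {ν} → Strict ν → ∀ {i j} → i ℕ.≤ j → j ℕ.< length ν → ent ν j ℕ.+ j ℕ.≤ ent ν i ℕ.+ i
strict-slope {ν} strict {i} i≤j = go (ℕₚ.≤⇒≤′ i≤j)
  where
  step : ∀ {ν} → Strict ν → ∀ {i} → suc i ℕ.< length ν → ent ν (suc i) ℕ.< ent ν i
  step ((p ∷ _) ∷ _)     {zero}  _        = p
  step (_ ∷ [])          {zero}  (s≤s ())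
  step {_ ∷ ν} (_ ∷ st)  {suc i} (s≤s lt) = step st lt
  go : ∀ {j} → i ℕ.≤′ j → j ℕ.< length ν → ent ν j ℕ.+ j ℕ.≤ ent ν i ℕ.+ i
  go ℕ.≤′-refl            _   = ℕₚ.≤-refl
  go (ℕ.≤′-step {j} i≤′j) j<m = ℕₚ.≤-trans
    (ℕₚ.≤-trans (ℕₚ.≤-reflexive (ℕₚ.+-suc _ j)) (ℕₚ.+-monoˡ-≤ j (step strict j<m)))
    (go i≤′j (ℕₚ.<-trans (ℕₚ.n<1+n j) j<m))

-- Rows of the doubled partition

legs : List ℕ → ℕ → ℕ
legs μ r = count (λ j → r ≤ᵇ (entry μ j ℕ.∸ 1) ℕ.+ j) [ 1 ⋯ length μ ]

module Doubled {μ : List ℕ} (strict : Strict μ) (μ>0 : All (0 ℕ.<_) μ) where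

  m = length μ

  ent>0 : ∀ {i} → i ℕ.< m → 0 ℕ.< ent μ i
  ent>0 i<m = All.lookup μ>0 (ent-∈ μ i<m)

  0∉μ : memb 0 μ ≡ false
  0∉μ = ∉⇒memb μ (λ 0∈ → ℕₚ.<-irrefl refl (All.lookup μ>0 0∈))

  slope : ∀ {i j} → i ℕ.≤ j → j ℕ.< m → ent μ j ℕ.+ j ℕ.≤ ent μ i ℕ.+ i
  slope = strict-slope strict

  private
    leg : ℕ → ℕ → Bool
    leg r j = r ≤ᵇ (entry μ j ℕ.∸ 1) ℕ.+ j

    leg-val : ∀ {j} → j ℕ.< m → (ent μ j ℕ.∸ 1) ℕ.+ suc j ≡ ent μ j ℕ.+ j
    leg-val {j} j<m with ent μ j | ent>0 j<m
    ... | suc a | _ = ℕₚ.+-suc a j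

    leg-initial : ∀ r → Initial (leg r ∘ suc) m
    leg-initial r {j} {k} j≤k k<m eq = ≤ᵇ-true {r} (ℕₚ.≤-trans (≤ᵇ⇒≤ {r} eq)
      (ℕₚ.≤-trans (ℕₚ.≤-reflexive (leg-val k<m)) (ℕₚ.≤-trans (slope j≤k k<m)
        (ℕₚ.≤-reflexive (sym (leg-val (ℕₚ.≤-<-trans j≤k k<m)))))))

    legs-applyUpTo : ∀ r → legs μ r ≡ count (leg r) (applyUpTo suc m)
    legs-applyUpTo r = cong (count (leg r)) (map-upTo suc m)

  legs⇒ : ∀ {r c} → c ℕ.< legs μ r → (c ℕ.< m) × (r ℕ.≤ ent μ c ℕ.+ c)
  legs⇒ {r} {c} c< with count-initial (leg r) suc m (leg-initial r) (subst (c ℕ.<_) (legs-applyUpTo r) c<)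
  ... | c<m , eq = c<m , ℕₚ.≤-trans (≤ᵇ⇒≤ eq) (ℕₚ.≤-reflexive (leg-val c<m))

  ⇒legs : ∀ {r c} → c ℕ.< m → r ℕ.≤ ent μ c ℕ.+ c → c ℕ.< legs μ r
  ⇒legs {r} {c} c<m r≤ = subst (c ℕ.<_) (sym (legs-applyUpTo r)) (initial-count (leg r) suc m (leg-initial r) c<m
    (≤ᵇ-true (ℕₚ.≤-trans r≤ (ℕₚ.≤-reflexive (sym (leg-val c<m))))))

  legs≤m : ∀ r → legs μ r ℕ.≤ m
  legs≤m r = ≤-from-< (λ c< → proj₁ (legs⇒ {r} c<))

  private
    upper lower : List ℕ
    upper = map (λ r → entry μ r ℕ.+ r) [ 1 ⋯ m ]
    lower = map (legs μ) [ suc m ⋯ entry μ 1 ]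

    upper≡ : upper ≡ applyUpTo (λ i → ent μ i ℕ.+ suc i) m
    upper≡ = map-range _ 1 m

    length-upper : length upper ≡ m
    length-upper = ≡.trans (cong length upper≡) (length-applyUpTo _ m)

    raw-< : ∀ {i} → i ℕ.< m → ent (upper ++ lower) i ≡ ent μ i ℕ.+ suc i
    raw-< {i} i<m = ≡.trans (ent-++ˡ upper lower (subst (i ℕ.<_) (sym length-upper) i<m))
      (≡.trans (cong (λ xs → ent xs i) upper≡) (ent-applyUpTo-< _ i<m))

    raw-≥ : ∀ {i} → m ℕ.≤ i → ent (upper ++ lower) i ≡ legs μ (suc i)
    raw-≥ {i} m≤i = begin
      ent (upper ++ lower) i
        ≡⟨ cong (ent (upper ++ lower)) (sym (≡.trans (cong (ℕ._+ k) length-upper) m+k)) ⟩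
      ent (upper ++ lower) (length upper ℕ.+ k)
        ≡⟨ ent-++ʳ upper lower k ⟩
      ent lower k
        ≡⟨ cong (λ xs → ent xs k) (map-range (legs μ) (suc m) (entry μ 1)) ⟩
      ent (applyUpTo (λ i → legs μ (suc m ℕ.+ i)) n) k
        ≡⟨ tail ⟩
      legs μ (suc i) ∎
      where
      open ≡-Reasoning
      k = i ℕ.∸ m
      n = entry μ 1 ℕ.∸ m
      m+k : m ℕ.+ k ≡ i
      m+k = ℕₚ.m+[n∸m]≡n m≤i
      tail : ent (applyUpTo (λ i → legs μ (suc m ℕ.+ i)) n) k ≡ legs μ (suc i)
      tail with k ℕₚ.<? n
      ... | yes k<n = ≡.trans (ent-applyUpTo-< _ k<n) (cong (legs μ ∘ suc) m+k)
      -- Beyond the listed rows the default 0 is correct: a leg in row `suc i` would give, by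
      -- `slope`, i below the first part, so the row would be listed.
      ... | no k≮n  = ≡.trans (ent-≥length (applyUpTo _ n) (ℕₚ.≤-trans (ℕₚ.≤-reflexive (length-applyUpTo _ n)) (ℕₚ.≮⇒≥ k≮n)))
                        (sym (ℕₚ.n≤0⇒n≡0 (≤-from-< λ c< → ⊥-elim (absurd c<))))
        where
        absurd : ∀ {c} → c ℕ.< legs μ (suc i) → ⊥
        absurd c< with legs⇒ c<
        ... | c<m , i<f = k≮n (ℕₚ.∸-monoˡ-< (ℕₚ.≤-trans i<f (ℕₚ.≤-trans (slope z≤n c<m)
                (ℕₚ.≤-reflexive (ℕₚ.+-identityʳ _)))) m≤i)

    raw-decreasing : Decreasing (upper ++ lower)
    raw-decreasing = step⇒decreasing (upper ++ lower) step
      where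
      step : ∀ i → ent (upper ++ lower) (suc i) ℕ.≤ ent (upper ++ lower) i
      step i with i ℕₚ.<? m | suc i ℕₚ.<? m
      ... | yes p | yes q rewrite raw-< p | raw-< q =
        ℕₚ.≤-trans (ℕₚ.≤-reflexive (ℕₚ.+-suc _ (suc i)))
          (ℕₚ.≤-trans (s≤s (slope (ℕₚ.n≤1+n i) q)) (ℕₚ.≤-reflexive (sym (ℕₚ.+-suc _ i))))
      ... | yes p | no q rewrite raw-< p | raw-≥ (ℕₚ.≮⇒≥ q) =
        ℕₚ.≤-trans (legs≤m _) (ℕₚ.≤-trans (ℕₚ.≮⇒≥ q) (ℕₚ.m≤n+m (suc i) (ent μ i)))
      ... | no p  | yes q = ⊥-elim (p (ℕₚ.<-trans (ℕₚ.n<1+n i) q))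
      ... | no p  | no q rewrite raw-≥ (ℕₚ.≮⇒≥ p) | raw-≥ (ℕₚ.≮⇒≥ q) = ≤-from-< λ c< →
        let c<m , le = legs⇒ c< in ⇒legs c<m (ℕₚ.≤-trans (ℕₚ.n≤1+n (suc i)) le)

  D-upper : ∀ {i} → i ℕ.< m → ent (D μ) i ≡ ent μ i ℕ.+ suc i
  D-upper {i} i<m = ≡.trans (ent-nonzero (upper ++ lower) raw-decreasing i) (raw-< i<m)

  D-lower : ∀ {i} → m ℕ.≤ i → ent (D μ) i ≡ legs μ (suc i)
  D-lower {i} m≤i = ≡.trans (ent-nonzero (upper ++ lower) raw-decreasing i) (raw-≥ m≤i)

  D-decreasing : Decreasing (D μ)
  D-decreasing {i} {j} i≤j
    rewrite ent-nonzero (upper ++ lower) raw-decreasing i | ent-nonzero (upper ++ lower) raw-decreasing j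
    = raw-decreasing i≤j

-- The index runs over all naturals and rows past the end have length 0, so every sufficiently
-- negative integer belongs.
Maya : List ℕ → ℤ → Set
Maya ν x = ∃ λ i → x ≡ + ent ν i - + suc i

module _ {μ : List ℕ} (strict : Strict μ) (μ>0 : All (0 ℕ.<_) μ) where
  open Doubled strict μ>0

  private
    cancel : ∀ a s → a + s - s ≡ a
    cancel = solve-∀

  -- The first m rows give the parts. A later row i with L legs gives -(n + 1) with n = i - L. If n
  -- + 1 were the part at index j, its leg would end at i + 1 + (j - L): too short for this row when
  -- j < L, long enough when j ≥ L, and both contradict the value of L.
  Maya-D⇒S : ∀ {x} → Maya (D μ) x → S μ x ≡ true
  Maya-D⇒S (i , refl) with i ℕₚ.<? m
  ... | yes i<m rewrite D-upper i<m = ≡.trans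
    (cong (S μ) (cancel (+ ent μ i) (+ suc i))) (∈⇒memb (ent-∈ μ i<m))
  ... | no i≮m rewrite D-lower (ℕₚ.≮⇒≥ i≮m) = ≡.trans (cong (S μ) neg) (cong not (∉⇒memb μ n∉))
    where
    L = legs μ (suc i)
    n = i ℕ.∸ L
    L≤i : L ℕ.≤ i
    L≤i = ℕₚ.≤-trans (legs≤m (suc i)) (ℕₚ.≮⇒≥ i≮m)
    L+n : L ℕ.+ n ≡ i
    L+n = ℕₚ.m+[n∸m]≡n L≤i
    ring : ∀ l n → l - (1ℤ + (l + n)) ≡ - (1ℤ + n)
    ring = solve-∀
    neg : + L - + suc i ≡ -[1+ n ]
    neg = ≡.trans (cong (λ k → + L - + suc k) (sym L+n)) (ring (+ L) (+ n))
    n∉ : suc n ∉ μ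
    n∉ n∈ with ∈-ent n∈
    ... | j , j<m , eq with j ℕₚ.<? L
    ... | yes j<L = ℕₚ.<-irrefl refl (ℕₚ.≤-<-trans (proj₂ (legs⇒ j<L)) (begin-strict
        ent μ j ℕ.+ j ≡⟨ cong (ℕ._+ j) eq ⟩
        suc n ℕ.+ j   <⟨ ℕₚ.+-monoʳ-< (suc n) j<L ⟩
        suc n ℕ.+ L   ≡⟨ cong suc (≡.trans (ℕₚ.+-comm n L) L+n) ⟩
        suc i         ∎))
      where open ℕₚ.≤-Reasoning
    ... | no j≮L = j≮L (⇒legs j<m (begin
        suc i         ≡⟨ cong suc (≡.trans (sym L+n) (ℕₚ.+-comm L n)) ⟩
        suc n ℕ.+ L   ≤⟨ ℕₚ.+-monoʳ-≤ (suc n) (ℕₚ.≮⇒≥ j≮L) ⟩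
        suc n ℕ.+ j   ≡⟨ cong (ℕ._+ j) (sym eq) ⟩
        ent μ j ℕ.+ j ∎))
      where open ℕₚ.≤-Reasoning

  S⇒Maya-D : ∀ x → S μ x ≡ true → Maya (D μ) x
  S⇒Maya-D (+ n) eq with ∈-ent (memb⇒∈ n μ eq)
  ... | i , i<m , refl = i , sym (≡.trans (cong (λ k → + k - + suc i) (D-upper i<m)) (cancel (+ ent μ i) (+ suc i)))
  S⇒Maya-D -[1+ n ] eq = i , sym (≡.trans (cong (λ k → + k - + suc i) (≡.trans (D-lower m≤i) L≡t)) (ring (+ t) (+ n)))
    where
    n∉ : suc n ∉ μ
    n∉ = memb-∉ (not-true eq)
    big : ℕ → Bool
    big a = suc n <ᵇ a
    big-initial : Initial (big ∘ ent μ) m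
    big-initial {j} {k} j≤k k<m e = <ᵇ-true (ℕₚ.+-cancelʳ-< j _ _ (ℕₚ.<-≤-trans
      (ℕₚ.+-mono-<-≤ (<ᵇ⇒< {suc n} e) j≤k) (slope j≤k k<m)))
    -- There are t parts exceeding n + 1, and row n + t turns out to meet exactly their legs, so its
    -- value is t - (n + t + 1) = -(n + 1).
    t = count big (applyUpTo (ent μ) m)
    i = n ℕ.+ t
    ring : ∀ t n → t - (1ℤ + (n + t)) ≡ - (1ℤ + n)
    ring = solve-∀
    below : ∀ {c} → c ℕ.< t → (c ℕ.< m) × (suc i ℕ.≤ ent μ c ℕ.+ c)
    below {c} c<t = c<m , (begin
        suc (n ℕ.+ t)        ≡⟨ cong (λ k → suc (n ℕ.+ k)) (sym t≡) ⟩
        suc (n ℕ.+ suc t-1)  ≡⟨ cong suc (ℕₚ.+-suc n t-1) ⟩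
        suc (suc n) ℕ.+ t-1  ≤⟨ ℕₚ.+-monoˡ-≤ t-1 (<ᵇ⇒< {suc n} (proj₂ last)) ⟩
        ent μ t-1 ℕ.+ t-1    ≤⟨ slope (ℕ.s≤s⁻¹ (ℕₚ.≤-trans c<t (ℕₚ.≤-reflexive (sym t≡)))) (proj₁ last) ⟩
        ent μ c ℕ.+ c        ∎)
      where
      open ℕₚ.≤-Reasoning
      t-1 = ℕ.pred t
      t≡ : suc t-1 ≡ t
      t≡ = ℕₚ.suc-pred t {{ℕ.>-nonZero (ℕₚ.≤-<-trans z≤n c<t)}}
      c<m = proj₁ (count-initial big (ent μ) m big-initial c<t)
      last = count-initial big (ent μ) m big-initial (ℕₚ.≤-reflexive t≡)
    above : ∀ {c} → t ℕ.≤ c → c ℕ.< m → ent μ c ℕ.+ c ℕ.≤ i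
    above {c} t≤c c<m = ℕₚ.≤-trans (slope t≤c c<m) (ℕₚ.+-monoˡ-≤ t small)
      where
      t<m = ℕₚ.≤-<-trans t≤c c<m
      small : ent μ t ℕ.≤ n
      small with suc n ℕₚ.<? ent μ t
      ... | yes lt = ⊥-elim (ℕₚ.<-irrefl refl (initial-count big (ent μ) m big-initial t<m (<ᵇ-true lt)))
      ... | no nlt = ℕ.s≤s⁻¹ (ℕₚ.≤∧≢⇒< (ℕₚ.≮⇒≥ nlt) (λ e → n∉ (subst (_∈ μ) e (ent-∈ μ t<m))))
    L≡t : legs μ (suc i) ≡ t
    L≡t = ℕₚ.≤-antisym
      (≤-from-< λ {c} c<L → ℕₚ.≰⇒> λ t≤c → ℕₚ.<-irrefl refl
        (ℕₚ.≤-trans (proj₂ (legs⇒ c<L)) (above t≤c (proj₁ (legs⇒ c<L)))))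
      (≤-from-< λ c<t → ⇒legs (proj₁ (below c<t)) (proj₂ (below c<t)))
    m≤i : m ℕ.≤ i
    m≤i with m ℕₚ.≤? i
    ... | yes p = p
    ... | no  p = ⊥-elim (p (begin
        m                     ≡⟨ sym m≡ ⟩
        suc m-1               ≤⟨ ℕₚ.+-monoˡ-≤ m-1 (ent>0 (ℕₚ.≤-reflexive m≡)) ⟩
        ent μ m-1 ℕ.+ m-1     ≤⟨ above (ℕ.s≤s⁻¹ (ℕₚ.≤-trans t<m (ℕₚ.≤-reflexive (sym m≡)))) (ℕₚ.≤-reflexive m≡) ⟩
        i                     ∎))
      where
      open ℕₚ.≤-Reasoning
      t<m : t ℕ.< m
      t<m = ℕₚ.≤-<-trans (ℕₚ.m≤n+m t n) (ℕₚ.≰⇒> p)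
      m-1 = ℕ.pred m
      m≡ : suc m-1 ≡ m
      m≡ = ℕₚ.suc-pred m {{ℕ.>-nonZero (ℕₚ.≤-<-trans z≤n t<m)}}

-- β-sets and the abacus

infix 1 _⇔_
_⇔_ : Set → Set → Set
P ⇔ Q = (P → Q) × (Q → P)

⇔-trans : ∀ {P Q R} → P ⇔ Q → Q ⇔ R → P ⇔ R
⇔-trans (f , g) (f′ , g′) = f′ ∘ f , g ∘ g′

⇔-sym : ∀ {P Q} → P ⇔ Q → Q ⇔ P
⇔-sym (f , g) = g , f

-- β-sets are extended by all negative integers, which makes membership invariant under shifts.
infix 4 _∈β_
_∈β_ : ℤ → List ℕ → Set
+ w      ∈β bs = w ∈ bs
-[1+ _ ] ∈β bs = ⊤

<0⇒∈β : ∀ {z bs} → z ℤ.< 0ℤ → z ∈β bs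
<0⇒∈β { -[1+ _ ]} _ = tt
<0⇒∈β {+ _} (ℤ.+<+ ())

map-strict : ∀ (f : ℕ → ℕ) {xs} → (∀ {x y} → x ∈ xs → y ∈ xs → y ℕ.< x → f y ℕ.< f x) →
  Strict xs → Strict (map f xs)
map-strict f          mono []       = []
map-strict f {x ∷ xs} mono (x> ∷ s) = All.tabulate below ∷ map-strict f (λ p q → mono (there p) (there q)) s
  where
  below : ∀ {z} → z ∈ map f xs → z ℕ.< f x
  below z∈ with ∈-map⁻ f z∈
  ... | y , y∈ , refl = mono (here refl) (there y∈) (All.lookup x> y∈)

module Beta (d : ℕ) .{{_ : NonZero d}} where

  module _ {bs : List ℕ} (bs> : Strict bs) where
    private
      n = length bs
      row : ℕ → ℕ
      row i = ent bs i ℕ.∸ (n ℕ.∸ suc i)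
      raw : List ℕ
      raw = map (λ s → entry bs s ℕ.∸ (n ℕ.∸ s)) [ 1 ⋯ n ]
      raw≡ : raw ≡ applyUpTo row n
      raw≡ = map-range _ 1 n

      row-val : ∀ {i} → i ℕ.< n → row i ℕ.+ n ≡ ent bs i ℕ.+ suc i
      row-val {i} i<n = begin
        row i ℕ.+ n                           ≡⟨ cong (row i ℕ.+_) (sym (ℕₚ.m∸n+n≡m i<n)) ⟩
        row i ℕ.+ ((n ℕ.∸ suc i) ℕ.+ suc i)   ≡⟨ sym (ℕₚ.+-assoc (row i) _ _) ⟩
        row i ℕ.+ (n ℕ.∸ suc i) ℕ.+ suc i     ≡⟨ cong (ℕ._+ suc i) (ℕₚ.m∸n+n≡m (ℕₚ.m≤n+o⇒m∸n≤o n (suc i) fits)) ⟩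
        ent bs i ℕ.+ suc i                    ∎
        where
        open ≡-Reasoning
        n≡ : suc (ℕ.pred n) ≡ n
        n≡ = ℕₚ.suc-pred n {{ℕ.>-nonZero (ℕₚ.≤-<-trans z≤n i<n)}}
        fits : n ℕ.≤ suc i ℕ.+ ent bs i
        fits = ℕₚ.≤-trans (ℕₚ.≤-reflexive (sym n≡)) (s≤s (ℕₚ.≤-trans (ℕₚ.m≤n+m _ (ent bs (ℕ.pred n)))
          (ℕₚ.≤-trans (strict-slope bs> (ℕ.s≤s⁻¹ (ℕₚ.≤-trans i<n (ℕₚ.≤-reflexive (sym n≡)))) (ℕₚ.≤-reflexive n≡))
            (ℕₚ.≤-reflexive (ℕₚ.+-comm (ent bs i) i)))))

      raw-< : ∀ {i} → i ℕ.< n → ent raw i ≡ row i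
      raw-< {i} i<n = ≡.trans (cong (λ xs → ent xs i) raw≡) (ent-applyUpTo-< row i<n)

      raw-≥ : ∀ {i} → n ℕ.≤ i → ent raw i ≡ 0
      raw-≥ n≤i = ent-≥length raw (ℕₚ.≤-trans (ℕₚ.≤-reflexive
        (≡.trans (cong length raw≡) (length-applyUpTo row n))) n≤i)

      raw-decreasing : Decreasing raw
      raw-decreasing = step⇒decreasing raw step
        where
        step : ∀ i → ent raw (suc i) ℕ.≤ ent raw i
        step i with suc i ℕₚ.<? n
        ... | no p rewrite raw-≥ (ℕₚ.≮⇒≥ p) = z≤n
        ... | yes p rewrite raw-< p | raw-< (ℕₚ.<-trans (ℕₚ.n<1+n i) p) =
          ℕₚ.+-cancelʳ-≤ n _ _ (begin
            row (suc i) ℕ.+ n             ≡⟨ row-val p ⟩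
            ent bs (suc i) ℕ.+ suc (suc i) ≡⟨ ℕₚ.+-suc _ (suc i) ⟩
            suc (ent bs (suc i) ℕ.+ suc i) ≤⟨ s≤s (strict-slope bs> (ℕₚ.n≤1+n i) p) ⟩
            suc (ent bs i ℕ.+ i)           ≡⟨ sym (ℕₚ.+-suc _ i) ⟩
            ent bs i ℕ.+ suc i             ≡⟨ sym (row-val (ℕₚ.<-trans (ℕₚ.n<1+n i) p)) ⟩
            row i ℕ.+ n                    ∎)
          where open ℕₚ.≤-Reasoning

      ent-< : ∀ {i} → i ℕ.< n → ent (fromBeta d bs) i ≡ row i
      ent-< {i} i<n = ≡.trans (ent-nonzero raw raw-decreasing i) (raw-< i<n)

      ent-≥ : ∀ {i} → n ℕ.≤ i → ent (fromBeta d bs) i ≡ 0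
      ent-≥ {i} n≤i = ≡.trans (ent-nonzero raw raw-decreasing i) (raw-≥ n≤i)

    -- Entry i of `bs` equals the i-th row length minus i + 1, shifted by the number n of beads; the
    -- empty rows i ≥ n fill precisely the negative integers.
    Maya-fromBeta : ∀ x → Maya (fromBeta d bs) x ⇔ ((x + + n) ∈β bs)
    Maya-fromBeta x = to , from (x + + n) refl
      where
      ring₁ : ∀ r s n → r - s + n ≡ r + n - s
      ring₁ = solve-∀
      ring₂ : ∀ e s → e + s - s ≡ e
      ring₂ = solve-∀
      val : ∀ {i} → i ℕ.< n → + ent (fromBeta d bs) i - + suc i + + n ≡ + ent bs i
      val {i} i<n rewrite ent-< i<n = ≡.trans (ring₁ (+ row i) (+ suc i) (+ n))
        (≡.trans (cong (λ k → + k - + suc i) (row-val i<n)) (ring₂ (+ ent bs i) (+ suc i)))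
      to : Maya (fromBeta d bs) x → (x + + n) ∈β bs
      to (i , refl) with i ℕₚ.<? n
      ... | yes i<n = subst (_∈β bs) (sym (val i<n)) (ent-∈ bs i<n)
      ... | no i≮n rewrite ent-≥ (ℕₚ.≮⇒≥ i≮n) = <0⇒∈β (1+≤⇒<
              (≤-by (ℤ.+≤+ (ℕₚ.≮⇒≥ i≮n)) (ring (+ i) (+ n))))
        where
        ring : ∀ i n → 0ℤ - (1ℤ + (0ℤ - (1ℤ + i) + n)) ≡ i - n
        ring = solve-∀
      from : ∀ z → x + + n ≡ z → z ∈β bs → Maya (fromBeta d bs) x
      from (+ w) eq w∈ with ∈-ent w∈
      ... | i , i<n , e = i , ≡-by (≡.trans eq (≡.trans (cong +_ (sym e)) (sym (val i<n)))) (ring (+ ent (fromBeta d bs) i - + suc i) x (+ n))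
        where
        ring : ∀ y x n → y - x ≡ y + n - (x + n) 
        ring = solve-∀
      from -[1+ w ] eq _ = n ℕ.+ w , ≡.trans (≡-by eq (ring x (+ n) (+ w)))
          (cong (λ k → + k - + suc (n ℕ.+ w)) (sym (ent-≥ (ℕₚ.m≤m+n n w))))
        where
        ring : ∀ x n w → 0ℤ - (1ℤ + (n + w)) - x ≡ - (1ℤ + w) - (x + n)
        ring = solve-∀

  +-* : ∀ i w → + (i ℕ.+ w ℕ.* d) ≡ + i + + w * + d
  +-* i w = cong (_+_ (+ i)) (ℤₚ.pos-* w d)

  -- An integer i + w d with i < d is position w on runner i. Comparison with multiples of d sees
  -- only w, and w may be negative.
  block-< : ∀ {i w v} → i ℕ.< d → w ℤ.< v → + i + w * + d ℤ.< v * + d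
  block-< {i} {w} {v} i<d w<v = ℤₚ.<-≤-trans (ℤₚ.+-monoˡ-< (w * + d) (ℤ.+<+ i<d))
    (subst (ℤ._≤ v * + d) (ring w (+ d)) (ℤₚ.*-monoʳ-≤-nonNeg (+ d) (<⇒1+≤ w<v)))
    where
    ring : ∀ w d → (1ℤ + w) * d ≡ d + w * d
    ring = solve-∀

  block-≥ : ∀ {i w v} → v ℤ.≤ w → v * + d ℤ.≤ + i + w * + d
  block-≥ {i} {w} v≤w = ℤₚ.≤-trans (ℤₚ.*-monoʳ-≤-nonNeg (+ d) v≤w) (ℤₚ.i≤j+i (w * + d) (+ i))

  block-unique : ∀ {i j w v} → i ℕ.< d → j ℕ.< d → + i + w * + d ≡ + j + v * + d → (i ≡ j) × (w ≡ v)
  block-unique {i} {j} {w} {v} i<d j<d eq with ℤₚ.<-cmp w v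
  ... | tri< w<v _ _ = ⊥-elim (ℤₚ.<-irrefl eq (ℤₚ.<-≤-trans (block-< i<d w<v) (block-≥ {j} {v} {v} ℤₚ.≤-refl)))
  ... | tri> _ _ v<w = ⊥-elim (ℤₚ.<-irrefl (sym eq) (ℤₚ.<-≤-trans (block-< j<d v<w) (block-≥ {i} {w} {w} ℤₚ.≤-refl)))
  ... | tri≈ _ refl _ = ℤₚ.+-injective (≡-by eq (ring (+ i) (+ j) (w * + d))) , refl
    where
    ring : ∀ i j w → j - i ≡ j + w - (i + w)
    ring = solve-∀

  %ℕ-block : ∀ {i} w → i ℕ.< d → (+ i + w * + d) %ℕ d ≡ i
  %ℕ-block {i} w i<d = proj₁ (block-unique {x %ℕ d} {i} {x /ℕ d} {w} (ℤ-DivMod.n%ℕd<d x d) i<d (sym (ℤ-DivMod.a≡a%ℕn+[a/ℕn]*n x d)))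
    where x = + i + w * + d

  %-block : ∀ {i} w → i ℕ.< d → (i ℕ.+ w ℕ.* d) % d ≡ i
  %-block {i} w i<d = ≡.trans ([m+kn]%n≡m%n i w d) (m<n⇒m%n≡m i<d)

  /-block : ∀ {i} w → i ℕ.< d → (i ℕ.+ w ℕ.* d) / d ≡ w
  /-block {i} w i<d = ℕₚ.*-cancelʳ-≡ _ w d (ℕₚ.+-cancelˡ-≡ i _ _ (sym (≡.trans
    (m≡m%n+[m/n]*n y d) (cong (ℕ._+ (y / d) ℕ.* d) (%-block w i<d)))))
    where y = i ℕ.+ w ℕ.* d

  ∸-/-block : ∀ {i} w → (i ℕ.+ w ℕ.* d ℕ.∸ i) / d ≡ w
  ∸-/-block {i} w = ≡.trans (cong (_/ d) (ℕₚ.m+n∸m≡n i (w ℕ.* d))) (m*n/n≡m w d)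

  module Abacus {ν : List ℕ} (dec : Decreasing ν) where
    K = (length (nonzero ν) ℕ.+ (d ℕ.∸ 1)) / d
    k = abacusK d ν
    X = betaSet d ν
    b = beads d ν

    +k : + k ≡ + K * + d
    +k = ≡.trans (ℤₚ.pos-* d K) (ℤₚ.*-comm (+ d) (+ K))

    length≤k : length (nonzero ν) ℕ.≤ k
    length≤k = ℕₚ.+-cancelʳ-≤ (d ℕ.∸ 1) l k (begin
      l ℕ.+ (d ℕ.∸ 1)              ≡⟨ m≡m%n+[m/n]*n t d ⟩
      t % d ℕ.+ K ℕ.* d             ≤⟨ ℕₚ.+-monoˡ-≤ (K ℕ.* d) (ℕₚ.∸-monoˡ-≤ 1 (m%n<n t d)) ⟩
      (d ℕ.∸ 1) ℕ.+ K ℕ.* d         ≡⟨ ℕₚ.+-comm (d ℕ.∸ 1) _ ⟩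
      K ℕ.* d ℕ.+ (d ℕ.∸ 1)         ≡⟨ cong (ℕ._+ (d ℕ.∸ 1)) (ℕₚ.*-comm K d) ⟩
      k ℕ.+ (d ℕ.∸ 1)               ∎)
      where
      open ℕₚ.≤-Reasoning
      l = length (nonzero ν)
      t = l ℕ.+ (d ℕ.∸ 1)

    ent-≥k : ∀ {i} → k ℕ.≤ i → ent ν i ≡ 0
    ent-≥k {i} k≤i = ≡.trans (sym (ent-nonzero ν dec i)) (ent-≥length (nonzero ν) (ℕₚ.≤-trans length≤k k≤i))

    bead : ℕ → ℕ
    bead i = ent ν i ℕ.+ k ℕ.∸ suc i

    X≡ : X ≡ applyUpTo bead k
    X≡ = map-range _ 1 k

    +bead : ∀ {i} → i ℕ.< k → + bead i ≡ + ent ν i - + suc i + + k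
    +bead {i} i<k = ≡.trans (sym (ℤₚ.⊖-≥ le)) (≡.trans (sym (ℤₚ.m-n≡m⊖n (ent ν i ℕ.+ k) (suc i)))
      (ring (+ ent ν i) (+ k) (+ suc i)))
      where
      le : suc i ℕ.≤ ent ν i ℕ.+ k
      le = ℕₚ.≤-trans i<k (ℕₚ.m≤n+m k (ent ν i))
      ring : ∀ e k s → e + k - s ≡ e - s + k
      ring = solve-∀

    X-strict : Strict X
    X-strict = subst Strict (sym X≡) (AllPairsₚ.applyUpTo⁺₁ bead k mono)
      where
      mono : ∀ {i j} → i ℕ.< j → j ℕ.< k → bead j ℕ.< bead i
      mono {i} {j} i<j j<k = ℕₚ.<-≤-trans
        (ℕₚ.∸-monoʳ-< (s≤s i<j) (ℕₚ.≤-trans j<k (ℕₚ.m≤n+m k (ent ν j))))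
        (ℕₚ.∸-monoˡ-≤ (suc i) (ℕₚ.+-monoˡ-≤ k (dec (ℕₚ.<⇒≤ i<j))))

    length-X : length X ≡ k
    length-X = ≡.trans (cong length X≡) (length-applyUpTo bead k)

    Maya-X : ∀ x → Maya ν x ⇔ x + + k ∈β X
    Maya-X x = to , from (x + + k) refl
      where
      to : Maya ν x → x + + k ∈β X
      to (i , refl) with i ℕₚ.<? k
      ... | yes i<k = subst (_∈β X) (+bead i<k) (subst (bead i ∈_) (sym X≡) (∈-applyUpTo⁺ bead i<k))
      ... | no i≮k rewrite ent-≥k (ℕₚ.≮⇒≥ i≮k) = <0⇒∈β (1+≤⇒<
              (≤-by (ℤ.+≤+ (ℕₚ.≮⇒≥ i≮k)) (ring (+ i) (+ k))))
        where
        ring : ∀ i n → 0ℤ - (1ℤ + (0ℤ - (1ℤ + i) + n)) ≡ i - n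
        ring = solve-∀
      from : ∀ z → x + + k ≡ z → z ∈β X → Maya ν x
      from (+ w) eq w∈ with ∈-applyUpTo⁻ bead (subst (w ∈_) X≡ w∈)
      ... | i , i<k , e = i , ≡-by (≡.trans eq (≡.trans (cong +_ e) (+bead i<k))) (ring (+ ent ν i - + suc i) x (+ k))
        where
        ring : ∀ y x n → y - x ≡ y + n - (x + n)
        ring = solve-∀
      from -[1+ w ] eq _ = k ℕ.+ w , ≡.trans (≡-by eq (ring x (+ k) (+ w)))
          (cong (λ e → + e - + suc (k ℕ.+ w)) (sym (ent-≥k (ℕₚ.m≤m+n k w))))
        where
        ring : ∀ x n w → 0ℤ - (1ℤ + (n + w)) - x ≡ - (1ℤ + w) - (x + n)
        ring = solve-∀

    on : ℕ → ℕ → Bool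
    on i x = (x % d) ≡ᵇ i

    ∈-on⁻ : ∀ {i x} xs → x ∈ filterᵇ (on i) xs → (x ∈ xs) × (x ≡ i ℕ.+ (x / d) ℕ.* d)
    ∈-on⁻ {i} {x} xs x∈ with ∈-filter⁻ (T? ∘ on i) {xs = xs} x∈
    ... | x∈′ , t = x∈′ , ≡.trans (m≡m%n+[m/n]*n x d)
            (cong (ℕ._+ (x / d) ℕ.* d) (ℕₚ.≡ᵇ⇒≡ (x % d) i t))

    ∈-on⁺ : ∀ {i w} xs → i ℕ.< d → i ℕ.+ w ℕ.* d ∈ xs → i ℕ.+ w ℕ.* d ∈ filterᵇ (on i) xs
    ∈-on⁺ {i} {w} xs i<d x∈ = ∈-filter⁺ (T? ∘ on i) x∈ (ℕₚ.≡⇒≡ᵇ _ i (%-block w i<d))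

    runner : ℕ → List ℕ
    runner i = map (λ x → (x ℕ.∸ i) / d) (filterᵇ (on i) X)

    ∈-runner : ∀ {i} w → i ℕ.< d → (w ∈ runner i) ⇔ (i ℕ.+ w ℕ.* d ∈ X)
    ∈-runner {i} w i<d = to , from
      where
      to : w ∈ runner i → i ℕ.+ w ℕ.* d ∈ X
      to w∈ with ∈-map⁻ _ w∈
      ... | x , x∈ , refl with ∈-on⁻ X x∈
      ... | x∈X , eq = subst (_∈ X) (≡.trans eq (cong (λ v → i ℕ.+ v ℕ.* d)
              (sym (≡.trans (cong (λ y → (y ℕ.∸ i) / d) eq) (∸-/-block {i} (x / d)))))) x∈X
      from : i ℕ.+ w ℕ.* d ∈ X → w ∈ runner i
      from x∈ = subst (_∈ runner i) (∸-/-block {i} w) (∈-map⁺ (λ x → (x ℕ.∸ i) / d) (∈-on⁺ {w = w} X i<d x∈))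

    runner-strict : ∀ i → Strict (runner i)
    runner-strict i = map-strict _ mono (AllPairsₚ.filter⁺ (T? ∘ on i) X-strict)
      where
      mono : ∀ {x y} → x ∈ filterᵇ (on i) X → y ∈ filterᵇ (on i) X → y ℕ.< x →
        (y ℕ.∸ i) / d ℕ.< (x ℕ.∸ i) / d
      mono {x} {y} x∈ y∈ y<x with ∈-on⁻ X x∈ | ∈-on⁻ X y∈
      ... | _ , ex | _ , ey rewrite ≡.trans (cong (λ z → (z ℕ.∸ i) / d) ex) (∸-/-block {i} (x / d))
                                  | ≡.trans (cong (λ z → (z ℕ.∸ i) / d) ey) (∸-/-block {i} (y / d))
        = ℕₚ.*-cancelʳ-< d _ _ (ℕₚ.+-cancelˡ-< i _ _ (subst (ℕ._< _) ey (subst (y ℕ.<_) ex y<x)))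

    ∈β-runner : ∀ {i} z → i ℕ.< d → (z ∈β runner i) ⇔ (+ i + z * + d ∈β X)
    ∈β-runner {i} (+ w) i<d = ⇔-trans (∈-runner w i<d)
      (subst (_∈β X) (+-* i w) , subst (_∈β X) (sym (+-* i w)))
    ∈β-runner {i} z@(-[1+ w ]) i<d =
      (λ _ → <0⇒∈β (block-< {v = 0ℤ} i<d (ℤ.-<+ {w} {0}))) , (λ _ → tt)

    -- Origin of the charge: reading the quotient partition subtracts the `b i` beads of its runner,
    -- while reading ν subtracts k = K d, that is K positions on every runner. The difference `b i`
    -- - K remains.
    quotient-Maya : ∀ {i} z → i ℕ.< d → Maya (quotientPart d ν i) z ⇔ Maya ν (+ i + (z + (+ b i - + K)) * + d)
    quotient-Maya {i} z i<d = ⇔-trans (Maya-fromBeta (runner-strict i) z)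
      (⇔-trans (∈β-runner (z + + length (runner i)) i<d)
      (⇔-trans (subst (_∈β X) (sym eq) , subst (_∈β X) eq) (⇔-sym (Maya-X _))))
      where
      ring : ∀ i z b K d → i + (z + (b - K)) * d + K * d ≡ i + (z + b) * d
      ring = solve-∀
      eq : + i + (z + (+ b i - + K)) * + d + + k ≡ + i + (z + + length (runner i)) * + d
      eq = ≡.trans (cong (_+_ (+ i + (z + (+ b i - + K)) * + d)) +k)
        (≡.trans (ring (+ i) z (+ b i) (+ K) (+ d))
          (cong (λ l → + i + (z + + l) * + d) (sym (length-map (λ x → (x ℕ.∸ i) / d) (filterᵇ (on i) X)))))

    settled : ℕ → Bool
    settled y = (y / d) <ᵇ b (y % d)

    C : List ℕ
    C = filterᵇ settled (reverse (upTo (d ℕ.* k)))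

    C-strict : Strict C
    C-strict = AllPairsₚ.filter⁺ (T? ∘ settled) (subst Strict (sym (reverse-upTo (d ℕ.* k)))
      (AllPairsₚ.applyDownFrom⁺₁ (λ x → x) (d ℕ.* k) (λ j<i _ → j<i)))

    -- A crude bound, sufficient for all settled beads to lie below d * k, the range from which `C`
    -- is filtered.
    b≤k : ∀ i → b i ℕ.≤ k
    b≤k i = ℕₚ.≤-trans (length-filter (T? ∘ on i) X) (ℕₚ.≤-reflexive length-X)

    ∈-C : ∀ {i} w → i ℕ.< d → (i ℕ.+ w ℕ.* d ∈ C) ⇔ (w ℕ.< b i)
    ∈-C {i} w i<d = to , from
      where
      y = i ℕ.+ w ℕ.* d
      to : y ∈ C → w ℕ.< b i
      to y∈ with ∈-filter⁻ (T? ∘ settled) {xs = reverse (upTo (d ℕ.* k))} y∈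
      ... | _ , t = subst (ℕ._< b i) (/-block w i<d) (subst (λ j → y / d ℕ.< b j) (%-block w i<d)
              (ℕₚ.<ᵇ⇒< (y / d) _ t))
      from : w ℕ.< b i → y ∈ C
      from w<b = ∈-filter⁺ (T? ∘ settled) (subst (y ∈_) (sym (reverse-upTo (d ℕ.* k))) (∈-downFrom⁺ y<))
        (ℕₚ.<⇒<ᵇ (subst (λ j → y / d ℕ.< b j) (sym (%-block w i<d)) (subst (ℕ._< b i) (sym (/-block w i<d)) w<b)))
        where
        y< : y ℕ.< d ℕ.* k
        y< = begin-strict
          i ℕ.+ w ℕ.* d  <⟨ ℕₚ.+-monoˡ-< (w ℕ.* d) i<d ⟩
          suc w ℕ.* d    ≤⟨ ℕₚ.*-monoˡ-≤ d (ℕₚ.≤-trans w<b (b≤k i)) ⟩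
          k ℕ.* d        ≡⟨ ℕₚ.*-comm k d ⟩
          d ℕ.* k        ∎
          where open ℕₚ.≤-Reasoning

    count-C : ∀ {i} → i ℕ.< d → count (on i) C ≡ b i
    count-C {i} i<d = ≡.trans (↭ₚ.↭-length (unique-↭
        (Uniqueₚ.filter⁺ (T? ∘ on i) (strict⇒unique C-strict))
        (map-unique f (λ _ _ eq → ℕₚ.*-cancelʳ-≡ _ _ d (ℕₚ.+-cancelˡ-≡ i _ _ eq)) (Uniqueₚ.upTo⁺ (b i)))
        to from))
      (≡.trans (length-map f (upTo (b i))) (length-upTo (b i)))
      where
      f : ℕ → ℕ
      f w = i ℕ.+ w ℕ.* d
      to : ∀ {x} → x ∈ filterᵇ (on i) C → x ∈ map f (upTo (b i))
      to {x} x∈ with ∈-on⁻ C x∈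
      ... | x∈C , eq = subst (_∈ map f (upTo (b i))) (sym eq)
              (∈-map⁺ f (∈-upTo⁺ (proj₁ (∈-C (x / d) i<d) (subst (_∈ C) eq x∈C))))
      from : ∀ {x} → x ∈ map f (upTo (b i)) → x ∈ filterᵇ (on i) C
      from x∈ with ∈-map⁻ f x∈
      ... | w , w∈ , refl = ∈-on⁺ {w = w} C i<d (proj₂ (∈-C w i<d) (∈-upTo⁻ w∈))

    mult-residue : ∀ i xs → mult i (map (_% d) xs) ≡ count (on i) xs
    mult-residue i []       = refl
    mult-residue i (x ∷ xs) with x % d ≡ᵇ i in e | i ≡ᵇ x % d in e′
    ... | true  | true  = cong suc (mult-residue i xs)
    ... | false | false = mult-residue i xs
    ... | true  | false with () ← ≡.trans (sym (≡ᵇ-refl i)) (≡.trans (cong (i ≡ᵇ_) (sym (≡ᵇ⇒≡ (x % d) e))) e′)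
    ... | false | true  with () ← ≡.trans (sym (≡ᵇ-refl i)) (≡.trans (cong (_≡ᵇ i) (≡ᵇ⇒≡ i e′)) e)

    -- Pushing beads along runners preserves the number on each runner. In this form the fact makes
    -- periodic sums over the two β-sets agree.
    residues-↭ : map (_% d) X ↭ map (_% d) C
    residues-↭ = mult≡⇒↭ _ _ same
      where
      none : ∀ {i} xs → ¬ i ℕ.< d → mult i (map (_% d) xs) ≡ 0
      none {i} xs i≮d = ∉⇒mult≡0 i _ (λ i∈ → absurd (∈-map⁻ (_% d) i∈))
        where
        absurd : (∃ λ x → (x ∈ xs) × (i ≡ x % d)) → ⊥
        absurd (x , _ , eq) = i≮d (subst (ℕ._< d) (sym eq) (m%n<n x d))
      same : ∀ i → mult i (map (_% d) X) ≡ mult i (map (_% d) C)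
      same i with i ℕₚ.<? d
      ... | yes i<d = ≡.trans (mult-residue i X) (sym (≡.trans (mult-residue i C) (count-C i<d)))
      ... | no  i≮d = ≡.trans (none X i≮d) (sym (none C i≮d))

    -- Ensures that the core is read with the same shift k as ν.
    length-C : length C ≡ k
    length-C = ≡.trans (sym (length-map (_% d) C)) (≡.trans (sym (↭ₚ.↭-length residues-↭))
      (≡.trans (length-map (_% d) X) length-X))

    Maya-C : ∀ x → Maya (core d ν) x ⇔ x + + k ∈β C
    Maya-C x = subst (λ n → Maya (core d ν) x ⇔ x + + n ∈β C) length-C (Maya-fromBeta C-strict x)

    ∈β-C : ∀ {i} z → i ℕ.< d → (+ i + z * + d ∈β C) ⇔ (z ℤ.< + b i)
    ∈β-C {i} (+ w) i<d = ⇔-trans (subst (_∈β C) (sym (+-* i w)) , subst (_∈β C) (+-* i w))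
      (⇔-trans (∈-C w i<d) (ℤ.+<+ , ℤₚ.drop‿+<+))
    ∈β-C {i} -[1+ w ] i<d =
      (λ _ → ℤ.-<+) , (λ _ → <0⇒∈β (block-< {v = 0ℤ} i<d (ℤ.-<+ {w} {0})))

    -- After settling, runner i is occupied exactly below `b i`, negative positions included;
    -- undoing the shift by K makes the charge the threshold.
    core-Maya : ∀ {i} z → i ℕ.< d → Maya (core d ν) (+ i + z * + d) ⇔ (z ℤ.< + b i - + K)
    core-Maya {i} z i<d = ⇔-trans (Maya-C _) (⇔-trans (subst (_∈β C) eq , subst (_∈β C) (sym eq))
      (⇔-trans (∈β-C (z + + K) i<d) (to , from)))
      where
      ring : ∀ i z K d → i + z * d + K * d ≡ i + (z + K) * d
      ring = solve-∀
      eq : + i + z * + d + + k ≡ + i + (z + + K) * + d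
      eq = ≡.trans (cong (_+_ (+ i + z * + d)) +k) (ring (+ i) z (+ K) (+ d))
      r₁ : ∀ z K b → b - K - (1ℤ + z) ≡ b - (1ℤ + (z + K))
      r₁ = solve-∀
      r₂ : ∀ z K b → b - (1ℤ + (z + K)) ≡ b - K - (1ℤ + z)
      r₂ = solve-∀
      to : z + + K ℤ.< + b i → z ℤ.< + b i - + K
      to lt = 1+≤⇒< (≤-by (<⇒1+≤ lt) (r₁ z (+ K) (+ b i)))
      from : z ℤ.< + b i - + K → z + + K ℤ.< + b i
      from lt = 1+≤⇒< (≤-by (<⇒1+≤ lt) (r₂ z (+ K) (+ b i)))

-- Columns of the doubled partition

module Columns {μ : List ℕ} (μ> : Strict μ) (μ>0 : All (0 ℕ.<_) μ) where
  open Doubled μ> μ>0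

  private
    ν = D μ

  -- The missing position of the Maya diagram attached to column c: the hook in row r has length
  -- (ν_r - r) - `foot c`, and its residue is the index j of a hook whose foot node has residue j +
  -- 1.
  foot : ℕ → ℤ
  foot c = + c - + colLen ν c - + 1

  slope≥m : ∀ {s} → s ℕ.< m → m ℕ.≤ ent μ s ℕ.+ s
  slope≥m {s} s<m = begin
    m                   ≡⟨ sym m≡ ⟩
    1 ℕ.+ ℕ.pred m      ≤⟨ ℕₚ.+-monoˡ-≤ (ℕ.pred m) (ent>0 (ℕₚ.≤-reflexive m≡)) ⟩
    ent μ (ℕ.pred m) ℕ.+ ℕ.pred m ≤⟨ slope (ℕ.s≤s⁻¹ (ℕₚ.≤-trans s<m (ℕₚ.≤-reflexive (sym m≡)))) (ℕₚ.≤-reflexive m≡) ⟩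
    ent μ s ℕ.+ s       ∎
    where
    open ℕₚ.≤-Reasoning
    m≡ : suc (ℕ.pred m) ≡ m
    m≡ = ℕₚ.suc-pred m {{ℕ.>-nonZero (ℕₚ.≤-<-trans z≤n s<m)}}

  -- Suppose the foot were the value of row t. If the row reaches the column, the column also
  -- extends past t and the row value is too large; if not, both inequalities flip and it is too
  -- small.
  foot-gap : ∀ {c} → 0 ℕ.< c → S μ (foot c) ≡ false
  foot-gap {suc c} _ with S μ (foot (suc c)) in e
  ... | false = refl
  ... | true with S⇒Maya-D μ> μ>0 (foot (suc c)) e
  ... | t , eq with suc c ℕₚ.≤? ent ν t
  ... | yes le = ⊥-elim (ℤₚ.<-irrefl eq (1+≤⇒< (≤-by (ℤₚ.+-mono-≤ (ℤ.+≤+ le) (ℤ.+≤+ (<colLen ν D-decreasing le)))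
          (ring (+ suc c) (+ colLen ν (suc c)) (+ ent ν t) (+ suc t)))))
    where
    ring : ∀ c l e t → e - t - (1ℤ + (c - l - 1ℤ)) ≡ e + l - (c + t)
    ring = solve-∀
  ... | no nle = ⊥-elim (ℤₚ.<-irrefl (sym eq) (1+≤⇒< (≤-by
          (ℤₚ.+-mono-≤ (ℤ.+≤+ (ℕ.s≤s⁻¹ (ℕₚ.≰⇒> nle))) (ℤ.+≤+ (ℕₚ.≮⇒≥ λ lt → nle (colLen< ν D-decreasing lt))))
          (ring (+ c) (+ colLen ν (suc c)) (+ ent ν t) (+ t)))))
    where
    ring : ∀ c l e t → (1ℤ + c) - l - 1ℤ - (1ℤ + (e - (1ℤ + t))) ≡ c + t - (e + l)
    ring = solve-∀

  foot-mono : ∀ {b c} → 0 ℕ.< b → b ℕ.< c → foot b ℤ.< foot c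
  foot-mono {suc b} {suc c} _ b<c = 1+≤⇒< (≤-by (ℤₚ.+-mono-≤ (ℤ.+≤+ b<c) (ℤ.+≤+ anti)) (ring (+ suc b) (+ suc c) (+ colLen ν (suc b)) (+ colLen ν (suc c))))
    where
    anti : colLen ν (suc c) ℕ.≤ colLen ν (suc b)
    anti = ≤-from-< λ t< → <colLen ν D-decreasing (ℕₚ.≤-trans (ℕₚ.<⇒≤ b<c) (colLen< ν D-decreasing t<))
    ring : ∀ b c l k → c - k - 1ℤ - (1ℤ + (b - l - 1ℤ)) ≡ c + l - (1ℤ + b + k)
    ring = solve-∀

  foot-injective : ∀ {b c} → 0 ℕ.< b → 0 ℕ.< c → foot b ≡ foot c → b ≡ c
  foot-injective {b} {c} 0<b 0<c eq with ℕₚ.<-cmp b c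
  ... | tri< b<c _ _ = ⊥-elim (ℤₚ.<-irrefl eq (foot-mono 0<b b<c))
  ... | tri≈ _ b≡c _ = b≡c
  ... | tri> _ _ c<b = ⊥-elim (ℤₚ.<-irrefl (sym eq) (foot-mono 0<c c<b))

  colLen-m : colLen ν (suc m) ≡ m
  colLen-m = ℕₚ.≤-antisym (≤-from-< inside) (≤-from-< λ {t} t<m → <colLen ν D-decreasing
      (subst (suc m ℕ.≤_) (sym (≡.trans (D-upper t<m) (ℕₚ.+-suc _ t))) (s≤s (slope≥m t<m))))
    where
    inside : ∀ {t} → t ℕ.< colLen ν (suc m) → t ℕ.< m
    inside {t} t< with t ℕₚ.<? m
    ... | yes p = p
    ... | no  p = ⊥-elim (ℕₚ.<-irrefl refl (ℕₚ.≤-trans (colLen< ν D-decreasing t<)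
            (ℕₚ.≤-trans (ℕₚ.≤-reflexive (D-lower (ℕₚ.≮⇒≥ p))) (legs≤m (suc t)))))

  -- Column m + 1 pairs every part with the gap 0, which is why its hooks have the parts as lengths.
  foot-m : foot (suc m) ≡ 0ℤ
  foot-m rewrite colLen-m = ring (+ m)
    where
    ring : ∀ m → 1ℤ + m - m - 1ℤ ≡ 0ℤ
    ring = solve-∀

  module _ {s : ℕ} (s<m : s ℕ.< m) where

    private
      a = ent μ s
      r = suc s

    arm : List ℕ
    arm = [ suc r ⋯ r ℕ.+ a ]

    arm-bounds : ∀ {c} → c ∈ arm → (suc r ℕ.≤ c) × (c ℕ.≤ r ℕ.+ a)
    arm-bounds = ∈-range⁻ {suc r} {r ℕ.+ a}

    row-length : ent ν s ≡ r ℕ.+ a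
    row-length = ≡.trans (D-upper s<m) (ℕₚ.+-comm a r)

    r≤colLen : ∀ {c} → c ∈ arm → r ℕ.≤ colLen ν c
    r≤colLen {zero}  c∈ with () ← proj₁ (arm-bounds c∈)
    r≤colLen {suc c} c∈ = <colLen ν D-decreasing
      (ℕₚ.≤-trans (proj₂ (arm-bounds c∈)) (ℕₚ.≤-reflexive (sym row-length)))

    foot< : ∀ {c} → c ∈ arm → foot c ℤ.< + a
    foot< {c} c∈ = 1+≤⇒< (≤-by (ℤₚ.+-mono-≤ (ℤ.+≤+ (proj₂ (arm-bounds c∈))) (ℤ.+≤+ (r≤colLen c∈)))
      (ring (+ c) (+ colLen ν c) (+ a) (+ r)))
      where
      ring : ∀ c l a r → a - (1ℤ + (c - l - 1ℤ)) ≡ (r + a) + l - (c + r)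
      ring = solve-∀

    -- If column c + 1 had length at least c + a, its row of index c + a - 1, lying below the first
    -- m rows, would contain leg c. That needs a_c + c ≥ a + c, whereas `slope` gives a_c + c ≤ a +
    -- s < a + c.
    foot> : ∀ {c} → c ∈ arm → - + a ℤ.< foot c
    foot> {zero}  c∈ with () ← proj₁ (arm-bounds c∈)
    foot> {suc c} c∈ = 1+≤⇒< (≤-by (ℤ.+≤+ short) (ring (+ c) (+ colLen ν (suc c)) (+ a)))
      where
      ring : ∀ c l a → (1ℤ + c) - l - 1ℤ - (1ℤ + - a) ≡ c + a - (1ℤ + l)
      ring = solve-∀
      s<c : s ℕ.< c
      s<c = ℕ.s≤s⁻¹ (proj₁ (arm-bounds c∈))
      short : colLen ν (suc c) ℕ.< c ℕ.+ a
      short = ℕₚ.≰⇒> absurd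
        where
        t = ℕ.pred (c ℕ.+ a)
        t≡ : suc t ≡ c ℕ.+ a
        t≡ = ℕₚ.suc-pred (c ℕ.+ a) {{ℕ.>-nonZero (ℕₚ.<-≤-trans (ℕₚ.≤-<-trans z≤n s<c) (ℕₚ.m≤m+n c a))}}
        m≤t : m ℕ.≤ t
        m≤t = ℕ.s≤s⁻¹ (ℕₚ.≤-trans (s≤s (slope≥m s<m)) (ℕₚ.≤-trans
          (ℕₚ.≤-reflexive (cong suc (ℕₚ.+-comm a s))) (ℕₚ.≤-trans (ℕₚ.+-monoˡ-≤ a s<c) (ℕₚ.≤-reflexive (sym t≡)))))
        absurd : ¬ c ℕ.+ a ℕ.≤ colLen ν (suc c)
        absurd le with legs⇒ {suc t} {c} (ℕₚ.≤-trans (colLen< ν D-decreasing (ℕₚ.≤-trans (ℕₚ.≤-reflexive t≡) le))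
                          (ℕₚ.≤-reflexive (D-lower m≤t)))
        ... | c<m , le′ = ℕₚ.<-irrefl refl (begin-strict
            c ℕ.+ a         ≡⟨ sym t≡ ⟩
            suc t           ≤⟨ le′ ⟩
            ent μ c ℕ.+ c   ≤⟨ slope (ℕₚ.<⇒≤ s<c) c<m ⟩
            a ℕ.+ s         <⟨ ℕₚ.+-monoʳ-< a s<c ⟩
            a ℕ.+ c         ≡⟨ ℕₚ.+-comm a c ⟩
            c ℕ.+ a         ∎)
          where open ℕₚ.≤-Reasoning

    -- A nonzero x and - x are never both gaps, so absolute values embed the gaps into 0, ..., a -
    -- 1.
    gaps-length : length (gaps μ a) ℕ.≤ a
    gaps-length with subset-↭ {ys = map ∣_∣ (gaps μ a)} {upTo a} (map-unique ∣_∣ inj (gaps-unique μ a)) sub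
      where
      inj : ∀ {x y} → x ∈ gaps μ a → y ∈ gaps μ a → ∣ x ∣ ≡ ∣ y ∣ → x ≡ y
      inj {x} {y} x∈ y∈ eq with proj₂ (∈-gaps⁻ {μ} {a} x∈) | proj₂ (∈-gaps⁻ {μ} {a} y∈)
      inj {+ m}      {+ .m}      x∈ y∈ refl | _ | _ = refl
      inj { -[1+ m ]} { -[1+ .m ]} x∈ y∈ refl | _ | _ = refl
      inj {+ .(suc n)} { -[1+ n ]} x∈ y∈ refl | e₁ | e₂ with () ← ≡.trans (sym e₁) (not-false e₂)
      inj { -[1+ n ]} {+ .(suc n)} x∈ y∈ refl | e₁ | e₂ with () ← ≡.trans (sym e₂) (not-false e₁)
      sub : ∀ {y} → y ∈ map ∣_∣ (gaps μ a) → y ∈ upTo a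
      sub y∈ with ∈-map⁻ ∣_∣ y∈
      ... | z , z∈ , refl = ∈-upTo⁺ (proj₁ (∈-gaps⁻ {μ} {a} z∈))
    ... | zs , p = begin
      length (gaps μ a)                        ≡⟨ sym (length-map ∣_∣ (gaps μ a)) ⟩
      length (map ∣_∣ (gaps μ a))              ≤⟨ ℕₚ.m≤m+n _ (length zs) ⟩
      length (map ∣_∣ (gaps μ a)) ℕ.+ length zs ≡⟨ sym (length-++ (map ∣_∣ (gaps μ a))) ⟩
      length (map ∣_∣ (gaps μ a) ++ zs)        ≡⟨ sym (↭ₚ.↭-length p) ⟩
      length (upTo a)                          ≡⟨ length-upTo a ⟩
      a                                        ∎
      where open ℕₚ.≤-Reasoning

    ∣foot∣< : ∀ {c} → c ∈ arm → ∣ foot c ∣ ℕ.< a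
    ∣foot∣< {c} c∈ = abs (foot c) (foot> c∈) (foot< c∈)
      where
      abs : ∀ y → - + a ℤ.< y → y ℤ.< + a → ∣ y ∣ ℕ.< a
      abs (+ n)    _ lt = ℤₚ.drop‿+<+ lt
      abs -[1+ n ] lt _ = ℤₚ.drop‿+<+ (ℤₚ.neg-cancel-< lt)

    length-arm : length arm ≡ a
    length-arm = ≡.trans (length-map (suc r ℕ.+_) (upTo (r ℕ.+ a ℕ.∸ r)))
      (≡.trans (length-upTo (r ℕ.+ a ℕ.∸ r)) (ℕₚ.m+n∸m≡n r a))

    -- The arm has a columns with distinct feet, all of them gaps, and there are at most a gaps:
    -- hence the feet exhaust them.
    feet-↭ : gaps μ a ↭ map foot arm
    feet-↭ = pigeonhole-↭
      (map-unique foot (λ b∈ c∈ → foot-injective (positive b∈) (positive c∈)) (range-unique (suc r) (r ℕ.+ a)))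
      sub (ℕₚ.≤-trans gaps-length (ℕₚ.≤-reflexive (sym (≡.trans (length-map foot arm) length-arm))))
      where
      positive : ∀ {c} → c ∈ arm → 0 ℕ.< c
      positive c∈ = ℕₚ.≤-trans (s≤s z≤n) (proj₁ (arm-bounds c∈))
      sub : ∀ {y} → y ∈ map foot arm → y ∈ gaps μ a
      sub y∈ with ∈-map⁻ foot y∈
      ... | c , c∈ , refl = ∈-gaps⁺ {μ} {a} {foot c} (∣foot∣< c∈) (foot-gap (positive c∈))

    m+1∈arm : suc m ∈ arm
    m+1∈arm = ∈-range⁺ {suc r} (s≤s s<m)
      (s≤s (ℕₚ.≤-trans (slope≥m s<m) (ℕₚ.≤-reflexive (ℕₚ.+-comm a s))))

    +hookLen : ∀ {c} → c ∈ arm → + hookLen ν r c ≡ + a - foot c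
    +hookLen {c} c∈ = ≡.trans (sym (ℤₚ.⊖-≥ fits)) (≡.trans
      (sym (ℤₚ.m-n≡m⊖n (entry ν r ℕ.+ colLen ν c ℕ.+ 1) (c ℕ.+ r)))
      (≡.trans (cong (λ e → + (e ℕ.+ colLen ν c ℕ.+ 1) - + (c ℕ.+ r)) row-length)
        (ring (+ r) (+ a) (+ colLen ν c) (+ c))))
      where
      ring : ∀ r a l c → r + a + l + 1ℤ - (c + r) ≡ a - (c - l - 1ℤ)
      ring = solve-∀
      fits : c ℕ.+ r ℕ.≤ entry ν r ℕ.+ colLen ν c ℕ.+ 1
      fits = ℕₚ.≤-trans (ℕₚ.+-mono-≤ (ℕₚ.≤-trans (proj₂ (arm-bounds c∈)) (ℕₚ.≤-reflexive (sym row-length)))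
        (r≤colLen c∈)) (ℕₚ.m≤m+n _ 1)

-- Sliding the runners

bool-⇔ : ∀ {b b′} → (b ≡ true ⇔ b′ ≡ true) → b ≡ b′
bool-⇔ {true}  {true}  _       = refl
bool-⇔ {false} {false} _       = refl
bool-⇔ {true}  {false} (f , _) with () ← f refl
bool-⇔ {false} {true}  (_ , g) with () ← g refl

map-≡ : ∀ {A B : Set} {f g : A → B} xs → map f xs ≡ map g xs → ∀ {x} → x ∈ xs → f x ≡ g x
map-≡ (x ∷ xs) eq (here refl) = proj₁ (∷-injective eq)
map-≡ (x ∷ xs) eq (there x∈)  = map-≡ xs (proj₂ (∷-injective eq)) x∈

S-neg : ∀ μ {x} → x ≢ 0ℤ → S μ (- x) ≡ not (S μ x)
S-neg μ {+ zero}   x≢0 = ⊥-elim (x≢0 refl)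
S-neg μ {+[1+ n ]} _   = refl
S-neg μ { -[1+ n ]} _  with memb (suc n) μ
... | true  = refl
... | false = refl

pos-nonneg : ∀ μ {x} → 0ℤ ℤ.≤ x → pos μ x ≡ ⟦ S μ x ⟧
pos-nonneg μ {+ n} _ = refl

pos-nonpos : ∀ μ {x} → memb 0 μ ≡ false → x ℤ.≤ 0ℤ → pos μ x ≡ 0ℤ
pos-nonpos μ {+ zero}    0∉ _ rewrite 0∉ = refl
pos-nonpos μ {+[1+ n ]}  0∉ (ℤ.+≤+ ())
pos-nonpos μ { -[1+ n ]} 0∉ _ = refl

⇔-at : ∀ {A : Set} (P : A → Set) {x y} → x ≡ y → P x ⇔ P y
⇔-at P eq = subst P eq , subst P (sym eq)

S⇔Maya : ∀ {μ} → Strict μ → All (0 ℕ.<_) μ → ∀ x → S μ x ≡ true ⇔ Maya (D μ) x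
S⇔Maya μ> μ>0 x = S⇒Maya-D μ> μ>0 x , Maya-D⇒S μ> μ>0

-- e i is the charge of runner i; φ slides every runner by its charge.
module Slide (d : ℕ) .{{_ : NonZero d}} (e : ℕ → ℤ) where

  open Beta d

  E : ℤ → ℤ
  E x = e (x %ℕ d) * + d

  φ ψ : ℤ → ℤ
  φ x = x + E x
  ψ u = u - E u

  block : ∀ x → x ≡ + (x %ℕ d) + (x /ℕ d) * + d
  block x = ℤ-DivMod.a≡a%ℕn+[a/ℕn]*n x d

  res< : ∀ x → x %ℕ d ℕ.< d
  res< x = ℤ-DivMod.n%ℕd<d x d

  -- A slide by a multiple of d stays on its runner, so the charge read after the slide is the one
  -- that was applied; hence φ and ψ are mutually inverse.
  E-periodic : ∀ u t → E (u + t * + d) ≡ E u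
  E-periodic u t = cong (λ i → e i * + d) (≡.trans (cong (_%ℕ d) eq) (%ℕ-block (u /ℕ d + t) (res< u)))
    where
    ring : ∀ i w t d → i + w * d + t * d ≡ i + (w + t) * d
    ring = solve-∀
    eq : u + t * + d ≡ + (u %ℕ d) + (u /ℕ d + t) * + d
    eq = ≡.trans (cong (λ v → v + t * + d) (block u)) (ring (+ (u %ℕ d)) (u /ℕ d) t (+ d))

  φψ : ∀ u → φ (ψ u) ≡ u
  φψ u = ≡.trans (cong (λ z → u - E u + z) (≡.trans (cong E (ring₁ u (e (u %ℕ d)) (+ d))) (E-periodic u (- e (u %ℕ d)))))
    (ring₂ u (E u))
    where
    ring₁ : ∀ u e d → u - e * d ≡ u + - e * d
    ring₁ = solve-∀
    ring₂ : ∀ u e → u - e + e ≡ u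
    ring₂ = solve-∀

  ψφ : ∀ x → ψ (φ x) ≡ x
  ψφ x = ≡.trans (cong (λ z → x + E x - z) (E-periodic x (e (x %ℕ d)))) (ring x (E x))
    where
    ring : ∀ u e → u + e - e ≡ u
    ring = solve-∀

  transport-φ : ∀ {P Q : ℤ → Set} → (∀ {i} z → i ℕ.< d → P (+ i + z * + d) ⇔ Q (+ i + (z + e i) * + d)) →
    ∀ x → P x ⇔ Q (φ x)
  transport-φ {P} {Q} iff x = ⇔-trans (⇔-at P (block x)) (⇔-trans (iff z (res< x)) (⇔-at Q eq))
    where
    i = x %ℕ d
    z = x /ℕ d
    ring : ∀ i z e d → i + (z + e) * d ≡ i + z * d + e * d
    ring = solve-∀
    eq : + i + (z + e i) * + d ≡ φ x
    eq = ≡.trans (ring (+ i) z (e i) (+ d)) (cong (λ y → y + e i * + d) (sym (block x)))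

  module Odd {c : List ℕ} (0∉c : memb 0 c ≡ false)
    (S-c-block : ∀ {i} z → i ℕ.< d → S c (+ i + z * + d) ≡ true ⇔ z ℤ.< e i) where

    -- ψ moves the threshold `e i` of each runner to 0, and then all runners share the single
    -- condition of being negative.
    S-c : ∀ x → S c x ≡ true ⇔ ψ x ℤ.< 0ℤ
    S-c x = ⇔-trans (⇔-at (λ y → S c y ≡ true) (block x)) (⇔-trans (S-c-block z i<d) (to , from))
      where
      i = x %ℕ d
      z = x /ℕ d
      i<d = res< x
      r₁ : ∀ x E → 0ℤ - (1ℤ + (x - E)) ≡ E - (1ℤ + x)
      r₁ = solve-∀
      to : z ℤ.< e i → ψ x ℤ.< 0ℤ
      to lt = 1+≤⇒< (≤-by (<⇒1+≤ (subst (ℤ._< E x) (sym (block x)) (block-< i<d lt))) (r₁ x (E x)))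
      from : ψ x ℤ.< 0ℤ → z ℤ.< e i
      from lt = ℤₚ.≰⇒> λ e≤z → ℤₚ.<⇒≱ lt (ℤₚ.i≤j⇒0≤j-i (subst (E x ℤ.≤_) (sym (block x)) (block-≥ {i} {z} e≤z)))

    -- The symmetry of the Maya diagram of D(c) forces the charges of opposite runners to cancel.
    e-0 : e 0 ≡ 0ℤ
    e-0 = ℤₚ.≤-antisym (ℤₚ.≮⇒≥ not-pos) (ℤₚ.≮⇒≥ not-neg)
      where
      0<d : 0 ℕ.< d
      0<d = ℕ.>-nonZero⁻¹ d
      zeroth : ∀ z → S c (z * + d) ≡ true ⇔ z ℤ.< e 0
      zeroth z = ⇔-trans (⇔-at (λ y → S c y ≡ true) (sym (ℤₚ.+-identityˡ (z * + d)))) (S-c-block z 0<d)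
      not-pos : ¬ 0ℤ ℤ.< e 0
      -- A positive charge would make 0 an element of the Maya diagram of c.
      not-pos lt with () ← ≡.trans (sym (proj₂ (zeroth 0ℤ) lt)) 0∉c
      not-neg : ¬ e 0 ℤ.< 0ℤ
      -- If e 0 < 0, the first gap on runner 0 is at position e 0, so by symmetry position - e 0 is
      -- occupied although it lies above the threshold.
      not-neg lt = ℤₚ.<-asym (ℤₚ.<-trans lt (ℤₚ.neg-mono-< lt)) (proj₁ (zeroth (- e 0)) opposite)
        where
        x≢0 : e 0 * + d ≢ 0ℤ
        x≢0 eq = ℤₚ.<-irrefl eq (subst (ℤ._< 0ℤ) (ℤₚ.+-identityˡ (e 0 * + d)) (block-< {v = 0ℤ} 0<d lt))
        off : S c (e 0 * + d) ≡ false
        off with S c (e 0 * + d) in eq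
        ... | false = refl
        ... | true  = ⊥-elim (ℤₚ.<-irrefl refl (proj₁ (zeroth (e 0)) eq))
        opposite : S c (- e 0 * + d) ≡ true
        opposite = ≡.trans (cong (S c) (sym (ℤₚ.neg-distribˡ-* (e 0) (+ d)))) (≡.trans (S-neg c x≢0) (cong not off))

    module _ {i : ℕ} (0<i : 0 ℕ.< i) (i<d : i ℕ.< d) where
      private
        j = d ℕ.∸ i
        j<d : j ℕ.< d
        j<d = ℕₚ.∸-monoʳ-< 0<i (ℕₚ.<⇒≤ i<d)
        +j : + j ≡ + d - + i
        +j = sym (≡.trans (ℤₚ.m-n≡m⊖n d i) (ℤₚ.⊖-≥ (ℕₚ.<⇒≤ i<d)))

      neg-block : ∀ z → - (+ i + z * + d) ≡ + j + (- z - 1ℤ) * + d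
      neg-block z = ≡.trans (ring (+ i) z (+ d)) (cong (λ k → k + (- z - 1ℤ) * + d) (sym +j))
        where
        ring : ∀ i z d → - (i + z * d) ≡ d - i + (- z - 1ℤ) * d
        ring = solve-∀

      -- Negation sends position z of runner i to position - z - 1 of runner d - i and exchanges
      -- beads with gaps. The last bead, z = e i - 1, gives one inequality and the first gap, z = e
      -- i, the other.
      e-opposite : e j ≡ - e i
      e-opposite = ℤₚ.≤-antisym upper lower
        where
        nonzero-block : ∀ z → + i + z * + d ≢ 0ℤ
        nonzero-block z eq with proj₁ (block-unique {i} {0} {z} {0ℤ} i<d (ℕₚ.<-trans 0<i i<d) (≡.trans eq refl))
        ... | refl = ℕₚ.<-irrefl refl 0<i
        symmetric : ∀ z → S c (+ j + (- z - 1ℤ) * + d) ≡ not (S c (+ i + z * + d))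
        symmetric z = ≡.trans (cong (S c) (sym (neg-block z))) (S-neg c (nonzero-block z))
        upper : e j ℤ.≤ - e i
        upper = ℤₚ.≮⇒≥ λ lt → absurd (proj₂ (S-c-block (- z - 1ℤ) j<d) (subst (ℤ._< e j) (r₁ (e i)) lt))
          where
          z = e i - 1ℤ
          r₁ : ∀ e → - e ≡ - (e - 1ℤ) - 1ℤ
          r₁ = solve-∀
          r₂ : ∀ e → e - (1ℤ + (e - 1ℤ)) ≡ e - e
          r₂ = solve-∀
          z<e : z ℤ.< e i
          z<e = 1+≤⇒< (≤-by (ℤₚ.≤-refl {e i}) (r₂ (e i)))
          absurd : S c (+ j + (- z - 1ℤ) * + d) ≡ true → ⊥
          absurd on with () ← ≡.trans (sym on) (≡.trans (symmetric z) (cong not (proj₂ (S-c-block z i<d) z<e)))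
        lower : - e i ℤ.≤ e j
        lower = ≤-by (<⇒1+≤ (proj₁ (S-c-block (- e i - 1ℤ) j<d) (≡.trans (symmetric (e i)) (cong not off)))) (r (e i) (e j))
          where
          r : ∀ x y → y - (- x) ≡ y - (1ℤ + (- x - 1ℤ))
          r = solve-∀
          off : S c (+ i + e i * + d) ≡ false
          off with S c (+ i + e i * + d) in eq
          ... | false = refl
          ... | true  = ⊥-elim (ℤₚ.<-irrefl refl (proj₁ (S-c-block (e i) i<d) eq))

      E-odd-block : ∀ z → E (- (+ i + z * + d)) ≡ - E (+ i + z * + d)
      E-odd-block z = begin
        E (- (+ i + z * + d))              ≡⟨ cong E (neg-block z) ⟩
        E (+ j + (- z - 1ℤ) * + d)         ≡⟨ cong (λ k → e k * + d) (%ℕ-block (- z - 1ℤ) j<d) ⟩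
        e j * + d                          ≡⟨ cong (λ k → k * + d) e-opposite ⟩
        - e i * + d                        ≡⟨ sym (ℤₚ.neg-distribˡ-* (e i) (+ d)) ⟩
        - (e i * + d)                      ≡⟨ cong (λ k → - (e k * + d)) (sym (%ℕ-block z i<d)) ⟩
        - E (+ i + z * + d)                ∎
        where open ≡-Reasoning

    E-odd : ∀ x → E (- x) ≡ - E x
    E-odd x with x %ℕ d in eq | res< x
    ... | suc i | i<d = subst (λ y → E (- y) ≡ - (e (suc i) * + d)) (sym x≡) (≡.trans (E-odd-block (s≤s z≤n) i<d (x /ℕ d))
            (cong (λ k → - (e k * + d)) (%ℕ-block (x /ℕ d) i<d)))
      where
      x≡ : x ≡ + suc i + (x /ℕ d) * + d
      x≡ = ≡.trans (block x) (cong (λ k → + k + (x /ℕ d) * + d) eq)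
    ... | zero | 0<d = ≡.trans (cong (λ k → e k * + d) (≡.trans (cong (_%ℕ d) -x≡) (%ℕ-block (- (x /ℕ d)) 0<d)))
            (≡.trans (cong (λ k → k * + d) e-0) (sym (cong (λ k → - (k * + d)) e-0)))
      where
      ring : ∀ z d → - (0ℤ + z * d) ≡ 0ℤ + - z * d
      ring = solve-∀
      -x≡ : - x ≡ + 0 + - (x /ℕ d) * + d
      -x≡ = ≡.trans (cong -_ (≡.trans (block x) (cong (λ k → + k + (x /ℕ d) * + d) eq))) (ring (x /ℕ d) (+ d))

    ψ-odd : ∀ u → ψ (- u) ≡ - ψ u
    ψ-odd u = ≡.trans (cong (λ z → - u - z) (E-odd u)) (ring u (E u))
      where
      ring : ∀ u e → - u - (- e) ≡ - (u - e)
      ring = solve-∀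

-- Charges of runners, and the meaning of an empty core and of equal quotients

level : (d : ℕ) .{{_ : NonZero d}} → List ℕ → ℕ
level d ν = (length (nonzero ν) ℕ.+ (d ℕ.∸ 1)) / d

-- Subtracting the common level changes none of the differences x_i - x_j in modified lengths, and
-- for D(λ) it makes the charges of opposite runners cancel, so that the slide is odd.
charge : (d : ℕ) .{{_ : NonZero d}} → List ℕ → ℕ → ℤ
charge d ν i = + beads d ν i - + level d ν

module _ (d : ℕ) .{{_ : NonZero d}} {ν : List ℕ} (dec : Decreasing ν) where
  open Beta d
  open Abacus {ν} dec

  -- The Maya diagram of the empty partition is the set of negative integers, so the threshold of
  -- every runner is 0.
  core≡[]⇒charge≡0 : core d ν ≡ [] → ∀ {i} → i ℕ.< d → charge d ν i ≡ 0ℤ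
  core≡[]⇒charge≡0 core≡[] {i} i<d = ℤₚ.≤-antisym (ℤₚ.≮⇒≥ (λ lt → ℤₚ.<-irrefl refl (proj₂ (iff 0ℤ) lt)))
                   (ℤₚ.≮⇒≥ (λ lt → ℤₚ.<-irrefl refl (proj₁ (iff _) lt)))
    where
    negative : ∀ z → z ℤ.< 0ℤ ⇔ Maya [] (+ i + z * + d)
    negative z = to , from
      where
      to : z ℤ.< 0ℤ → Maya [] (+ i + z * + d)
      to z<0 with + i + z * + d | block-< {v = 0ℤ} i<d z<0
      ... | -[1+ n ] | _ = n , refl
      ... | + n      | ℤ.+<+ ()
      from : Maya [] (+ i + z * + d) → z ℤ.< 0ℤ
      from (n , eq) = ℤₚ.≰⇒> λ 0≤z → ℤₚ.<-irrefl (sym eq) (ℤₚ.<-≤-trans (ℤ.-<+ {n} {0}) (block-≥ {i} {z} {0ℤ} 0≤z))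
    iff : ∀ z → z ℤ.< 0ℤ ⇔ z ℤ.< charge d ν i
    iff z = ⇔-trans (negative z)
      (subst (λ κ → Maya κ (+ i + z * + d) ⇔ (z ℤ.< charge d ν i)) core≡[] (core-Maya z i<d))

quotient≡⇒Maya : (d : ℕ) .{{_ : NonZero d}} → ∀ {ν κ} → Decreasing ν → Decreasing κ →
  quotient d ν ≡ quotient d κ → ∀ {i} z → i ℕ.< d →
  Maya ν (+ i + (z + charge d ν i) * + d) ⇔ Maya κ (+ i + (z + charge d κ i) * + d)
quotient≡⇒Maya d {ν} {κ} ν-dec κ-dec eq {i} z i<d = ⇔-trans (⇔-sym (Beta.Abacus.quotient-Maya d {ν} ν-dec z i<d))
  (⇔-trans (⇔-at (λ ρ → Maya ρ z) parts≡) (Beta.Abacus.quotient-Maya d {κ} κ-dec z i<d))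
  where
  parts≡ : quotientPart d ν i ≡ quotientPart d κ i
  parts≡ = map-≡ [ 0 ⋯ d ℕ.∸ 1 ] eq (∈-range⁺ {0} z≤n (ℕₚ.∸-monoˡ-≤ 1 i<d))

-- Equidistributed β-sets

neg : ℤ → ℤ
neg (+ _)    = 0ℤ
neg -[1+ _ ] = 1ℤ

∈β-indicator : ∀ b z bs → (b ≡ true ⇔ z ∈β bs) → ⟦ b ⟧ ≡ neg z + pos bs z
∈β-indicator b (+ w) bs (to , from) = ≡.trans
  (cong ⟦_⟧ (bool-⇔ {b} {memb w bs} ((λ p → ∈⇒memb (to p)) , (λ p → from (memb⇒∈ w bs p)))))
  (sym (ℤₚ.+-identityˡ _))
∈β-indicator b -[1+ w ] bs (to , from) = cong ⟦_⟧ (from _)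

module _ (d : ℕ) .{{_ : NonZero d}} (K : ℤ) where

  private
    k = K * + d

  -- Separates the infinite negative tail, whose contribution does not depend on `bs`, from the
  -- finite list of beads.
  β-sum : ∀ {bs} → Unique bs → (s : ℤ → Bool) → (∀ v → s v ≡ true ⇔ v + k ∈β bs) →
    ∀ {W} → Unique W → ∀ t → (∀ {x} → x ∈ bs → + x - k + t ∈ W) → ∀ (g : ℤ → ℤ) →
    ∑ W (λ u → g u * ⟦ s (u - t) ⟧) ≡ ∑ W (λ u → g u * neg (u - t + k)) + ∑ bs (λ x → g (+ x - k + t))
  β-sum {bs} uniq s iff {W} uniqW t inW g = begin
    ∑ W (λ u → g u * ⟦ s (u - t) ⟧)
      ≡⟨ ∑-cong W (λ {u} _ → ≡.trans (cong (_*_ (g u)) (∈β-indicator (s (u - t)) (u - t + k) bs (iff (u - t))))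
           (distrib (g u) (neg (u - t + k)) (pos bs (u - t + k)))) ⟩
    ∑ W (λ u → g u * neg (u - t + k) + pos bs (u - t + k) * g u)
      ≡⟨ ∑-+ W (λ u → g u * neg (u - t + k)) (λ u → pos bs (u - t + k) * g u) ⟩
    ∑ W (λ u → g u * neg (u - t + k)) + ∑ W (λ u → pos bs (u - t + k) * g u)
      ≡⟨ cong (_+_ (∑ W (λ u → g u * neg (u - t + k)))) (sym (≡.trans
           (reindex bs uniq uniqW (λ u → u - t + k) (λ x → x - k + t) (λ u → ring₁ u t k) (λ x → ring₂ x t k) inW
             (λ z → g (z - k + t)))
           (∑-cong W (λ {u} _ → cong (λ z → pos bs (u - t + k) * g z) (ring₁ u t k))))) ⟩
    ∑ W (λ u → g u * neg (u - t + k)) + ∑ bs (λ x → g (+ x - k + t)) ∎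
    where
    open ≡-Reasoning
    distrib : ∀ a b c → a * (b + c) ≡ a * b + c * a
    distrib = solve-∀
    ring₁ : ∀ u t k → u - t + k - k + t ≡ u
    ring₁ = solve-∀
    ring₂ : ∀ x t k → x - k + t - t + k ≡ x
    ring₂ = solve-∀

  periodic-sum : ∀ {xs ys} → map (_% d) xs ↭ map (_% d) ys → ∀ (g : ℤ → ℤ) → (∀ u w → g (u + w * + d) ≡ g u) →
    ∀ t → ∑ xs (λ x → g (+ x - k + t)) ≡ ∑ ys (λ x → g (+ x - k + t))
  periodic-sum {xs} {ys} p g per t = ≡.trans (residues xs) (≡.trans (∑-↭ _ p) (sym (residues ys)))
    where
    ring : ∀ r q d K t → r + q * d - K * d + t ≡ r + t + (q - K) * d
    ring = solve-∀
    residues : ∀ zs → ∑ zs (λ x → g (+ x - k + t)) ≡ ∑ (map (_% d) zs) (λ r → g (+ r + t))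
    residues zs = sym (≡.trans (∑-map (_% d) zs _) (∑-cong zs (λ {x} _ → sym (≡.trans
      (cong g (≡.trans (cong (λ y → y - k + t) (≡.trans (cong +_ (m≡m%n+[m/n]*n x d)) (Beta.+-* d (x % d) (x / d))))
        (ring (+ (x % d)) (+ (x / d)) (+ d) K t)))
      (per (+ (x % d) + t) (+ (x / d) - K))))))

  -- The tails cancel by `β-sum`, and a periodic weight sees beads only through their residues,
  -- which agree as multisets.
  balanced : ∀ {xs ys} → Unique xs → Unique ys → map (_% d) xs ↭ map (_% d) ys →
    (s s′ : ℤ → Bool) → (∀ v → s v ≡ true ⇔ v + k ∈β xs) → (∀ v → s′ v ≡ true ⇔ v + k ∈β ys) →
    ∀ {W} → Unique W → ∀ t → (∀ {x} → x ∈ xs → + x - k + t ∈ W) → (∀ {x} → x ∈ ys → + x - k + t ∈ W) →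
    ∀ (g : ℤ → ℤ) → (∀ u w → g (u + w * + d) ≡ g u) →
    ∑ W (λ u → g u * ⟦ s (u - t) ⟧) ≡ ∑ W (λ u → g u * ⟦ s′ (u - t) ⟧)
  balanced uxs uys p s s′ iff iff′ {W} uW t inx iny g per = ≡.trans (β-sum uxs s iff uW t inx g)
    (≡.trans (cong (_+_ (∑ W (λ u → g u * neg (u - t + k)))) (periodic-sum p g per t)) (sym (β-sum uys s′ iff′ uW t iny g)))

-- Comparing the hooks of λ, its core and its quotient

⟨<⟩-true : ∀ {x y} → x ℤ.< y → ⟨ x < y ⟩ ≡ 1ℤ
⟨<⟩-true {x} {y} lt with x ℤ.<? y
... | yes _ = refl
... | no ¬p = ⊥-elim (¬p lt)

⟨<⟩-false : ∀ {x y} → ¬ x ℤ.< y → ⟨ x < y ⟩ ≡ 0ℤ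
⟨<⟩-false {x} {y} nlt with x ℤ.<? y
... | yes p = ⊥-elim (nlt p)
... | no _  = refl

module Compare {μ c q : List ℕ} (ψ : ℤ → ℤ) (ψ-inj : ∀ {u v} → ψ u ≡ ψ v → u ≡ v)
  (S-ψ : ∀ u → S q (ψ u) ≡ S μ u) (S-c : ∀ u → S c u ≡ true ⇔ ψ u ℤ.< 0ℤ) where

  -- The implication handed to `table` says that `S c` is a half-line in the coordinate ψ. For a
  -- reversed pair, v in `S c` forces u in `S c`, and c has a hook exactly when they differ;
  -- otherwise the implication is the opposite one and c has no hook.
  hook-split : ∀ {u v} → v ℤ.< u →
    hook μ u v + ⟨ ψ u < ψ v ⟩ * (⟦ S c u ⟧ - ⟦ S c v ⟧) ≡
    hook q (ψ u) (ψ v) + hook c u v + ⟨ ψ u < ψ v ⟩ * (⟦ S μ u ⟧ - ⟦ S μ v ⟧)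
  hook-split {u} {v} v<u
    rewrite S-ψ u | S-ψ v | ⟨<⟩-true v<u | ⟨<⟩-false (ℤₚ.<-asym v<u) with ℤₚ.<-cmp (ψ u) (ψ v)
  ... | tri≈ _ eq _ = ⊥-elim (ℤₚ.<-irrefl (sym (ψ-inj eq)) v<u)
  ... | tri< lt _ _ rewrite ⟨<⟩-true lt | ⟨<⟩-false (ℤₚ.<-asym lt) =
    table (S μ u) (S μ v) (S c u) (S c v) (λ e → proj₂ (S-c u) (ℤₚ.<-trans lt (proj₁ (S-c v) e)))
    where
    table : ∀ s t s′ t′ → (t′ ≡ true → s′ ≡ true) →
      ⟦ s ⟧ * ⟦ not t ⟧ * 1ℤ + ⟦ t ⟧ * ⟦ not s ⟧ * 0ℤ + 1ℤ * (⟦ s′ ⟧ - ⟦ t′ ⟧) ≡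
      ⟦ s ⟧ * ⟦ not t ⟧ * 0ℤ + ⟦ t ⟧ * ⟦ not s ⟧ * 1ℤ + (⟦ s′ ⟧ * ⟦ not t′ ⟧ * 1ℤ + ⟦ t′ ⟧ * ⟦ not s′ ⟧ * 0ℤ)
        + 1ℤ * (⟦ s ⟧ - ⟦ t ⟧)
    table true  true  true  true  _ = refl
    table true  true  true  false _ = refl
    table true  true  false false _ = refl
    table true  false true  true  _ = refl
    table true  false true  false _ = refl
    table true  false false false _ = refl
    table false true  true  true  _ = refl
    table false true  true  false _ = refl
    table false true  false false _ = refl
    table false false true  true  _ = refl
    table false false true  false _ = refl
    table false false false false _ = refl
    table _     _     false true  f with () ← f refl
  ... | tri> _ _ gt rewrite ⟨<⟩-true gt | ⟨<⟩-false (ℤₚ.<-asym gt) =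
    table (S μ u) (S μ v) (S c u) (S c v) (λ e → proj₂ (S-c v) (ℤₚ.<-trans gt (proj₁ (S-c u) e)))
    where
    table : ∀ s t s′ t′ → (s′ ≡ true → t′ ≡ true) →
      ⟦ s ⟧ * ⟦ not t ⟧ * 1ℤ + ⟦ t ⟧ * ⟦ not s ⟧ * 0ℤ + 0ℤ * (⟦ s′ ⟧ - ⟦ t′ ⟧) ≡
      ⟦ s ⟧ * ⟦ not t ⟧ * 1ℤ + ⟦ t ⟧ * ⟦ not s ⟧ * 0ℤ + (⟦ s′ ⟧ * ⟦ not t′ ⟧ * 1ℤ + ⟦ t′ ⟧ * ⟦ not s′ ⟧ * 0ℤ)
        + 0ℤ * (⟦ s ⟧ - ⟦ t ⟧)
    table true  true  true  true  _ = refl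
    table true  true  false true  _ = refl
    table true  true  false false _ = refl
    table true  false true  true  _ = refl
    table true  false false true  _ = refl
    table true  false false false _ = refl
    table false true  true  true  _ = refl
    table false true  false true  _ = refl
    table false true  false false _ = refl
    table false false true  true  _ = refl
    table false false false true  _ = refl
    table false false false false _ = refl
    table _     _     true  false f with () ← f refl

  module _ (h : ℕ) (W : List ℤ)
    (balance : ∀ t → t ≡ 0ℤ ⊎ t ≡ + suc h →
      ∑ W (λ u → ⟨ ψ u < ψ (u - + suc h) ⟩ * ⟦ S μ (u - t) ⟧) ≡
      ∑ W (λ u → ⟨ ψ u < ψ (u - + suc h) ⟩ * ⟦ S c (u - t) ⟧)) where

    private
      g : ℤ → ℤ
      g u = ⟨ ψ u < ψ (u - + suc h) ⟩
      v : ℤ → ℤ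
      v u = u - + suc h

      diff : (κ : List ℕ) → ∑ W (λ u → g u * (⟦ S κ u ⟧ - ⟦ S κ (v u) ⟧)) ≡
        ∑ W (λ u → g u * ⟦ S κ (u - 0ℤ) ⟧) - ∑ W (λ u → g u * ⟦ S κ (v u) ⟧)
      diff κ = ≡.trans (∑-cong W (λ {u} _ → ≡.trans (distrib (g u) ⟦ S κ u ⟧ ⟦ S κ (v u) ⟧)
          (cong (λ w → g u * ⟦ S κ w ⟧ - g u * ⟦ S κ (v u) ⟧) (sym (ℤₚ.+-identityʳ u)))))
        (∑-- W (λ u → g u * ⟦ S κ (u - 0ℤ) ⟧) (λ u → g u * ⟦ S κ (v u) ⟧))
        where
        distrib : ∀ a b c → a * (b - c) ≡ a * b - a * c
        distrib = solve-∀

    -- The discrepancy on reversed pairs is a difference of two sums, linear in membership of u and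
    -- of u - h; `balance` equates each for λ and c, at t = 0 and t = h.
    hookSum-split : ∑ W (λ u → hook μ u (v u)) ≡
      ∑ W (λ u → hook q (ψ u) (ψ (v u))) + ∑ W (λ u → hook c u (v u))
    hookSum-split = ≡-by sums (ring Hμ Hq Hc G)
      where
      open ≡-Reasoning
      Hμ = ∑ W (λ u → hook μ u (v u))
      Hq = ∑ W (λ u → hook q (ψ u) (ψ (v u)))
      Hc = ∑ W (λ u → hook c u (v u))
      G = ∑ W (λ u → g u * (⟦ S c u ⟧ - ⟦ S c (v u) ⟧))
      G′ = ∑ W (λ u → g u * (⟦ S μ u ⟧ - ⟦ S μ (v u) ⟧))
      G≡ : G ≡ G′
      G≡ = ≡.trans (diff c) (≡.trans (sym (cong₂ _-_ (balance 0ℤ (inj₁ refl)) (balance (+ suc h) (inj₂ refl)))) (sym (diff μ)))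
      ring : ∀ a b c g → b + c - a ≡ b + c + g - (a + g)
      ring = solve-∀
      below : ∀ u → v u ℤ.< u
      below u = 1+≤⇒< (≤-by (ℤ.+≤+ (z≤n {h})) (r u (+ h)))
        where
        r : ∀ u h → u - (1ℤ + (u - (1ℤ + h))) ≡ h - 0ℤ
        r = solve-∀
      sums : Hμ + G ≡ Hq + Hc + G
      sums = begin
        Hμ + G
          ≡⟨ sym (∑-+ W (λ u → hook μ u (v u)) (λ u → g u * (⟦ S c u ⟧ - ⟦ S c (v u) ⟧))) ⟩
        ∑ W (λ u → hook μ u (v u) + g u * (⟦ S c u ⟧ - ⟦ S c (v u) ⟧))
          ≡⟨ ∑-cong W (λ {u} _ → hook-split (below u)) ⟩
        ∑ W (λ u → hook q (ψ u) (ψ (v u)) + hook c u (v u) + g u * (⟦ S μ u ⟧ - ⟦ S μ (v u) ⟧))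
          ≡⟨ ∑-+ W (λ u → hook q (ψ u) (ψ (v u)) + hook c u (v u)) (λ u → g u * (⟦ S μ u ⟧ - ⟦ S μ (v u) ⟧)) ⟩
        ∑ W (λ u → hook q (ψ u) (ψ (v u)) + hook c u (v u)) + G′
          ≡⟨ cong₂ _+_ (∑-+ W (λ u → hook q (ψ u) (ψ (v u))) (λ u → hook c u (v u))) (sym G≡) ⟩
        Hq + Hc + G ∎

-- Modified hook lengths

map-entry : ∀ μ → map (entry μ) [ 1 ⋯ length μ ] ≡ μ
map-entry μ = ≡.trans (map-range (entry μ) 1 (length μ)) (go μ)
  where
  go : ∀ μ → applyUpTo (ent μ) (length μ) ≡ μ
  go []      = refl
  go (a ∷ μ) = cong (a ∷_) (go μ)

module ModifiedHooks (d : ℕ) .{{_ : NonZero d}} (λ′ : List ℕ) {q : List ℕ}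
  (q> : Strict q) (q>0 : All (0 ℕ.<_) q) where

  open Slide d (charge d (D λ′))
  open Columns q> q>0

  private
    m = length q

    in-rows : ∀ {r} → r ∈ [ 1 ⋯ m ] → ∃ λ s → (r ≡ suc s) × (s ℕ.< m)
    in-rows {zero}  r∈ with () ← proj₁ (∈-range⁻ {1} {m} r∈)
    in-rows {suc s} r∈ = s , refl , proj₂ (∈-range⁻ {1} {m} r∈)

  -- The runners i and j are the residues of the part and of the foot, so (x_i - x_j) d distributes
  -- over both ends of the hook and the level cancels.
  modHook-φ : ∀ {s} (s<m : s ℕ.< m) {c} → c ∈ arm s<m →
    modHook d λ′ q (suc s , c) ≡ ∣ φ (+ ent q s) - φ (foot c) ∣
  modHook-φ {s} s<m {c} c∈ = cong ∣_∣ (≡.trans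
    (cong₂ (λ h i → h + (+ beads d (D λ′) i - + beads d (D λ′) (foot c %ℕ d)) * + d) (+hookLen s<m c∈)
      (cong (_%ℕ d) (≡.trans (cong (λ n → + n - + suc s) (row-length s<m)) (ring₁ (+ ent q s) (+ suc s)))))
    (ring₂ (+ ent q s) (foot c) (+ beads d (D λ′) (+ ent q s %ℕ d)) (+ beads d (D λ′) (foot c %ℕ d)) (+ level d (D λ′)) (+ d)))
    where
    ring₁ : ∀ a r → r + a - r ≡ a
    ring₁ = solve-∀
    ring₂ : ∀ a f x y k d → a - f + (x - y) * d ≡ a + (x - k) * d - (f + (y - k) * d)
    ring₂ = solve-∀

  mult-barsBar : ∀ h → + mult h (barsBar d λ′ q) ≡ barSum q φ h
  mult-barsBar h = begin
    + mult h (barsBar d λ′ q)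
      ≡⟨ mult-∑ h (barsBar d λ′ q) ⟩
    ∑ (barsBar d λ′ q) (λ x → δ (+ h) (+ x))
      ≡⟨ ∑-map (modHook d λ′ q) (PNodes d q ++ BNodes d q) _ ⟩
    ∑ (PNodes d q ++ BNodes d q) F
      ≡⟨ ∑-++ (PNodes d q) (BNodes d q) F ⟩
    ∑ (PNodes d q) F + ∑ (BNodes d q) F
      ≡⟨ cong₂ _+_ (∑-map _ [ 1 ⋯ m ] F) (≡.trans (∑-concatMap _ [ 1 ⋯ m ] F)
           (∑-cong [ 1 ⋯ m ] (λ {r} _ → ∑-map _ (others r) F))) ⟩
    ∑ [ 1 ⋯ m ] (λ r → F (r , suc m)) + ∑ [ 1 ⋯ m ] (λ r → ∑ (others r) (λ c → F (r , c)))
      ≡⟨ sym (∑-+ [ 1 ⋯ m ] (λ r → F (r , suc m)) (λ r → ∑ (others r) (λ c → F (r , c)))) ⟩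
    -- Returning column m + 1 to the columns of B completes the arm of each row, whose feet are all
    -- the gaps of that part.
    ∑ [ 1 ⋯ m ] (λ r → ∑ (suc m ∷ others r) (λ c → F (r , c)))
      ≡⟨ ∑-cong [ 1 ⋯ m ] per-row ⟩
    ∑ [ 1 ⋯ m ] (λ r → H (entry q r))
      ≡⟨ sym (∑-map (entry q) [ 1 ⋯ m ] H) ⟩
    ∑ (map (entry q) [ 1 ⋯ m ]) H
      ≡⟨ cong (λ xs → ∑ xs H) (map-entry q) ⟩
    barSum q φ h ∎
    where
    open ≡-Reasoning
    F : ℕ × ℕ → ℤ
    F z = δ (+ h) (+ modHook d λ′ q z)
    H : ℕ → ℤ
    H a = ∑ (gaps q a) (λ y → δ (+ h) (+ ∣ φ (+ a) - φ y ∣))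
    others : ℕ → List ℕ
    others r = filterᵇ (λ c → not (c ≡ᵇ suc m)) [ suc r ⋯ r ℕ.+ entry q r ]
    per-row : ∀ {r} → r ∈ [ 1 ⋯ m ] → ∑ (suc m ∷ others r) (λ c → F (r , c)) ≡ H (entry q r)
    per-row r∈ with in-rows r∈
    ... | s , refl , s<m = begin
      ∑ (suc m ∷ others (suc s)) (λ c → F (suc s , c))
        ≡⟨ ∑-↭ _ (unique-↭ unique (range-unique (suc (suc s)) (suc s ℕ.+ ent q s)) to from) ⟩
      ∑ (arm s<m) (λ c → F (suc s , c))
        ≡⟨ ∑-cong (arm s<m) (λ c∈ → cong (λ x → δ (+ h) (+ x)) (modHook-φ s<m c∈)) ⟩
      ∑ (arm s<m) (λ c → δ (+ h) (+ ∣ φ (+ ent q s) - φ (foot c) ∣))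
        ≡⟨ sym (∑-map foot (arm s<m) (λ y → δ (+ h) (+ ∣ φ (+ ent q s) - φ y ∣))) ⟩
      ∑ (map foot (arm s<m)) (λ y → δ (+ h) (+ ∣ φ (+ ent q s) - φ y ∣))
        ≡⟨ ∑-↭ _ (↭-sym (feet-↭ s<m)) ⟩
      H (ent q s) ∎
      where
      p : ℕ → Bool
      p c = not (c ≡ᵇ suc m)
      ≢-p : ∀ c → p c ≡ true → c ≢ suc m
      ≢-p c eq refl with () ← ≡.trans (sym eq) (cong not (≡ᵇ-refl (suc m)))
      unique : Unique (suc m ∷ others (suc s))
      unique = All.tabulate (λ {c} c∈ eq → ≢-p c (T-≡ (proj₂ (∈-filter⁻ (T? ∘ p) {xs = arm s<m} c∈))) (sym eq))
        ∷ Uniqueₚ.filter⁺ (T? ∘ p) (range-unique (suc (suc s)) (suc s ℕ.+ ent q s))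
      to : ∀ {c} → c ∈ suc m ∷ others (suc s) → c ∈ arm s<m
      to (here refl) = m+1∈arm s<m
      to (there c∈)  = proj₁ (∈-filter⁻ (T? ∘ p) {xs = arm s<m} c∈)
      from : ∀ {c} → c ∈ arm s<m → c ∈ suc m ∷ others (suc s)
      from {c} c∈ with c ≡ᵇ suc m in e
      ... | true  = here (≡ᵇ⇒≡ c e)
      ... | false = there (∈-filter⁺ (T? ∘ p) c∈ (≡-T (cong not e)))

  partsBar-φ : φ 0ℤ ≡ 0ℤ → partsBar d λ′ q ≡ map (λ a → ∣ φ (+ a) ∣) q
  partsBar-φ φ0 = begin
    map (modHook d λ′ q) (map (λ r → r , suc m) [ 1 ⋯ m ])
      ≡⟨ sym (map-∘ [ 1 ⋯ m ]) ⟩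
    map (λ r → modHook d λ′ q (r , suc m)) [ 1 ⋯ m ]
      ≡⟨ map-cong-local (All.tabulate per-row) ⟩
    map (λ r → ∣ φ (+ entry q r) ∣) [ 1 ⋯ m ]
      ≡⟨ map-∘ [ 1 ⋯ m ] ⟩
    map (λ a → ∣ φ (+ a) ∣) (map (entry q) [ 1 ⋯ m ])
      ≡⟨ cong (map (λ a → ∣ φ (+ a) ∣)) (map-entry q) ⟩
    map (λ a → ∣ φ (+ a) ∣) q ∎
    where
    open ≡-Reasoning
    per-row : ∀ {r} → r ∈ [ 1 ⋯ m ] → modHook d λ′ q (r , suc m) ≡ ∣ φ (+ entry q r) ∣
    per-row r∈ with in-rows r∈
    ... | s , refl , s<m = ≡.trans (modHook-φ s<m (m+1∈arm s<m)) (cong ∣_∣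
            (≡.trans (cong (λ y → φ (+ ent q s) - y) (≡.trans (cong φ foot-m) φ0)) (ℤₚ.+-identityʳ (φ (+ ent q s)))))

-- Multiplicities of bar lengths

bounded : ∀ (zs : List ℤ) → ∃ λ M → ∀ {z} → z ∈ zs → ∣ z ∣ ℕ.≤ M
bounded []       = 0 , λ ()
bounded (z ∷ zs) with bounded zs
... | M , bound = ∣ z ∣ ℕ.+ M , λ where
  (here refl) → ℕₚ.m≤m+n ∣ z ∣ M
  (there z∈)  → ℕₚ.≤-trans (bound z∈) (ℕₚ.m≤n+m M ∣ z ∣)

-- A part belongs to S and a gap does not, so they differ, and φ is injective.
barSum-0 : ∀ {μ} φ (ψ : ℤ → ℤ) → (∀ x → ψ (φ x) ≡ x) → barSum μ φ 0 ≡ 0ℤ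
barSum-0 {μ} φ ψ ψφ = ≡.trans (∑-cong μ (λ {a} a∈ → ≡.trans (∑-cong (gaps μ a) (λ {y} y∈ →
    δ-≢ {0ℤ} {+ ∣ φ (+ a) - φ y ∣} (λ eq → distinct a∈ y∈ (ℤₚ.∣i∣≡0⇒i≡0 (sym (ℤₚ.+-injective eq))))))
    (∑-0 (gaps μ a)))) (∑-0 μ)
  where
  distinct : ∀ {a y} → a ∈ μ → y ∈ gaps μ a → φ (+ a) - φ y ≢ 0ℤ
  distinct {a} {y} a∈ y∈ eq with ≡.trans (sym (ψφ (+ a))) (≡.trans (cong ψ (ℤₚ.i-j≡0⇒i≡j _ _ eq)) (ψφ y))
  ... | refl with () ← ≡.trans (sym (∈⇒memb a∈)) (proj₂ (∈-gaps⁻ {μ} {a} y∈))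

mult-pos : ∀ {μ} → Unique μ → ∀ h → + mult h μ ≡ pos μ (+ h)
mult-pos {μ} uniq h = ≡.trans (mult-∑ h μ) (≡.trans (∑-cong μ (λ {a} _ → δ-sym (+ h) (+ a))) (∑-δ-pos μ (+ h) uniq))

-- For one fixed length, i, a and b are its multiplicities in the intersection, the rest of c and
-- the rest of P̄, and l is that in λ. The alternatives say that l counts membership in exactly one
-- of c and P̄.
symmetric-difference : ∀ i a b l → a ≡ 0 ⊎ b ≡ 0 →
  (i ℕ.+ a ≡ 1 × i ℕ.+ b ℕ.+ l ≡ 1) ⊎ (i ℕ.+ a ≡ 0 × i ℕ.+ b ≡ l) →
  l ℕ.+ (i ℕ.+ i) ≡ i ℕ.+ a ℕ.+ (i ℕ.+ b)
symmetric-difference zero       zero       b    l  _           (inj₂ (_ , refl)) = ℕₚ.+-identityʳ b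
symmetric-difference (suc zero) zero       zero zero _         (inj₁ _)          = refl
symmetric-difference zero       (suc zero) zero l  _           (inj₁ (_ , refl)) = refl
symmetric-difference zero       (suc (suc a)) zero l _         (inj₁ (() , _))
symmetric-difference zero       (suc (suc a)) zero l _         (inj₂ (() , _))
symmetric-difference zero       (suc a)    (suc b) l (inj₁ ())
symmetric-difference zero       (suc a)    (suc b) l (inj₂ ())

-- Hook sums of λ, its core and its quotient over a common window

module HookSums (d : ℕ) .{{_ : NonZero d}} {μ c q : List ℕ}
  (μ> : Strict μ) (μ>0 : All (0 ℕ.<_) μ)
  (c> : Strict c) (c>0 : All (0 ℕ.<_) c)
  (q> : Strict q) (q>0 : All (0 ℕ.<_) q)
  (core-μ : D c ≡ core d (D μ)) (core-q : core d (D q) ≡ [])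
  (quotients : quotient d (D q) ≡ quotient d (D μ)) where

  open Slide d (charge d (D μ))

  private
    module A = Beta.Abacus d {D μ} (Doubled.D-decreasing μ> μ>0)

    0∉c : memb 0 c ≡ false
    0∉c = Doubled.0∉μ c> c>0
    0∉q : memb 0 q ≡ false
    0∉q = Doubled.0∉μ q> q>0

  open Odd {c} 0∉c (λ {i} z i<d → ⇔-trans (S⇔Maya c> c>0 (+ i + z * + d))
    (⇔-trans (⇔-at (λ ν → Maya ν (+ i + z * + d)) core-μ) (A.core-Maya z i<d)))

  -- Equal quotients match the runners of D(q) and D(λ) up to their charges, and those of D(q)
  -- vanish because its core is empty; what remains is the slide by the charges of D(λ).
  S-φ : ∀ x → S q x ≡ S μ (φ x)
  S-φ x = bool-⇔ (⇔-trans (S⇔Maya q> q>0 x) (⇔-trans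
    (transport-φ {Maya (D q)} {Maya (D μ)} (λ {i} z i<d → ⇔-trans
      (⇔-at (λ w → Maya (D q) (+ i + w * + d)) (sym (≡.trans (cong (_+_ z)
        (core≡[]⇒charge≡0 d {D q} (Doubled.D-decreasing q> q>0) core-q i<d)) (ℤₚ.+-identityʳ z))))
      (quotient≡⇒Maya d {D q} {D μ} (Doubled.D-decreasing q> q>0) (Doubled.D-decreasing μ> μ>0) quotients z i<d)) x)
    (⇔-sym (S⇔Maya μ> μ>0 (φ x)))))

  S-ψ : ∀ u → S q (ψ u) ≡ S μ u
  S-ψ u = ≡.trans (S-φ (ψ u)) (cong (S μ) (φψ u))

  ψ-inj : ∀ {u v} → ψ u ≡ ψ v → u ≡ v
  ψ-inj {u} {v} eq = ≡.trans (sym (φψ u)) (≡.trans (cong φ eq) (φψ v))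

  φ0 : φ 0ℤ ≡ 0ℤ
  φ0 = ψ-inj (≡.trans (ψφ 0ℤ) (sym (self-neg (ψ 0ℤ) (ψ-odd 0ℤ))))
    where
    self-neg : ∀ x → x ≡ - x → x ≡ 0ℤ
    self-neg (+ zero) _ = refl

  k = + level d (D μ) * + d

  S-X : ∀ v → S μ v ≡ true ⇔ v + k ∈β A.X
  S-X v = ⇔-trans (S⇔Maya μ> μ>0 v) (⇔-trans (A.Maya-X v) (⇔-at (λ z → v + z ∈β A.X) A.+k))

  S-C : ∀ v → S c v ≡ true ⇔ v + k ∈β A.C
  S-C v = ⇔-trans (S⇔Maya c> c>0 v) (⇔-trans (⇔-at (λ ν → Maya ν v) core-μ)
    (⇔-trans (A.Maya-C v) (⇔-at (λ z → v + z ∈β A.C) A.+k)))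

  ψ-periodic : ∀ u w → ψ (u + w * + d) ≡ ψ u + w * + d
  ψ-periodic u w = ≡.trans (cong (λ z → u + w * + d - z) (E-periodic u w)) (ring u (w * + d) (E u))
    where
    ring : ∀ u w e → u + w - e ≡ u - e + w
    ring = solve-∀

  -- ψ commutes with translations by multiples of d, so whether it reverses the pair depends only on
  -- the residue of u; this is the periodicity asked for by `balanced`.
  ⟨<⟩-periodic : ∀ t u w → ⟨ ψ (u + w * + d) < ψ (u + w * + d - t) ⟩ ≡ ⟨ ψ u < ψ (u - t) ⟩
  ⟨<⟩-periodic t u w = ≡.trans (cong₂ ⟨_<_⟩ (ψ-periodic u w)
      (≡.trans (cong ψ (ring u (w * + d) t)) (ψ-periodic (u - t) w)))
    (shift (ψ u) (ψ (u - t)) (w * + d))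
    where
    ring : ∀ u w t → u + w - t ≡ u - t + w
    ring = solve-∀
    r₁ : ∀ x y w → y - (1ℤ + x) ≡ y + w - (1ℤ + (x + w))
    r₁ = solve-∀
    shift : ∀ x y w → ⟨ x + w < y + w ⟩ ≡ ⟨ x < y ⟩
    shift x y w with x ℤ.<? y
    ... | yes lt = ⟨<⟩-true {x + w} {y + w} (ℤₚ.+-monoˡ-< w lt)
    ... | no nlt = ⟨<⟩-false {x + w} {y + w} (λ lt → nlt (1+≤⇒< (≤-by (<⇒1+≤ lt) (r₁ x y w))))

  private
    -- One bound M must serve everything: slid parts of q and parts of λ and c for the three folds,
    -- and the beads of both β-sets for the balance.
    points : List ℤ
    points = map (φ ∘ +_) q ++ map +_ μ ++ map +_ c ++ map (λ x → + x - k) A.X ++ map (λ x → + x - k) A.C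
    M = proj₁ (bounded points)
    bound = proj₂ (bounded points)
    q-bound : ∀ {a} → a ∈ q → ∣ φ (+ a) ∣ ℕ.≤ M
    q-bound a∈ = bound (∈-++⁺ˡ (∈-map⁺ (φ ∘ +_) a∈))
    μ-bound : ∀ {a} → a ∈ μ → a ℕ.≤ M
    μ-bound a∈ = bound (∈-++⁺ʳ (map (φ ∘ +_) q) (∈-++⁺ˡ (∈-map⁺ +_ a∈)))
    c-bound : ∀ {a} → a ∈ c → a ℕ.≤ M
    c-bound a∈ = bound (∈-++⁺ʳ (map (φ ∘ +_) q) (∈-++⁺ʳ (map +_ μ) (∈-++⁺ˡ (∈-map⁺ +_ a∈))))
    X-bound : ∀ {x} → x ∈ A.X → ∣ + x - k ∣ ℕ.≤ M
    X-bound x∈ = bound (∈-++⁺ʳ (map (φ ∘ +_) q) (∈-++⁺ʳ (map +_ μ) (∈-++⁺ʳ (map +_ c)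
      (∈-++⁺ˡ (∈-map⁺ (λ x → + x - k) x∈)))))
    C-bound : ∀ {x} → x ∈ A.C → ∣ + x - k ∣ ℕ.≤ M
    C-bound x∈ = bound (∈-++⁺ʳ (map (φ ∘ +_) q) (∈-++⁺ʳ (map +_ μ) (∈-++⁺ʳ (map +_ c)
      (∈-++⁺ʳ (map (λ x → + x - k) A.X) (∈-map⁺ (λ x → + x - k) x∈)))))

    module Fμ = Fold μ (strict⇒unique μ>) (Doubled.0∉μ μ> μ>0) (λ x → x) (λ x → x) (λ _ → refl) (λ _ → refl) (λ _ → refl) M μ-bound
    module Fc = Fold c (strict⇒unique c>) 0∉c (λ x → x) (λ x → x) (λ _ → refl) (λ _ → refl) (λ _ → refl) M c-bound
    module Fq = Fold q (strict⇒unique q>) 0∉q φ ψ φψ ψφ ψ-odd M q-bound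

  module AtLength (h₀ : ℕ) where
    h = suc h₀
    W = window (- + M) (suc (M ℕ.+ M ℕ.+ h))

    Tμ Tc Tq : ℤ
    Tμ = ∑ W (λ u → hook μ u (u - + h))
    Tc = ∑ W (λ u → hook c u (u - + h))
    Tq = ∑ W (λ u → hook q (ψ u) (ψ (u - + h)))

    private
      uniqW : Unique W
      uniqW = window-unique (- + M) (suc (M ℕ.+ M ℕ.+ h))

      in-W : ∀ {u} → - + M ℤ.≤ u → u ℤ.≤ + M + + h → u ∈ W
      in-W {u} lo hi = ∈-window⁺ lo (1+≤⇒< (≤-by hi (ring (+ M) (+ h) u)))
        where
        ring : ∀ m h u → - m + (1ℤ + (m + m + h)) - (1ℤ + u) ≡ m + h - u
        ring = solve-∀

      shifted-in-W : ∀ {z t} → ∣ z ∣ ℕ.≤ M → t ≡ 0ℤ ⊎ t ≡ + h → z + t ∈ W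
      shifted-in-W {z} le (inj₁ refl) = subst (_∈ W) (sym (ℤₚ.+-identityʳ z))
        (in-W (∣∣≤⇒≥ le) (ℤₚ.≤-trans (∣∣≤⇒≤ le) (ℤₚ.i≤i+j (+ M) (+ h))))
      shifted-in-W {z} le (inj₂ refl) = in-W (ℤₚ.≤-trans (∣∣≤⇒≥ le) (ℤₚ.i≤i+j z (+ h)))
        (ℤₚ.+-monoˡ-≤ (+ h) (∣∣≤⇒≤ {z} le))

    hooks : Tμ ≡ Tq + Tc
    hooks = Compare.hookSum-split {μ} {c} {q} ψ ψ-inj S-ψ S-c h₀ W (λ t t≡ →
      balanced d (+ level d (D μ)) (strict⇒unique A.X-strict) (strict⇒unique A.C-strict) A.residues-↭
        (S μ) (S c) S-X S-C uniqW t (λ {x} x∈ → shifted-in-W {+ x - k} (X-bound x∈) t≡) (λ {x} x∈ → shifted-in-W {+ x - k} (C-bound x∈) t≡)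
        (λ u → ⟨ ψ u < ψ (u - + h) ⟩) (⟨<⟩-periodic (+ h)))

    fold-μ : barSum μ (λ x → x) h + barSum μ (λ x → x) h + ∑ μ (λ a → δ (+ h) (+ (2 ℕ.* a))) ≡ Tμ + partSum μ (λ x → x) h
    fold-μ = Fμ.fold h₀ W uniqW in-W (∑-reflect M h)

    fold-c : barSum c (λ x → x) h + barSum c (λ x → x) h + ∑ c (λ a → δ (+ h) (+ (2 ℕ.* a))) ≡ Tc + partSum c (λ x → x) h
    fold-c = Fc.fold h₀ W uniqW in-W (∑-reflect M h)

    fold-q : barSum q φ h + barSum q φ h + ∑ q (λ a → δ (+ h) (+ (2 ℕ.* ∣ φ (+ a) ∣))) ≡ Tq + partSum q φ h
    fold-q = Fq.fold h₀ W uniqW in-W (∑-reflect M h)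

    -- As ψ (- h) = - ψ h, only the nonnegative one of the two positions can be a part of q. It is ψ
    -- (- h) if h lies in c, where membership means that h is missing from λ, and ψ h otherwise.
    partSum-q : (memb h c ≡ true × partSum q φ h ≡ ⟦ not (memb h μ) ⟧) ⊎
                (memb h c ≡ false × partSum q φ h ≡ ⟦ memb h μ ⟧)
    partSum-q with memb h c in e
    ... | true = inj₁ (refl , (begin
        partSum q φ h                          ≡⟨ Fq.partSum-pos h₀ ⟩
        pos q (ψ (+ h)) + pos q (ψ (- + h))    ≡⟨ cong₂ _+_ (pos-nonpos q 0∉q (ℤₚ.<⇒≤ ψ<0)) (pos-nonneg q ψ>0) ⟩
        0ℤ + ⟦ S q (ψ (- + h)) ⟧               ≡⟨ ℤₚ.+-identityˡ _ ⟩
        ⟦ S q (ψ (- + h)) ⟧                    ≡⟨ cong ⟦_⟧ (S-ψ (- + h)) ⟩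
        ⟦ not (memb h μ) ⟧                     ∎))
      where
      open ≡-Reasoning
      ψ<0 : ψ (+ h) ℤ.< 0ℤ
      ψ<0 = proj₁ (S-c (+ h)) e
      ψ>0 : 0ℤ ℤ.≤ ψ (- + h)
      ψ>0 = subst (0ℤ ℤ.≤_) (sym (ψ-odd (+ h))) (ℤₚ.neg-mono-≤ (ℤₚ.<⇒≤ ψ<0))
    ... | false = inj₂ (refl , (begin
        partSum q φ h                          ≡⟨ Fq.partSum-pos h₀ ⟩
        pos q (ψ (+ h)) + pos q (ψ (- + h))    ≡⟨ cong₂ _+_ (pos-nonneg q ψ≥0) (pos-nonpos q 0∉q ψ≤0) ⟩
        ⟦ S q (ψ (+ h)) ⟧ + 0ℤ                 ≡⟨ ℤₚ.+-identityʳ _ ⟩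
        ⟦ S q (ψ (+ h)) ⟧                      ≡⟨ cong ⟦_⟧ (S-ψ (+ h)) ⟩
        ⟦ memb h μ ⟧                           ∎))
      where
      open ≡-Reasoning
      ψ≥0 : 0ℤ ℤ.≤ ψ (+ h)
      ψ≥0 = ℤₚ.≮⇒≥ λ lt → true≢false (≡.trans (sym (proj₂ (S-c (+ h)) lt)) e)
        where
        true≢false : true ≢ false
        true≢false ()
      ψ≤0 : ψ (- + h) ℤ.≤ 0ℤ
      ψ≤0 = subst (ℤ._≤ 0ℤ) (sym (ψ-odd (+ h))) (ℤₚ.neg-mono-≤ ψ≥0)

-- Eliminating the hook sums and halving

halve : ∀ x y → x + x ≡ y + y → x ≡ y
halve x y eq = ℤₚ.*-cancelˡ-≡ (+ 2) x y (≡.trans (twice x) (≡.trans eq (sym (twice y))))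
  where
  twice : ∀ z → + 2 * z ≡ z + z
  twice = solve-∀

-- The three folds and the splitting of hooks give 2B = 2Bc + 2Bq - 2I + 2dI, and Bq = I + R turns
-- 2Bq - 2I into 2R. The equation for Bq is added twice, since every fold carries its bar count
-- twice.
combine : ∀ B Bc Bq dμ dc dP Tμ Tc Tq lμ lc lP I dI R →
  B + B + dμ ≡ Tμ + lμ → Bc + Bc + dc ≡ Tc + lc → Bq + Bq + dP ≡ Tq + lP →
  Tμ ≡ Tq + Tc → lμ + (I + I) ≡ lc + lP → dμ + (dI + dI) ≡ dc + dP → Bq ≡ I + R →
  B ≡ Bc + (R + dI)
combine B Bc Bq dμ dc dP Tμ Tc Tq lμ lc lP I dI R e₁ e₂ e₃ e₄ e₅ e₆ e₇ =
  halve B (Bc + (R + dI)) (≡-by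
    (cong₂ _+_ e₁ (cong₂ _+_ (sym e₂) (cong₂ _+_ (sym e₃) (cong₂ _+_ e₄ (cong₂ _+_ e₅ (cong₂ _+_ (sym e₆)
      (cong₂ _+_ e₇ e₇)))))))
    (ring B Bc Bq dμ dc dP Tμ Tc Tq lμ lc lP I dI R))
  where
  ring : ∀ B Bc Bq dμ dc dP Tμ Tc Tq lμ lc lP I dI R →
    Bc + (R + dI) + (Bc + (R + dI)) - (B + B) ≡
    (Tμ + lμ + (Bc + Bc + dc + (Bq + Bq + dP + (Tq + Tc + (lc + lP + (dμ + (dI + dI) + (I + R + (I + R)))))))) -
    (B + B + dμ + (Tc + lc + (Tq + lP + (Tμ + (lμ + (I + I) + (dc + dP + (Bq + Bq)))))))
  ring = solve-∀

+mult-++ : ∀ h xs ys → + mult h (xs ++ ys) ≡ + mult h xs + + mult h ys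
+mult-++ h xs ys = cong +_ (mult-++ h xs ys)

mult-double : ∀ h xs → + mult h (double xs) ≡ ∑ xs (λ x → δ (+ h) (+ (2 ℕ.* x)))
mult-double h xs = ≡.trans (mult-∑ h (double xs)) (∑-map (2 ℕ.*_) xs (λ x → δ (+ h) (+ x)))

module BarMultisets (d : ℕ) .{{_ : NonZero d}} {μ c q : List ℕ}
  (μ> : Strict μ) (μ>0 : All (0 ℕ.<_) μ)
  (c> : Strict c) (c>0 : All (0 ℕ.<_) c)
  (q> : Strict q) (q>0 : All (0 ℕ.<_) q)
  (core-μ : D c ≡ core d (D μ)) (core-q : core d (D q) ≡ [])
  (quotients : quotient d (D q) ≡ quotient d (D μ)) where

  open Slide d (charge d (D μ))
  open HookSums d μ> μ>0 c> c>0 q> q>0 core-μ core-q quotients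
  open ModifiedHooks d μ q> q>0

  private
    P̄ I : List ℕ
    P̄ = partsBar d μ q
    I = c ∩ P̄

    P̄≡ : P̄ ≡ map (λ a → ∣ φ (+ a) ∣) q
    P̄≡ = partsBar-φ φ0

    mult-P̄ : ∀ h → + mult h P̄ ≡ partSum q φ h
    mult-P̄ h = ≡.trans (cong (λ xs → + mult h xs) P̄≡)
      (≡.trans (mult-∑ h (map (λ a → ∣ φ (+ a) ∣) q)) (∑-map (λ a → ∣ φ (+ a) ∣) q (λ x → δ (+ h) (+ x))))

    double-P̄ : ∀ h → + mult h (double P̄) ≡ ∑ q (λ a → δ (+ h) (+ (2 ℕ.* ∣ φ (+ a) ∣)))
    double-P̄ h = ≡.trans (cong (λ xs → + mult h (double xs)) P̄≡)
      (≡.trans (mult-double h (map (λ a → ∣ φ (+ a) ∣) q)) (∑-map (λ a → ∣ φ (+ a) ∣) q (λ x → δ (+ h) (+ (2 ℕ.* x)))))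

    split = ∩-split c P̄
    as = proj₁ split
    bs = proj₁ (proj₂ split)
    c↭ : c ↭ I ++ as
    c↭ = proj₁ (proj₂ (proj₂ split))
    P̄↭ : P̄ ↭ I ++ bs
    P̄↭ = proj₁ (proj₂ (proj₂ (proj₂ split)))
    disjoint : ∀ {h} → h ∈ as → h ∉ bs
    disjoint = proj₂ (proj₂ (proj₂ (proj₂ split)))

    mult-c : ∀ h → mult h c ≡ mult h I ℕ.+ mult h as
    mult-c h = ≡.trans (mult-↭ h c↭) (mult-++ h I as)

    mult-P̄′ : ∀ h → mult h P̄ ≡ mult h I ℕ.+ mult h bs
    mult-P̄′ h = ≡.trans (mult-↭ h P̄↭) (mult-++ h I bs)

    mult-0 : ∀ {ν} → All (0 ℕ.<_) ν → mult 0 ν ≡ 0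
    mult-0 {ν} ν>0 = ∉⇒mult≡0 0 ν (λ 0∈ → ℕₚ.<-irrefl refl (All.lookup ν>0 0∈))

    mult-0-P̄ : mult 0 P̄ ≡ 0
    mult-0-P̄ = ∉⇒mult≡0 0 P̄ (λ 0∈ → absurd (∈-map⁻ (λ a → ∣ φ (+ a) ∣) (subst (0 ∈_) P̄≡ 0∈)))
      where
      absurd : (∃ λ a → (a ∈ q) × (0 ≡ ∣ φ (+ a) ∣)) → ⊥
      absurd (a , a∈ , eq) = ℕₚ.<-irrefl (sym a≡0) (All.lookup q>0 a∈)
        where
        a≡0 : a ≡ 0
        a≡0 = ℤₚ.+-injective (≡.trans (sym (ψφ (+ a))) (≡.trans
          (cong ψ (≡.trans (ℤₚ.∣i∣≡0⇒i≡0 {φ (+ a)} (sym eq)) (sym φ0))) (ψφ 0ℤ)))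

    one-empty : ∀ h → mult h as ≡ 0 ⊎ mult h bs ≡ 0
    one-empty h with mult h as in e
    ... | zero  = inj₁ refl
    ... | suc _ = inj₂ (∉⇒mult≡0 h bs (disjoint (mult>0⇒∈ h as e)))

    +mult : ∀ {ν} → Strict ν → ∀ h → + mult h ν ≡ ⟦ memb h ν ⟧
    +mult ν> h = mult-pos (strict⇒unique ν>) h

    cases : ∀ h → (mult h c ≡ 1 × mult h P̄ ℕ.+ mult h μ ≡ 1) ⊎ (mult h c ≡ 0 × mult h P̄ ≡ mult h μ)
    cases zero = inj₂ (mult-0 c>0 , ≡.trans mult-0-P̄ (sym (mult-0 μ>0)))
    cases (suc h₀) with AtLength.partSum-q h₀
    ... | inj₁ (e , eq) = inj₁ (ℤₚ.+-injective (≡.trans (+mult c> (suc h₀)) (cong ⟦_⟧ e)) ,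
            ℤₚ.+-injective (≡.trans (cong₂ _+_ (≡.trans (mult-P̄ (suc h₀)) eq) (+mult μ> (suc h₀)))
              (complement (memb (suc h₀) μ))))
      where
      complement : ∀ b → ⟦ not b ⟧ + ⟦ b ⟧ ≡ 1ℤ
      complement true  = refl
      complement false = refl
    ... | inj₂ (e , eq) = inj₂ (ℤₚ.+-injective (≡.trans (+mult c> (suc h₀)) (cong ⟦_⟧ e)) ,
            ℤₚ.+-injective (≡.trans (mult-P̄ (suc h₀)) (≡.trans eq (sym (+mult μ> (suc h₀))))))

  -- Length by length λ is the symmetric difference of c and P̄, so adding the intersection twice
  -- restores both. The doubled version follows by mapping.
  parts-↭ : μ ++ (I ++ I) ↭ c ++ P̄
  parts-↭ = mult≡⇒↭ (μ ++ (I ++ I)) (c ++ P̄) same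
    where
    same : ∀ h → mult h (μ ++ (I ++ I)) ≡ mult h (c ++ P̄)
    same h rewrite mult-++ h μ (I ++ I) | mult-++ h I I | mult-++ h c P̄ | mult-c h | mult-P̄′ h =
      symmetric-difference (mult h I) (mult h as) (mult h bs) (mult h μ) (one-empty h)
        (subst₂ (λ x y → (x ≡ 1 × y ℕ.+ mult h μ ≡ 1) ⊎ (x ≡ 0 × y ≡ mult h μ)) (mult-c h) (mult-P̄′ h) (cases h))

  private
    rest : List ℕ
    rest = bs ++ map (modHook d μ q) (BNodes d q)

    -- The intersection lies in P̄, which is a segment of the modified bars, so removing it in the
    -- definition of the right-hand side is a genuine difference.
    barsBar↭ : barsBar d μ q ↭ I ++ rest
    barsBar↭ = ↭-trans (↭-reflexive (map-++ (modHook d μ q) (PNodes d q) (BNodes d q)))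
      (↭-trans (↭ₚ.++⁺ʳ _ P̄↭) (↭ₚ.++-assoc I bs _))

    mult-bars : ∀ {ν} → Strict ν → All (0 ℕ.<_) ν → ∀ h → + mult h (bars ν) ≡ barSum ν (λ x → x) h
    mult-bars {ν} ν> ν>0 h = ≡.trans (cong +_ (mult-↭ h (bars-↭ ν> ν>0))) (mult-barList h ν (λ x → x))

    doubles : ∀ h → + mult h (double μ) + (+ mult h (double I) + + mult h (double I)) ≡
      + mult h (double c) + + mult h (double P̄)
    doubles h = begin
      + mult h (double μ) + (+ mult h (double I) + + mult h (double I))
        ≡⟨ cong (_+_ (+ mult h (double μ))) (sym (≡.trans (cong (+_ ∘ mult h) (map-++ (2 ℕ.*_) I I)) (+mult-++ h (double I) (double I)))) ⟩
      + mult h (double μ) + + mult h (double (I ++ I))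
        ≡⟨ sym (≡.trans (cong (+_ ∘ mult h) (map-++ (2 ℕ.*_) μ (I ++ I))) (+mult-++ h (double μ) (double (I ++ I)))) ⟩
      + mult h (double (μ ++ (I ++ I)))
        ≡⟨ cong +_ (mult-↭ h (↭ₚ.map⁺ (2 ℕ.*_) parts-↭)) ⟩
      + mult h (double (c ++ P̄))
        ≡⟨ ≡.trans (cong (+_ ∘ mult h) (map-++ (2 ℕ.*_) c P̄)) (+mult-++ h (double c) (double P̄)) ⟩
      + mult h (double c) + + mult h (double P̄) ∎
      where open ≡-Reasoning

    singles : ∀ h → + mult h μ + (+ mult h I + + mult h I) ≡ + mult h c + + mult h P̄
    singles h = ≡.trans (sym (≡.trans (+mult-++ h μ (I ++ I)) (cong (_+_ (+ mult h μ)) (+mult-++ h I I))))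
      (≡.trans (cong +_ (mult-↭ h parts-↭)) (+mult-++ h c P̄))

    mult-barsBar-split : ∀ h → + mult h (barsBar d μ q) ≡ + mult h I + + mult h rest
    mult-barsBar-split h = ≡.trans (cong +_ (mult-↭ h barsBar↭)) (+mult-++ h I rest)

    equation : ∀ h → + mult h (bars μ) ≡ + mult h (bars c) + (+ mult h rest + + mult h (double I))
    -- Folding covers positive lengths only; at length 0 every multiplicity vanishes.
    equation zero = ≡.trans (≡.trans (mult-bars μ> μ>0 0) (barSum-0 {μ} (λ x → x) (λ x → x) (λ _ → refl)))
      (sym (cong₂ _+_ (≡.trans (mult-bars c> c>0 0) (barSum-0 {c} (λ x → x) (λ x → x) (λ _ → refl)))
        (cong₂ _+_ (cong +_ rest-0) (cong +_ I-0))))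
      where
      rest-0 : mult 0 rest ≡ 0
      rest-0 = ℕₚ.m+n≡0⇒n≡0 (mult 0 I) (ℤₚ.+-injective (≡.trans (sym (mult-barsBar-split 0))
        (≡.trans (mult-barsBar 0) (barSum-0 {q} φ ψ ψφ))))
      I-0 : mult 0 (double I) ≡ 0
      I-0 = ∉⇒mult≡0 0 (double I) (λ 0∈ → absurd (∈-map⁻ (2 ℕ.*_) 0∈))
        where
        absurd : (∃ λ a → (a ∈ I) × (0 ≡ 2 ℕ.* a)) → ⊥
        absurd (zero , a∈ , _) = ℕₚ.<-irrefl refl (All.lookup c>0 (↭ₚ.∈-resp-↭ (↭-sym c↭) (∈-++⁺ˡ a∈)))
    equation (suc h₀) = combine
      (+ mult h (bars μ)) (+ mult h (bars c)) (+ mult h (barsBar d μ q))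
      (+ mult h (double μ)) (+ mult h (double c)) (+ mult h (double P̄))
      Tμ Tc Tq (+ mult h μ) (+ mult h c) (+ mult h P̄) (+ mult h I) (+ mult h (double I)) (+ mult h rest)
      (≡.trans (cong₂ _+_ (cong₂ _+_ (mult-bars μ> μ>0 h) (mult-bars μ> μ>0 h)) (mult-double h μ))
        (≡.trans fold-μ (cong (_+_ Tμ) (sym (mult-∑ h μ)))))
      (≡.trans (cong₂ _+_ (cong₂ _+_ (mult-bars c> c>0 h) (mult-bars c> c>0 h)) (mult-double h c))
        (≡.trans fold-c (cong (_+_ Tc) (sym (mult-∑ h c)))))
      (≡.trans (cong₂ _+_ (cong₂ _+_ (mult-barsBar h) (mult-barsBar h)) (double-P̄ h))
        (≡.trans fold-q (cong (_+_ Tq) (sym (mult-P̄ h)))))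
      hooks (singles h) (doubles h) (mult-barsBar-split h)
      where open AtLength h₀

  bars-split : bars μ ↭ bars c ++ barsTilde d μ c q
  bars-split = ↭-trans (mult≡⇒↭ (bars μ) (bars c ++ (rest ++ double I)) (λ h → ℤₚ.+-injective
      (≡.trans (equation h) (sym (≡.trans (+mult-++ h (bars c) (rest ++ double I))
        (cong (_+_ (+ mult h (bars c))) (+mult-++ h rest (double I))))))))
    (↭ₚ.++⁺ˡ (bars c) (↭ₚ.++⁺ʳ (double I) (↭-sym (∖-↭ I barsBar↭))))

strict : ∀ {μ} → IsBarPartition μ → Strict μ
strict (linked , _) = Linked⇒AllPairs (λ p q → ℕₚ.<-trans q p) linked

theorem4p1 : (d : ℕ) .{{_ : NonZero d}} → 3 ≤ d → d % 2 ≡ 1 →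
    (λ' c q : List ℕ) → IsBarPartition λ' →
    IsBarCore d λ' c → IsBarQuotient d λ' q →
    bars λ' ↭ (bars c ++ barsTilde d λ' c q)
theorem4p1 d _ _ λ' c q hλ (hc , core-λ) (hq , core-q , quotients) =
  BarMultisets.bars-split d (strict hλ) (proj₂ hλ) (strict hc) (proj₂ hc) (strict hq) (proj₂ hq) core-λ core-q quotients
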